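{- Let $k$ be a field of characteristic zero and fix positive integers $r$ and $d$. Then every monomial Artinian level algebra $k[x_1,\dots,x_r]/I$ of codimension $r$ and type $d$ has the Weak Lefschetz Property if and only if at least one of the following holds: (a) $r=1$ or $r=2$; (b) $d=1$; (c) $r=3$ and $d=2$. Furthermore, every monomial Artinian level algebra of codimension $r$ and type $d$ has the Strong Lefschetz Property if and only if (a) or (b) holds.
   Context: $I\subset R=k[x_1,\dots,x_r]$ is a monomial ideal containing no linear forms with $R/I$ Artinian (so $R/I$ has codimension $r$). $A=R/I$ is level of type $d$ if its socle (annihilator of the homogeneous maximal ideal) has dimension $d$ and is concentrated in a single degree. $A$ has the Weak Lefschetz Property (WLP) if there is a linear form $L$ such that $\times L:A_j\to A_{j+1}$ has maximal rank (injective or surjective) for all $j$, and the Strong Lefschetz Property (SLP) if there is a linear form $L$ such that $\times L^s:A_j\to A_{j+s}$ has maximal rank for all $j$ and all $s\ge1$. -}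

module Defs where

open import Level using (Level; _⊔_) renaming (suc to lsuc)
open import Algebra.Bundles using (CommutativeRing)
open import Data.Nat using (ℕ; zero; suc; _≤_) renaming (_+_ to _+ℕ_)
open import Data.Fin using (Fin)
import Data.Fin as Fin
open import Data.Vec using (Vec; lookup; _[_]≔_)
import Data.Vec as Vec
open import Data.List using (List)
open import Data.List.Relation.Unary.Any using (Any)
open import Data.List.Relation.Unary.All using (All)
open import Data.Vec.Relation.Binary.Pointwise.Inductive using (Pointwise)
open import Data.Product using (Σ; ∃; _×_)
open import Data.Sum using (_⊎_)
open import Relation.Nullary using (¬_)
open import Relation.Binary.PropositionalEquality using (_≡_)

record Field (c ℓ : Level) : Set (lsuc (c ⊔ ℓ)) where
  field
    commutativeRing : CommutativeRing c ℓ
  open CommutativeRing commutativeRing public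
  field
    1≉0     : ¬ (1# ≈ 0#)
    inverse : ∀ x → ¬ (x ≈ 0#) → Σ Carrier (λ y → (x * y) ≈ 1#)

module _ {c ℓ} (K : Field c ℓ) where
  open Field K

  fromℕ : ℕ → Carrier
  fromℕ zero    = 0#
  fromℕ (suc n) = 1# + fromℕ n

  CharZero : Set ℓ
  CharZero = ∀ n → ¬ (fromℕ (suc n) ≈ 0#)

  sumFin : ∀ n → (Fin n → Carrier) → Carrier
  sumFin zero    f = 0#
  sumFin (suc n) f = f Fin.zero + sumFin n (λ i → f (Fin.suc i))


-- Monomials of R = k[x_1,...,x_r] are exponent vectors  b : Vec ℕ r.

deg : ∀ {r} → Vec ℕ r → ℕ
deg b = Vec.sum b

_∣ₘ_ : ∀ {r} → Vec ℕ r → Vec ℕ r → Set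
g ∣ₘ b = Pointwise _≤_ g b

-- A monomial ideal I is given by a finite list of monomial generators;
-- a monomial x^b lies in I iff some generator divides it.
Gens : ℕ → Set
Gens r = List (Vec ℕ r)

_∈I_ : ∀ {r} → Vec ℕ r → Gens r → Set
b ∈I gs = Any (λ g → g ∣ₘ b) gs

-- standard monomials: monomials not in I; they form a k-basis of R/I
Standard : ∀ {r} → Gens r → Vec ℕ r → Set
Standard gs b = ¬ (b ∈I gs)

-- I contains no linear forms (in particular I is proper): every
-- generator has degree ≥ 2
NoLinearForms : ∀ {r} → Gens r → Set
NoLinearForms gs = All (λ g → 2 ≤ deg g) gs

-- R/I Artinian (= finite-dimensional over k): all monomials of
-- sufficiently large degree lie in I
Artinian : ∀ {r} → Gens r → Set
Artinian {r} gs = ∃ λ D → ∀ (b : Vec ℕ r) → D ≤ deg b → b ∈I gs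

-- The algebra A = R/I over the field K, as the vector space K^{standard
-- monomials}.  An element is represented by a coefficient function
-- f : Vec ℕ r → K; only its values on standard monomials matter.

module Algebra {c ℓ} (K : Field c ℓ) {r : ℕ} (gs : Gens r) where
  open Field K

  Elt : Set c
  Elt = Vec ℕ r → Carrier

  _≈A_ : Elt → Elt → Set ℓ
  f ≈A g = ∀ b → Standard gs b → f b ≈ g b

  zeroA : Elt
  zeroA _ = 0#

  InDeg : ℕ → Elt → Set ℓ
  InDeg j f = ∀ b → Standard gs b → ¬ (deg b ≡ j) → f b ≈ 0#

  mulVar : Fin r → Elt → Elt
  mulVar i f b with lookup b i
  ... | zero  = 0#
  ... | suc n = f (b [ i ]≔ n)

  mulL : (Fin r → Carrier) → Elt → Elt
  mulL L f b = sumFin K r (λ i → L i * mulVar i f b)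

  mulLPow : (Fin r → Carrier) → ℕ → Elt → Elt
  mulLPow L zero    f = f
  mulLPow L (suc s) f = mulL L (mulLPow L s f)

  Injective : (Fin r → Carrier) → ℕ → ℕ → Set (c ⊔ ℓ)
  Injective L s j = ∀ f → InDeg j f → mulLPow L s f ≈A zeroA → f ≈A zeroA

  Surjective : (Fin r → Carrier) → ℕ → ℕ → Set (c ⊔ ℓ)
  Surjective L s j = ∀ g → InDeg (j +ℕ s) g →
                     Σ Elt (λ f → InDeg j f × (mulLPow L s f ≈A g))

  MaxRank : (Fin r → Carrier) → ℕ → ℕ → Set (c ⊔ ℓ)
  MaxRank L s j = Injective L s j ⊎ Surjective L s j

  WLP : Set (c ⊔ ℓ)
  WLP = Σ (Fin r → Carrier) λ L → ∀ j → MaxRank L 1 j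

  SLP : Set (c ⊔ ℓ)
  SLP = Σ (Fin r → Carrier) λ L → ∀ j s → 1 ≤ s → MaxRank L s j

  InSocle : Elt → Set ℓ
  InSocle f = ∀ i → mulVar i f ≈A zeroA

  lin : ∀ {d} → (Fin d → Carrier) → (Fin d → Elt) → Elt
  lin {d} a v b = sumFin K d (λ k → a k * v k b)

  SocleDim : ℕ → Set (c ⊔ ℓ)
  SocleDim d = Σ (Fin d → Elt) λ v →
      (∀ k → InSocle (v k))
    × (∀ a → lin a v ≈A zeroA → ∀ k → a k ≈ 0#)
    × (∀ f → InSocle f → Σ (Fin d → Carrier) λ a → f ≈A lin a v)

  IsLevel : ℕ → Set (c ⊔ ℓ)
  IsLevel d = SocleDim d × (∃ λ e → ∀ f → InSocle f → InDeg e f)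

MonomialArtinianLevel : ∀ {c ℓ} (K : Field c ℓ) (r d : ℕ) → Gens r → Set (c ⊔ ℓ)
MonomialArtinianLevel K r d gs =
  NoLinearForms gs × Artinian gs × Algebra.IsLevel K gs d

{-# OPTIONS --safe #-}

-- Positive part. Take L = x₁ + ⋯ + xᵣ. In the monomial bases the powers of L have integer matrices, so it
-- suffices that over ℤ either the matrix or its transpose has zero kernel: elimination then gives a one-sided
-- inverse over every field of characteristic zero.
--  * r = 2: up to signs, the kernel of the transpose of Lˢ consists of polynomials of degree < s vanishing at all
--    nonstandard exponents, and Lˢ f is orthogonal to all polynomials of degree < s.
--  * d = 1: the standard monomials are the divisors of one monomial, and L belongs to an sl₂-triple.
--  * r = 3, d = 2: the standard monomials fill two boxes. Slicing along one variable turns both kernels into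
--    polynomials in one integer variable, with runs of zeros on both sides, such that a higher difference has
--    longer runs of zeros. Pairing that difference with a suitable multiple of itself gives a vanishing sum of
--    nonnegative terms, which kills one of the two kernels.
-- Negative part. If f = Σ f_b x^b is killed by x₁ + ⋯ + xᵣ, then Σ f_b ∏ (Lᵢ + t)^bᵢ x^b is killed by
-- Σ (Lᵢ + t) xᵢ, and its lowest coefficient in t is killed by Σ Lᵢ xᵢ; likewise for functionals. So integer
-- witnesses for x₁ + ⋯ + xᵣ refute maximal rank for every L. For d ≥ 3 they come from a large part of k[x, y] next
-- to one further monomial; for d = 2 from one algebra in three variables on which L³ fails, by adjoining variables.
module Submission where

open import Defs
open import Data.Nat as ℕ using (ℕ; zero; suc; _≤_; _<_; z≤n; s≤s; _∸_; _⊓_)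
import Data.Nat.Properties as ℕₚ
open import Data.Nat.Induction using (<-rec)
import Data.Nat.Tactic.RingSolver as ℕSolver
open import Data.Integer as ℤ using (ℤ; +_; -[1+_]; _⊖_)
import Data.Integer.Properties as ℤₚ
import Data.Integer.Tactic.RingSolver as ℤSolver
open import Data.Fin using (Fin; zero; suc)
open import Data.Vec as Vec using (Vec; []; _∷_; lookup; _[_]≔_)
import Data.Vec.Properties as Vecₚ
import Data.Vec.Relation.Unary.All as VAll
open import Data.Vec.Relation.Binary.Pointwise.Inductive as PW using ([]; _∷_)
open import Data.List as List using (List; []; _∷_; filter; length; upTo; cartesianProductWith)
import Data.List.Properties as Listₚ
open import Data.List.Relation.Unary.Any as Any using (Any; here; there)
import Data.List.Relation.Unary.Any.Properties as Anyₚ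
open import Data.List.Relation.Unary.All as All using (All; []; _∷_)
import Data.List.Relation.Unary.All.Properties as Allₚ
open import Data.List.Relation.Unary.AllPairs using ([]; _∷_)
open import Data.List.Relation.Unary.Unique.Propositional using (Unique)
import Data.List.Relation.Unary.Unique.Propositional.Properties as Uniqueₚ
open import Data.List.Membership.Propositional using (_∈_; lose; find)
open import Data.List.Membership.Propositional.Properties using (∈-cartesianProductWith⁺; ∈-upTo⁺; ∈-upTo⁻; ∈-filter⁺; ∈-filter⁻; ∈-lookup; ∈-map⁺)
open import Data.Product using (Σ; ∃; _×_; _,_; proj₁; proj₂)
open import Data.Sum as Sum using (_⊎_; inj₁; inj₂; [_,_]′)
open import Data.Empty using (⊥; ⊥-elim)
open import Data.Unit using (tt)
open import Function.Bundles using (_⇔_; mk⇔)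
open import Level using (_⊔_)
open import Relation.Nullary using (¬_; Dec; yes; no; contradiction; ¬?; _×-dec_)
open import Relation.Nullary.Decidable using (decidable-stable; _→-dec_; toWitness)
open import Relation.Binary.PropositionalEquality as ≡ using (_≡_; _≢_)

-- Equality in `K` need not be decidable, while `MaxRank` demands a definite answer: a zero kernel
-- or a preimage of every target. Hence no rank is ever computed over `K`. Over ℤ a pivot can be
-- searched for, and elimination ends with a nonzero integer D such that D times each unit vector is
-- an integer combination of rows. Such a certificate survives in `K`; taken for the matrix it gives
-- injectivity, for the transpose surjectivity.
--
-- The negative part cannot simply rescale the variables by the coefficients of L, since some of
-- these may be zero. This is why t enters: every Lᵢ + t is monic in t, so no rescaling factor can
-- destroy a witness.
--
-- For two boxes the obvious zeros of the polynomials involved are in some degrees too few, and the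
-- positivity argument has to make up for the missing ones. Equality of the socle degrees makes the
-- excess of one box in one direction the sum of the excesses of the other box in the remaining two;
-- this places both slice functions of the injectivity problem on windows of the same length. The
-- numerical conditions for the two kernels then exhaust all cases.

-- Fraction-free linear algebra over ℤ.

module IntegerElimination where
  open import Data.Fin.Properties using (any?)
  open import Algebra.Properties.Semiring.Sum ℤₚ.+-*-semiring using (sum; sum-cong-≋; ∑-distrib-+; *-distribˡ-sum; sum-replicate-zero) public
  open import Data.Integer using (_+_; _*_; -_; _≟_)
  open ℤₚ using (+-identityˡ; +-identityʳ; *-zeroʳ; *-zeroˡ; *-identityʳ; *-comm; i*j≡0⇒i≡0∨j≡0)
  open ℤSolver using (solve-∀)
  open ≡ using (refl; sym; trans; cong; cong₂; module ≡-Reasoning)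

  kronecker : ∀ {n} → Fin n → Fin n → ℤ
  kronecker zero    zero    = + 1
  kronecker zero    (suc _) = + 0
  kronecker (suc _) zero    = + 0
  kronecker (suc k) (suc l) = kronecker k l

  sum-zero : ∀ {n} (f : Fin n → ℤ) → (∀ l → f l ≡ + 0) → sum f ≡ + 0
  sum-zero {n} f f≡0 = trans (sum-cong-≋ f≡0) (sum-replicate-zero n)

  sum-kronecker : ∀ {n} (c : Fin n → ℤ) l → sum (λ k → c k * kronecker k l) ≡ c l
  sum-kronecker c zero = trans (cong₂ _+_ (*-identityʳ (c zero)) (sum-zero _ (λ k → *-zeroʳ (c (suc k))))) (+-identityʳ _)
  sum-kronecker c (suc l) = trans (cong₂ _+_ (*-zeroʳ (c zero)) (sum-kronecker (λ k → c (suc k)) l)) (+-identityˡ _)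

  sum-linear : ∀ {n} a b (f g : Fin n → ℤ) → sum (λ l → a * f l + b * g l) ≡ a * sum f + b * sum g
  sum-linear a b f g = trans (∑-distrib-+ (λ l → a * f l) (λ l → b * g l))
    (sym (cong₂ _+_ (*-distribˡ-sum a f) (*-distribˡ-sum b g)))

  product≢0 : ∀ {a b} → a ≢ + 0 → b ≢ + 0 → a * b ≢ + 0
  product≢0 {a} a≢0 b≢0 ab≡0 = [ a≢0 , b≢0 ]′ (i*j≡0⇒i≡0∨j≡0 a ab≡0)

  _·_ : ∀ {n} → (Fin n → ℤ) → (Fin n → ℤ) → ℤ
  u · x = sum (λ l → u l * x l)

  -- An inductive span instead of a vector of coefficients, so that facts about rows pass to the
  -- span by recursion, over ℤ and later over a field. `respect` stands in for function
  -- extensionality.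
  data Span {m n} (M : Fin m → Fin n → ℤ) : (Fin n → ℤ) → Set where
    row     : ∀ k → Span M (M k)
    null    : Span M (λ _ → + 0)
    combine : ∀ a b {u v} → Span M u → Span M v → Span M (λ l → a * u l + b * v l)
    respect : ∀ {u v} → (∀ l → u l ≡ v l) → Span M u → Span M v

  Singular : ∀ {m n} → (Fin m → Fin n → ℤ) → Set
  Singular {n = n} M = Σ (Fin n → ℤ) λ x → (∃ λ l → x l ≢ + 0) × (∀ k → M k · x ≡ + 0)

  -- The rational row space is everything, with one common denominator `D`. Only `D` will have to be
  -- inverted in a field, and characteristic zero allows that.
  FullRowSpan : ∀ {m n} → (Fin m → Fin n → ℤ) → Set
  FullRowSpan M = Σ ℤ λ D → D ≢ + 0 × (∀ l → Span M (λ l′ → D * kronecker l l′))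

  span-sum : ∀ {m n k} {M : Fin m → Fin n → ℤ} (c : Fin k → ℤ) (v : Fin k → Fin n → ℤ) →
    (∀ i → Span M (v i)) → Span M (λ l → sum (λ i → c i * v i l))
  span-sum {k = zero}  c v sp = null
  span-sum {k = suc k} c v sp = respect (λ l → solve-one (c zero * v zero l) _)
    (combine (c zero) (+ 1) (sp zero) (span-sum (λ i → c (suc i)) (λ i → v (suc i)) (λ i → sp (suc i))))
    where
    solve-one : ∀ x y → x + + 1 * y ≡ x + y
    solve-one = solve-∀

  module Pivot {m n} (M : Fin m → Fin (suc n) → ℤ) (i : Fin m) where

    a : ℤ
    a = M i zero

    reduced : Fin m → Fin n → ℤ
    reduced k l = a * M k (suc l) + (- M k zero) * M i (suc l)

    pad : ℤ → (Fin n → ℤ) → Fin (suc n) → ℤ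
    pad x v zero    = x
    pad x v (suc l) = v l

    lift-span : ∀ {v} → Span reduced v → Span M (pad (+ 0) v)
    lift-span (row k) = respect (λ { zero → cancel a (M k zero) ; (suc l) → refl }) (combine a (- M k zero) (row k) (row i))
      where
      cancel : ∀ x y → x * y + (- y) * x ≡ + 0
      cancel = solve-∀
    lift-span null = respect (λ { zero → refl ; (suc l) → refl }) null
    lift-span (combine b c su sv) = respect (λ { zero → cong₂ _+_ (*-zeroʳ b) (*-zeroʳ c) ; (suc l) → refl }) (combine b c (lift-span su) (lift-span sv))
    lift-span (respect eq su) = respect (λ { zero → refl ; (suc l) → eq l }) (lift-span su)

    -- Back substitution without division: row `i` would put `- s i / a` in the pivot column, so the
    -- whole vector is multiplied by `a`.
    lift-kernel : a ≢ + 0 → Singular reduced → Singular M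
    lift-kernel a≢0 (x , (l₀ , x≢0) , ker) = y , (suc l₀ , product≢0 a≢0 x≢0) , λ k → begin
        M k zero * (- (s i)) + sum (λ l → M k (suc l) * (a * x l))
          ≡⟨ cong₂ _+_ (refl {x = M k zero * (- (s i))}) (trans (sum-cong-≋ (λ l → swap (M k (suc l)) a (x l))) (sym (*-distribˡ-sum a (λ l → M k (suc l) * x l)))) ⟩
        M k zero * (- (s i)) + a * s k
          ≡⟨ arrange (M k zero) (s i) (a * s k) ⟩
        a * s k + (- M k zero) * s i
          ≡⟨ sum-linear a (- M k zero) (λ l → M k (suc l) * x l) (λ l → M i (suc l) * x l) ⟨
        sum (λ l → a * (M k (suc l) * x l) + (- M k zero) * (M i (suc l) * x l))
          ≡⟨ sum-cong-≋ (λ l → factor a (M k (suc l)) (x l) (- M k zero) (M i (suc l))) ⟩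
        reduced k · x
          ≡⟨ ker k ⟩
        + 0 ∎
      where
      open ≡-Reasoning
      s : Fin m → ℤ
      s k = sum (λ l → M k (suc l) * x l)
      y : Fin (suc n) → ℤ
      y zero    = - (s i)
      y (suc l) = a * x l
      swap : ∀ u v w → u * (v * w) ≡ v * (u * w)
      swap = solve-∀
      arrange : ∀ u v w → u * (- v) + w ≡ w + (- u) * v
      arrange = solve-∀
      factor : ∀ a u x b v → a * (u * x) + b * (v * x) ≡ (a * u + b * v) * x
      factor = solve-∀

    -- `D` times row `i`, minus the combination of lifted unit vectors that equals its tail, leaves
    -- `a * D` in the pivot column alone. The other unit vectors are multiplied by `a` only to share
    -- this denominator.
    lift-full : a ≢ + 0 → FullRowSpan reduced → FullRowSpan M
    lift-full a≢0 (D , D≢0 , sp) = a * D , product≢0 a≢0 D≢0 , λ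
      { zero    → respect first (combine D (- (+ 1)) (row i) tailSpan)
      ; (suc l) → respect (other l) (combine a (+ 0) (lift-span (sp l)) null) }
      where
      tailSpan : Span M (pad (+ 0) (λ l → D * M i (suc l)))
      tailSpan = respect (λ { zero → sum-zero _ (λ l → *-zeroʳ (M i (suc l))) ; (suc l) → eq l })
        (span-sum (λ l → M i (suc l)) (λ l → pad (+ 0) (λ l′ → D * kronecker l l′)) (λ l → lift-span (sp l)))
        where
        swap : ∀ u v w → u * (v * w) ≡ v * (u * w)
        swap = solve-∀
        eq : ∀ l → sum (λ k → M i (suc k) * (D * kronecker k l)) ≡ D * M i (suc l)
        eq l = trans (sum-cong-≋ (λ k → swap (M i (suc k)) D (kronecker k l)))
          (trans (sym (*-distribˡ-sum D (λ k → M i (suc k) * kronecker k l))) (cong (D *_) (sum-kronecker (λ k → M i (suc k)) l)))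
      first : ∀ l → D * M i l + (- (+ 1)) * pad (+ 0) (λ l → D * M i (suc l)) l ≡ a * D * kronecker zero l
      first zero = go D a where
        go : ∀ x y → x * y + (- (+ 1)) * (+ 0) ≡ y * x * + 1
        go = solve-∀
      first (suc l) = go (D * M i (suc l)) (a * D) where
        go : ∀ x y → x + (- (+ 1)) * x ≡ y * + 0
        go = solve-∀
      other : ∀ k l → a * pad (+ 0) (λ l′ → D * kronecker k l′) l + + 0 * + 0 ≡ a * D * kronecker (suc k) l
      other k zero = go a (a * D) where
        go : ∀ x y → x * + 0 + + 0 * + 0 ≡ y * + 0
        go = solve-∀
      other k (suc l) = go a D (kronecker k l) where
        go : ∀ x y z → x * (y * z) + + 0 * + 0 ≡ x * y * z
        go = solve-∀

  eliminate : ∀ {m} n (M : Fin m → Fin n → ℤ) → Singular M ⊎ FullRowSpan M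
  eliminate zero    M = inj₂ (+ 1 , (λ ()) , λ ())
  eliminate (suc n) M with any? (λ i → ¬? (M i zero ≟ + 0))
  ... | no noPivot = inj₁ (kronecker zero , (zero , λ ()) , λ k →
          trans (sum-cong-≋ (λ l → *-comm (M k l) (kronecker zero l)))
          (trans (sum-cong-≋ (λ l → entry k l)) (sum-zero {suc n} (λ _ → + 0) (λ _ → refl))))
    where
    entry : ∀ k l → kronecker zero l * M k l ≡ + 0
    entry k zero    = cong (+ 1 *_) (decidable-stable (M k zero ≟ + 0) (λ ne → noPivot (k , ne)))
    entry k (suc l) = *-zeroˡ (M k (suc l))
  ... | yes (i , a≢0) with eliminate n (Pivot.reduced M i)
  ...   | inj₁ singular = inj₁ (Pivot.lift-kernel M i a≢0 singular)
  ...   | inj₂ full     = inj₂ (Pivot.lift-full M i a≢0 full)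

  injective⇒fullRowSpan : ∀ {m n} (M : Fin m → Fin n → ℤ) →
    (∀ x → (∀ k → M k · x ≡ + 0) → ∀ l → x l ≡ + 0) → FullRowSpan M
  injective⇒fullRowSpan {n = n} M inj with eliminate n M
  ... | inj₁ (x , (l , x≢0) , ker) = contradiction (inj x ker l) x≢0
  ... | inj₂ full = full

-- Integer coefficient functions, multiplication by the sum of the variables and its transpose.

module IntegerOperators where
  open import Data.Integer using (_+_; _*_)
  open ℤₚ using (+-identityˡ; *-zeroʳ)
  open ℤSolver using (solve-∀)
  open ≡ using (refl; sym; trans; cong; cong₂)

  +-right : ∀ x {y z} → y ≡ z → x + y ≡ x + z
  +-right x = cong (λ y → x + y)

  Fn : ℕ → Set
  Fn r = Vec ℕ r → ℤ

  DownClosed : ∀ {r} → (Vec ℕ r → Set) → Set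
  DownClosed P = ∀ {a b} → a ∣ₘ b → P b → P a

  ∣ₘ-refl : ∀ {r} {b : Vec ℕ r} → b ∣ₘ b
  ∣ₘ-refl = PW.refl ℕₚ.≤-refl

  ∣ₘ-trans : ∀ {r} {a b c : Vec ℕ r} → a ∣ₘ b → b ∣ₘ c → a ∣ₘ c
  ∣ₘ-trans = PW.trans ℕₚ.≤-trans

  prev : (ℕ → ℤ) → ℕ → ℤ
  prev g zero    = + 0
  prev g (suc x) = g x

  -- Multiplication by x₁ + ⋯ + xᵣ on coefficient functions, and its transpose.
  E : ∀ {r} → Fn r → Fn r
  E f []      = + 0
  E f (x ∷ b) = prev (λ y → f (y ∷ b)) x + E (λ b′ → f (x ∷ b′)) b

  D : ∀ {r} → Fn r → Fn r
  D f []      = + 0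
  D f (x ∷ b) = f (suc x ∷ b) + D (λ b′ → f (x ∷ b′)) b

  E^ : ∀ {r} → ℕ → Fn r → Fn r
  E^ zero    f = f
  E^ (suc s) f = E (E^ s f)

  -- Unlike in `E^`, the single step is applied first: transposition reverses the order of a
  -- product, and with this order `E^-δ` goes through by induction.
  D^ : ∀ {r} → ℕ → Fn r → Fn r
  D^ zero    f = f
  D^ (suc s) f = D^ s (D f)

  -- Multiplication is well defined modulo a monomial ideal: at `b` it reads only divisors of `b`,
  -- and divisors of standard exponents are standard.
  E-cong-on : ∀ {r} {P : Vec ℕ r → Set} → DownClosed P → ∀ {f g} →
    (∀ b → P b → f b ≡ g b) → ∀ b → P b → E f b ≡ E g b
  E-cong-on dc eq [] pb = refl
  E-cong-on {P = P} dc eq (zero ∷ b) pb =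
    +-right (+ 0) (E-cong-on {P = λ b′ → P (zero ∷ b′)} (λ ab → dc (z≤n ∷ ab)) (λ b′ → eq (zero ∷ b′)) b pb)
  E-cong-on {P = P} dc eq (suc x ∷ b) pb =
    cong₂ _+_ (eq (x ∷ b) (dc (ℕₚ.n≤1+n x ∷ ∣ₘ-refl) pb))
      (E-cong-on {P = λ b′ → P (suc x ∷ b′)} (λ ab → dc (ℕₚ.≤-refl ∷ ab)) (λ b′ → eq (suc x ∷ b′)) b pb)

  E^-cong-on : ∀ {r} {P : Vec ℕ r → Set} → DownClosed P → ∀ s {f g} →
    (∀ b → P b → f b ≡ g b) → ∀ b → P b → E^ s f b ≡ E^ s g b
  E^-cong-on dc zero    eq = eq
  E^-cong-on dc (suc s) eq = E-cong-on dc (E^-cong-on dc s eq)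

  E-cong : ∀ {r} {f g : Fn r} → (∀ b → f b ≡ g b) → ∀ b → E f b ≡ E g b
  E-cong eq [] = refl
  E-cong eq (zero ∷ b) = +-right (+ 0) (E-cong (λ b′ → eq (zero ∷ b′)) b)
  E-cong eq (suc x ∷ b) = cong₂ _+_ (eq (x ∷ b)) (E-cong (λ b′ → eq (suc x ∷ b′)) b)

  D-cong : ∀ {r} {f g : Fn r} → (∀ b → f b ≡ g b) → ∀ b → D f b ≡ D g b
  D-cong eq []      = refl
  D-cong eq (x ∷ b) = cong₂ _+_ (eq (suc x ∷ b)) (D-cong (λ b′ → eq (x ∷ b′)) b)

  E^-cong : ∀ {r} s {f g : Fn r} → (∀ b → f b ≡ g b) → ∀ b → E^ s f b ≡ E^ s g b
  E^-cong zero    eq = eq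
  E^-cong (suc s) eq = E-cong (E^-cong s eq)

  D^-cong : ∀ {r} s {f g : Fn r} → (∀ b → f b ≡ g b) → ∀ b → D^ s f b ≡ D^ s g b
  D^-cong zero    eq = eq
  D^-cong (suc s) eq = D^-cong s (D-cong eq)

  interchange : ∀ p q u v w x → p * u + q * v + (p * w + q * x) ≡ p * (u + w) + q * (v + x)
  interchange = solve-∀

  E-linear : ∀ {r} a b (f g : Fn r) v → E (λ v → a * f v + b * g v) v ≡ a * E f v + b * E g v
  E-linear a b f g [] = sym (cong₂ _+_ (*-zeroʳ a) (*-zeroʳ b))
  E-linear a b f g (zero ∷ v) = trans (+-right (+ 0) (E-linear a b (λ w → f (zero ∷ w)) (λ w → g (zero ∷ w)) v))
    (go a b (E (λ w → f (zero ∷ w)) v) (E (λ w → g (zero ∷ w)) v))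
    where
    go : ∀ a b x y → + 0 + (a * x + b * y) ≡ a * (+ 0 + x) + b * (+ 0 + y)
    go = solve-∀
  E-linear a b f g (suc x ∷ v) = trans (+-right (a * f (x ∷ v) + b * g (x ∷ v)) (E-linear a b (λ w → f (suc x ∷ w)) (λ w → g (suc x ∷ w)) v))
    (interchange a b (f (x ∷ v)) (g (x ∷ v)) _ _)

  D-linear : ∀ {r} a b (f g : Fn r) v → D (λ v → a * f v + b * g v) v ≡ a * D f v + b * D g v
  D-linear a b f g [] = sym (cong₂ _+_ (*-zeroʳ a) (*-zeroʳ b))
  D-linear a b f g (x ∷ v) = trans (+-right (a * f (suc x ∷ v) + b * g (suc x ∷ v)) (D-linear a b (λ w → f (x ∷ w)) (λ w → g (x ∷ w)) v))
    (interchange a b (f (suc x ∷ v)) (g (suc x ∷ v)) _ _)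

  E^-linear : ∀ {r} s a b (f g : Fn r) v → E^ s (λ v → a * f v + b * g v) v ≡ a * E^ s f v + b * E^ s g v
  E^-linear zero    a b f g v = refl
  E^-linear (suc s) a b f g v = trans (E-cong (E^-linear s a b f g) v) (E-linear a b (E^ s f) (E^ s g) v)

  D^-linear : ∀ {r} s a b (f g : Fn r) v → D^ s (λ v → a * f v + b * g v) v ≡ a * D^ s f v + b * D^ s g v
  D^-linear zero    a b f g v = refl
  D^-linear (suc s) a b f g v = trans (D^-cong s (D-linear a b f g) v) (D^-linear s a b (D f) (D g) v)

  D-suc : ∀ {r} s (f : Fn r) v → D^ (suc s) f v ≡ D (D^ s f) v
  D-suc zero    f v = refl
  D-suc (suc s) f v = D-suc s (D f) v

  E-suc : ∀ {r} s (f : Fn r) v → E^ (suc s) f v ≡ E^ s (E f) v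
  E-suc zero    f v = refl
  E-suc (suc s) f v = E-cong (E-suc s f) v

  E-zero : ∀ {r} (v : Vec ℕ r) → E (λ _ → + 0) v ≡ + 0
  E-zero []          = refl
  E-zero (zero ∷ v)  = trans (+-identityˡ _) (E-zero v)
  E-zero (suc x ∷ v) = trans (+-identityˡ _) (E-zero v)

  D-zero : ∀ {r} (v : Vec ℕ r) → D (λ _ → + 0) v ≡ + 0
  D-zero []      = refl
  D-zero (x ∷ v) = trans (+-identityˡ _) (D-zero v)

  E^-zero : ∀ {r} s (v : Vec ℕ r) → E^ s (λ _ → + 0) v ≡ + 0
  E^-zero zero    v = refl
  E^-zero (suc s) v = trans (E-cong (E^-zero s) v) (E-zero v)

  D^-zero : ∀ {r} s (v : Vec ℕ r) → D^ s (λ _ → + 0) v ≡ + 0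
  D^-zero zero    v = refl
  D^-zero (suc s) v = trans (D^-cong s D-zero v) (D^-zero s v)

  E-scale : ∀ {r} a (f : Fn r) v → E (λ v → a * f v) v ≡ a * E f v
  E-scale a f v = trans (E-cong (λ w → go a (f w)) v) (trans (E-linear a (+ 0) f f v) (sym (go a (E f v))))
    where
    go : ∀ a x → a * x ≡ a * x + + 0 * x
    go = solve-∀

  D-scale : ∀ {r} a (f : Fn r) v → D (λ v → a * f v) v ≡ a * D f v
  D-scale a f v = trans (D-cong (λ w → go a (f w)) v) (trans (D-linear a (+ 0) f f v) (sym (go a (D f v))))
    where
    go : ∀ a x → a * x ≡ a * x + + 0 * x
    go = solve-∀

  E-+ : ∀ {r} (f g : Fn r) v → E (λ v → f v + g v) v ≡ E f v + E g v
  E-+ f g v = trans (E-cong (λ w → go (f w) (g w)) v) (trans (E-linear (+ 1) (+ 1) f g v) (sym (go (E f v) (E g v))))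
    where
    go : ∀ x y → x + y ≡ + 1 * x + + 1 * y
    go = solve-∀

  δℕ : ℕ → ℕ → ℤ
  δℕ zero    zero    = + 1
  δℕ zero    (suc _) = + 0
  δℕ (suc _) zero    = + 0
  δℕ (suc x) (suc y) = δℕ x y

  δ : ∀ {r} → Vec ℕ r → Vec ℕ r → ℤ
  δ []      []      = + 1
  δ (x ∷ a) (y ∷ b) = δℕ x y * δ a b

  δℕ-refl : ∀ x → δℕ x x ≡ + 1
  δℕ-refl zero    = refl
  δℕ-refl (suc x) = δℕ-refl x

  δℕ-≢ : ∀ x y → x ≢ y → δℕ x y ≡ + 0
  δℕ-≢ zero    zero    x≢y = contradiction refl x≢y
  δℕ-≢ zero    (suc y) x≢y = refl
  δℕ-≢ (suc x) zero    x≢y = refl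
  δℕ-≢ (suc x) (suc y) x≢y = δℕ-≢ x y (λ eq → x≢y (cong suc eq))

  δℕ-sym : ∀ x y → δℕ x y ≡ δℕ y x
  δℕ-sym zero    zero    = refl
  δℕ-sym zero    (suc y) = refl
  δℕ-sym (suc x) zero    = refl
  δℕ-sym (suc x) (suc y) = δℕ-sym x y

  δ-refl : ∀ {r} (a : Vec ℕ r) → δ a a ≡ + 1
  δ-refl []      = refl
  δ-refl (x ∷ a) = cong₂ _*_ (δℕ-refl x) (δ-refl a)

  δ-≢ : ∀ {r} (a b : Vec ℕ r) → a ≢ b → δ a b ≡ + 0
  δ-≢ []      []      a≢b = contradiction refl a≢b
  δ-≢ (x ∷ a) (y ∷ b) a≢b with x ℕ.≟ y
  ... | yes refl = trans (cong₂ _*_ (refl {x = δℕ x x}) (δ-≢ a b (λ eq → a≢b (cong (x ∷_) eq)))) (*-zeroʳ (δℕ x x))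
  ... | no  x≢y  = cong₂ _*_ (δℕ-≢ x y x≢y) (refl {x = δ a b})

  δ-sym : ∀ {r} (a b : Vec ℕ r) → δ a b ≡ δ b a
  δ-sym []      []      = refl
  δ-sym (x ∷ a) (y ∷ b) = cong₂ _*_ (δℕ-sym x y) (δ-sym a b)

  E-δ : ∀ {r} (a b : Vec ℕ r) → E (δ a) b ≡ D (δ b) a
  E-δ [] [] = refl
  E-δ (x ∷ a) (y ∷ b) = cong₂ _+_ (head y)
    (trans (E-scale (δℕ x y) (δ a) b) (trans (cong₂ _*_ (δℕ-sym x y) (E-δ a b)) (sym (D-scale (δℕ y x) (δ b) a))))
    where
    head : ∀ y → prev (λ z → δ (x ∷ a) (z ∷ b)) y ≡ δ (y ∷ b) (suc x ∷ a)
    head zero    = refl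
    head (suc y) = δ-sym (x ∷ a) (y ∷ b)

  D-E-commute : ∀ {q r} (g : Vec ℕ q → Vec ℕ r → ℤ) a b →
    D (λ a → E (g a) b) a ≡ E (λ b → D (λ a → g a b) a) b
  D-E-commute g []      b = sym (E-zero b)
  D-E-commute g (x ∷ a) b = trans (+-right (E (g (suc x ∷ a)) b) (D-E-commute (λ a′ → g (x ∷ a′)) a b))
    (sym (E-+ (g (suc x ∷ a)) (λ b → D (λ a′ → g (x ∷ a′) b) a) b))

  D^-E-commute : ∀ {q r} s (g : Vec ℕ q → Vec ℕ r → ℤ) a b →
    D^ s (λ a → E (g a) b) a ≡ E (λ b → D^ s (λ a → g a b) a) b
  D^-E-commute zero    g a b = refl
  D^-E-commute (suc s) g a b = trans (D^-cong s (λ a → D-E-commute g a b) a) (D^-E-commute s (λ a b → D (λ a → g a b) a) a b)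

  -- Both sides are the entry of Lˢ between the monomials `a` and `b`. In the induction one operator
  -- acts on `b` and the other on `a`, so they commute by `D^-E-commute`.
  E^-δ : ∀ {r} s (a b : Vec ℕ r) → E^ s (δ a) b ≡ D^ s (δ b) a
  E^-δ zero    a b = δ-sym a b
  E^-δ (suc s) a b = trans (E-cong (E^-δ s a) b) (trans (sym (D^-E-commute s (λ a b → δ b a) a b))
    (D^-cong s (λ a → trans (E-cong (λ b → δ-sym b a) b) (E-δ a b)) a))

-- Finite enumerations of exponent vectors.

module Enumerations where
  open ≡ using (refl; sym; cong)

  open VAll using ([]; _∷_)

  lookup-injective : ∀ {A : Set} {xs : List A} → Unique xs → ∀ i j → List.lookup xs i ≡ List.lookup xs j → i ≡ j
  lookup-injective (px ∷ u) zero    zero    eq = refl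
  lookup-injective (px ∷ u) zero    (suc j) eq = contradiction eq (All.lookup px (∈-lookup j))
  lookup-injective (px ∷ u) (suc i) zero    eq = contradiction (sym eq) (All.lookup px (∈-lookup i))
  lookup-injective (px ∷ u) (suc i) (suc j) eq = cong suc (lookup-injective u i j eq)

  cube : ∀ r → ℕ → List (Vec ℕ r)
  cube zero    M = [] ∷ []
  cube (suc r) M = cartesianProductWith _∷_ (upTo (suc M)) (cube r M)

  ∈-cube : ∀ {r M} {b : Vec ℕ r} → VAll.All (_≤ M) b → b ∈ cube r M
  ∈-cube []       = here refl
  ∈-cube (p ∷ ps) = ∈-cartesianProductWith⁺ _∷_ (∈-upTo⁺ (s≤s p)) (∈-cube ps)

  cube-unique : ∀ r M → Unique (cube r M)
  cube-unique zero    M = [] ∷ []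
  cube-unique (suc r) M = Uniqueₚ.cartesianProductWith⁺ _∷_ Vecₚ.∷-injective (Uniqueₚ.upTo⁺ (suc M)) (cube-unique r M)

  entries≤deg : ∀ {r} (b : Vec ℕ r) {M} → deg b ≤ M → VAll.All (_≤ M) b
  entries≤deg []      d = []
  entries≤deg (x ∷ b) d = ℕₚ.m+n≤o⇒m≤o x d ∷ entries≤deg b (ℕₚ.m+n≤o⇒n≤o x d)

  -- The indices number the rows and columns of the integer matrices; `injective` makes the
  -- functions δ at the listed exponents independent.
  record Enumeration {r} (P : Vec ℕ r → Set) : Set where
    field
      size      : ℕ
      at        : Fin size → Vec ℕ r
      sound     : ∀ i → P (at i)
      complete  : ∀ b → P b → ∃ λ i → at i ≡ b
      injective : ∀ i j → at i ≡ at j → i ≡ j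

  enumerate : ∀ {r} {P : Vec ℕ r → Set} → (∀ b → Dec (P b)) → ∀ M → (∀ b → P b → deg b ≤ M) → Enumeration P
  enumerate {r} {P} P? M bound = record
    { size      = List.length xs
    ; at        = List.lookup xs
    ; sound     = λ i → proj₂ (∈-filter⁻ P? {xs = cube r M} (∈-lookup {xs = xs} i))
    ; complete  = λ b pb → let b∈ = ∈-filter⁺ P? (∈-cube (entries≤deg b (bound b pb))) pb in Any.index b∈ , sym (Anyₚ.lookup-index b∈)
    ; injective = lookup-injective (Uniqueₚ.filter⁺ P? (cube-unique r M))
    }
    where
    xs : List (Vec ℕ r)
    xs = filter P? (cube r M)

  _∣ₘ?_ : ∀ {r} (a b : Vec ℕ r) → Dec (a ∣ₘ b)
  _∣ₘ?_ = PW.decidable ℕ._≤?_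

  standard? : ∀ {r} (gs : Gens r) b → Dec (Standard gs b)
  standard? gs b = ¬? (Any.any? (_∣ₘ? b) gs)

  enumerateStandard : ∀ {r} (gs : Gens r) j → Enumeration (λ b → Standard gs b × deg b ≡ j)
  enumerateStandard gs j = enumerate (λ b → standard? gs b ×-dec (deg b ℕ.≟ j)) j (λ b p → ℕₚ.≤-reflexive (proj₂ p))

  standard-downClosed : ∀ {r} (gs : Gens r) {a b : Vec ℕ r} → a ∣ₘ b → Standard gs b → Standard gs a
  standard-downClosed gs a∣b std a∈I = std (Any.map (λ g∣a → PW.trans ℕₚ.≤-trans g∣a a∣b) a∈I)

-- From integer matrices to maximal rank over a field of characteristic zero.

module FieldTransfer where
  open IntegerElimination using (Span; row; null; combine; respect; FullRowSpan; kronecker; injective⇒fullRowSpan; _·_)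
  module ℤSum = IntegerElimination
  open IntegerOperators
  open Enumerations

  -- Vectors are functions on all exponents with a condition on the support, so that `E` and `D` can
  -- act without being cut down to the standard monomials. The same holds for `DualInjective`.
  PrimalInjective : ∀ {r} → Gens r → ℕ → ℕ → Set
  PrimalInjective {r} gs s j = ∀ (f : Fn r) → (∀ b → ¬ (Standard gs b × deg b ≡ j) → f b ≡ + 0) →
    (∀ b → Standard gs b → deg b ≡ j ℕ.+ s → E^ s f b ≡ + 0) → ∀ b → f b ≡ + 0

  DualInjective : ∀ {r} → Gens r → ℕ → ℕ → Set
  DualInjective {r} gs s j = ∀ (φ : Fn r) → (∀ b → ¬ (Standard gs b × deg b ≡ j ℕ.+ s) → φ b ≡ + 0) →
    (∀ a → Standard gs a → deg a ≡ j → D^ s φ a ≡ + 0) → ∀ b → φ b ≡ + 0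

  E-homogeneous : ∀ {r} (f : Fn r) b → (∀ b′ → suc (deg b′) ≡ deg b → f b′ ≡ + 0) → E f b ≡ + 0
  E-homogeneous f []          v = ≡.refl
  E-homogeneous f (zero ∷ b)  v = ≡.trans (ℤₚ.+-identityˡ _) (E-homogeneous (λ b′ → f (zero ∷ b′)) b (λ b′ → v (zero ∷ b′)))
  E-homogeneous f (suc x ∷ b) v = ≡.cong₂ ℤ._+_ (v (x ∷ b) ≡.refl)
    (E-homogeneous (λ b′ → f (suc x ∷ b′)) b (λ b′ eq → v (suc x ∷ b′) (≡.trans (≡.sym (ℕₚ.+-suc (suc x) (deg b′))) (≡.cong (suc x ℕ.+_) eq))))

  E^-homogeneous : ∀ {r} s (f : Fn r) j → (∀ b → deg b ≢ j → f b ≡ + 0) → ∀ b → deg b ≢ j ℕ.+ s → E^ s f b ≡ + 0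
  E^-homogeneous zero    f j v b ne = v b (λ eq → ne (≡.trans eq (≡.sym (ℕₚ.+-identityʳ j))))
  E^-homogeneous (suc s) f j v b ne = E-homogeneous (E^ s f) b (λ b′ eq →
    E^-homogeneous s f j v b′ (λ eq′ → ne (≡.trans (≡.sym eq) (≡.trans (≡.cong suc eq′) (≡.sym (ℕₚ.+-suc j s))))))

  sum-single : ∀ {n} (t : Fin n → ℤ) i → (∀ l → l ≢ i → t l ≡ + 0) → ℤSum.sum t ≡ t i
  sum-single t zero v = ≡.trans (≡.cong₂ ℤ._+_ (≡.refl {x = t zero}) (ℤSum.sum-zero _ (λ l → v (suc l) (λ ())))) (ℤₚ.+-identityʳ _)
  sum-single t (suc i) v = ≡.trans (≡.cong₂ ℤ._+_ (v zero (λ ())) (sum-single (λ l → t (suc l)) i (λ l ne → v (suc l) (λ { ≡.refl → ne ≡.refl })))) (ℤₚ.+-identityˡ _)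

  E^-sum : ∀ {r n} s (x : Fin n → ℤ) (f : Fin n → Fn r) b →
    E^ s (λ b → ℤSum.sum (λ l → x l ℤ.* f l b)) b ≡ ℤSum.sum (λ l → x l ℤ.* E^ s (f l) b)
  E^-sum {n = zero}  s x f b = E^-zero s b
  E^-sum {n = suc n} s x f b = ≡.trans (E^-cong s (λ b → ≡.cong₂ ℤ._+_ (≡.refl {x = x zero ℤ.* f zero b}) (≡.sym (ℤₚ.*-identityˡ (rest b)))) b)
    (≡.trans (E^-linear s (x zero) (+ 1) (f zero) rest b)
    (≡.cong₂ ℤ._+_ (≡.refl {x = x zero ℤ.* E^ s (f zero) b}) (≡.trans (ℤₚ.*-identityˡ _) (E^-sum s (λ l → x (suc l)) (λ l → f (suc l)) b))))
    where
    rest : Fn _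
    rest b = ℤSum.sum (λ l → x (suc l) ℤ.* f (suc l) b)

  D^-sum : ∀ {r n} s (x : Fin n → ℤ) (f : Fin n → Fn r) b →
    D^ s (λ b → ℤSum.sum (λ l → x l ℤ.* f l b)) b ≡ ℤSum.sum (λ l → x l ℤ.* D^ s (f l) b)
  D^-sum {n = zero}  s x f b = D^-zero s b
  D^-sum {n = suc n} s x f b = ≡.trans (D^-cong s (λ b → ≡.cong₂ ℤ._+_ (≡.refl {x = x zero ℤ.* f zero b}) (≡.sym (ℤₚ.*-identityˡ (rest b)))) b)
    (≡.trans (D^-linear s (x zero) (+ 1) (f zero) rest b)
    (≡.cong₂ ℤ._+_ (≡.refl {x = x zero ℤ.* D^ s (f zero) b}) (≡.trans (ℤₚ.*-identityˡ _) (D^-sum s (λ l → x (suc l)) (λ l → f (suc l)) b))))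
    where
    rest : Fn _
    rest b = ℤSum.sum (λ l → x (suc l) ℤ.* f (suc l) b)

  module Expansion {r} {P : Vec ℕ r → Set} (enum : Enumeration P) where
    open Enumeration enum

    expand : (Fin size → ℤ) → Fn r
    expand x b = ℤSum.sum (λ l → x l ℤ.* δ (at l) b)

    expand-at : ∀ x l → expand x (at l) ≡ x l
    expand-at x l = ≡.trans (sum-single _ l (λ k k≢l → ≡.trans (≡.cong (x k ℤ.*_) (δ-≢ (at k) (at l) (λ eq → k≢l (injective k l eq)))) (ℤₚ.*-zeroʳ (x k))))
      (≡.trans (≡.cong (x l ℤ.*_) (δ-refl (at l))) (ℤₚ.*-identityʳ (x l)))

    expand-support : ∀ x b → ¬ P b → expand x b ≡ + 0
    expand-support x b ¬p = ℤSum.sum-zero _ (λ l → ≡.trans (≡.cong (x l ℤ.*_) (δ-≢ (at l) b (λ { ≡.refl → ¬p (sound l) }))) (ℤₚ.*-zeroʳ (x l)))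

  module _ {r} (gs : Gens r) (s j : ℕ) where

    open Enumeration (enumerateStandard gs j) renaming (size to n; at to S)
    open Enumeration (enumerateStandard gs (j ℕ.+ s)) using () renaming (size to m; at to T)

    primal-fullRowSpan : PrimalInjective gs s j → FullRowSpan (λ (k : Fin m) (l : Fin n) → E^ s (δ (S l)) (T k))
    primal-fullRowSpan prim = injective⇒fullRowSpan _ λ x ker l → ≡.trans (≡.sym (expand-at x l))
      (prim (expand x) (expand-support x) (λ b std dg → vanish x ker b std dg) (S l))
      where
      open Expansion (enumerateStandard gs j)
      vanish : ∀ x → (∀ k → (λ l → E^ s (δ (S l)) (T k)) · x ≡ + 0) → ∀ b → Standard gs b → deg b ≡ j ℕ.+ s → E^ s (expand x) b ≡ + 0
      vanish x ker b std dg with Enumeration.complete (enumerateStandard gs (j ℕ.+ s)) b (std , dg)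
      ... | k , ≡.refl = ≡.trans (E^-sum s x (λ l → δ (S l)) (T k)) (≡.trans (ℤSum.sum-cong-≋ (λ l → ℤₚ.*-comm (x l) (E^ s (δ (S l)) (T k)))) (ker k))

    dual-fullRowSpan : DualInjective gs s j → FullRowSpan (λ (l : Fin n) (k : Fin m) → E^ s (δ (S l)) (T k))
    dual-fullRowSpan dual = injective⇒fullRowSpan _ λ y ker k → ≡.trans (≡.sym (expand-at y k))
      (dual (expand y) (expand-support y) (λ a std dg → vanish y ker a std dg) (T k))
      where
      open Expansion (enumerateStandard gs (j ℕ.+ s))
      vanish : ∀ y → (∀ l → (λ k → E^ s (δ (S l)) (T k)) · y ≡ + 0) → ∀ a → Standard gs a → deg a ≡ j → D^ s (expand y) a ≡ + 0
      vanish y ker a std dg with complete a (std , dg)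
      ... | l , ≡.refl = ≡.trans (D^-sum s y (λ k → δ (T k)) (S l)) (≡.trans (ℤSum.sum-cong-≋ (λ k →
            ≡.trans (≡.cong (y k ℤ.*_) (≡.sym (E^-δ s (S l) (T k)))) (ℤₚ.*-comm (y k) (E^ s (δ (S l)) (T k))))) (ker l))

  module OverField {c ℓ} (K : Field c ℓ) where
    open Field K hiding (zero)
    open import Algebra.Properties.Semiring.Sum semiring using (sum; sum-cong-≋; ∑-distrib-+; *-distribˡ-sum; sum-replicate-zero; ∑-comm)
    open import Algebra.Properties.Ring ring using (-‿distribˡ-*; -‿distribʳ-*; -0#≈0#; -‿+-comm; -‿involutive)
    open import Relation.Binary.Reasoning.Setoid setoid

    ι : ℤ → Carrier
    ι (+ n)      = fromℕ K n
    ι (-[1+ n ]) = - fromℕ K (suc n)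

    fromℕ-+ : ∀ m n → fromℕ K (m ℕ.+ n) ≈ fromℕ K m + fromℕ K n
    fromℕ-+ zero    n = sym (+-identityˡ _)
    fromℕ-+ (suc m) n = trans (+-congˡ (fromℕ-+ m n)) (sym (+-assoc _ _ _))

    fromℕ-* : ∀ m n → fromℕ K (m ℕ.* n) ≈ fromℕ K m * fromℕ K n
    fromℕ-* zero    n = sym (zeroˡ _)
    fromℕ-* (suc m) n = trans (fromℕ-+ n (m ℕ.* n)) (trans (+-cong (sym (*-identityˡ _)) (fromℕ-* m n)) (sym (distribʳ _ _ _)))

    ι-neg : ∀ i → ι (ℤ.- i) ≈ - ι i
    ι-neg (+ zero)  = sym -0#≈0#
    ι-neg (+ suc n) = refl
    ι-neg -[1+ n ]  = sym (-‿involutive _)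

    ι-⊖ : ∀ m n → ι (m ⊖ n) ≈ fromℕ K m + - fromℕ K n
    ι-⊖ zero zero = sym (trans (+-congˡ -0#≈0#) (+-identityʳ _))
    ι-⊖ zero (suc n) = sym (+-identityˡ _)
    ι-⊖ (suc m) zero = sym (trans (+-congˡ -0#≈0#) (+-identityʳ _))
    ι-⊖ (suc m) (suc n) = begin
      ι (suc m ⊖ suc n)                                 ≡⟨ ≡.cong ι (ℤₚ.[1+m]⊖[1+n]≡m⊖n m n) ⟩
      ι (m ⊖ n)                                         ≈⟨ ι-⊖ m n ⟩
      fromℕ K m + - fromℕ K n                           ≈⟨ +-congʳ (+-identityʳ _) ⟨
      (fromℕ K m + 0#) + - fromℕ K n                    ≈⟨ +-congʳ (+-congˡ (-‿inverseʳ 1#)) ⟨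
      (fromℕ K m + (1# + - 1#)) + - fromℕ K n           ≈⟨ +-congʳ (+-assoc _ _ _) ⟨
      ((fromℕ K m + 1#) + - 1#) + - fromℕ K n           ≈⟨ +-assoc _ _ _ ⟩
      (fromℕ K m + 1#) + (- 1# + - fromℕ K n)           ≈⟨ +-cong (+-comm _ _) (-‿+-comm _ _) ⟩
      (1# + fromℕ K m) + - (1# + fromℕ K n)             ∎

    ι-+ : ∀ i j → ι (i ℤ.+ j) ≈ ι i + ι j
    ι-+ (+ m)    (+ n)    = fromℕ-+ m n
    ι-+ (+ m)    -[1+ n ] = ι-⊖ m (suc n)
    ι-+ -[1+ m ] (+ n)    = trans (ι-⊖ n (suc m)) (+-comm _ _)
    ι-+ -[1+ m ] -[1+ n ] = trans (-‿cong (trans (reflexive (≡.cong (λ k → fromℕ K (suc k)) (≡.sym (ℕₚ.+-suc m n)))) (fromℕ-+ (suc m) (suc n)))) (sym (-‿+-comm _ _))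

    ι-* : ∀ i j → ι (i ℤ.* j) ≈ ι i * ι j
    ι-*⁺ : ∀ m j → ι (+ m ℤ.* j) ≈ fromℕ K m * ι j
    ι-*⁺ m (+ n)    = trans (reflexive (≡.cong ι (≡.sym (ℤₚ.pos-* m n)))) (fromℕ-* m n)
    ι-*⁺ m -[1+ n ] = begin
      ι (+ m ℤ.* -[1+ n ])        ≡⟨ ≡.cong ι (≡.sym (ℤₚ.neg-distribʳ-* (+ m) (+ suc n))) ⟩
      ι (ℤ.- (+ m ℤ.* + suc n))   ≈⟨ ι-neg (+ m ℤ.* + suc n) ⟩
      - ι (+ m ℤ.* + suc n)       ≈⟨ -‿cong (ι-*⁺ m (+ suc n)) ⟩
      - (fromℕ K m * ι (+ suc n)) ≈⟨ -‿distribʳ-* _ _ ⟩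
      fromℕ K m * ι -[1+ n ]      ∎
    ι-* (+ m)    j = ι-*⁺ m j
    ι-* -[1+ m ] j = begin
      ι (-[1+ m ] ℤ.* j)          ≡⟨ ≡.cong ι (≡.sym (ℤₚ.neg-distribˡ-* (+ suc m) j)) ⟩
      ι (ℤ.- (+ suc m ℤ.* j))     ≈⟨ ι-neg (+ suc m ℤ.* j) ⟩
      - ι (+ suc m ℤ.* j)         ≈⟨ -‿cong (ι-*⁺ (suc m) j) ⟩
      - (ι (+ suc m) * ι j)       ≈⟨ -‿distribˡ-* _ _ ⟩
      ι -[1+ m ] * ι j            ∎

    ι-1 : ι (+ 1) ≈ 1#
    ι-1 = +-identityʳ 1#

    cancel-invertible : ∀ {x y} → (Σ Carrier λ z → x * z ≈ 1#) → x * y ≈ 0# → y ≈ 0#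
    cancel-invertible {x} {y} (z , xz) xy = begin
      y           ≈⟨ *-identityˡ y ⟨
      1# * y      ≈⟨ *-congʳ xz ⟨
      (x * z) * y ≈⟨ *-congʳ (*-comm x z) ⟩
      (z * x) * y ≈⟨ *-assoc z x y ⟩
      z * (x * y) ≈⟨ *-congˡ xy ⟩
      z * 0#      ≈⟨ zeroʳ z ⟩
      0#          ∎

    ι-≢0 : CharZero K → ∀ D → D ≢ + 0 → ¬ (ι D ≈ 0#)
    ι-≢0 char0 (+ zero)  D≢0 eq = D≢0 ≡.refl
    ι-≢0 char0 (+ suc n) D≢0 eq = char0 n eq
    ι-≢0 char0 -[1+ n ]  D≢0 eq = char0 n (trans (sym (-‿involutive _)) (trans (-‿cong eq) -0#≈0#))

    sum-zeroᴷ : ∀ {n} (t : Fin n → Carrier) → (∀ l → t l ≈ 0#) → sum t ≈ 0#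
    sum-zeroᴷ {n} t v = trans (sum-cong-≋ v) (sum-replicate-zero n)

    sum-singleᴷ : ∀ {n} (t : Fin n → Carrier) i → (∀ l → l ≢ i → t l ≈ 0#) → sum t ≈ t i
    sum-singleᴷ t zero    v = trans (+-congˡ (sum-zeroᴷ _ (λ l → v (suc l) (λ ())))) (+-identityʳ _)
    sum-singleᴷ t (suc i) v = trans (+-cong (v zero (λ ())) (sum-singleᴷ (λ l → t (suc l)) i (λ l ne → v (suc l) (λ { ≡.refl → ne ≡.refl })))) (+-identityˡ _)

    kronecker-refl : ∀ {n} (l : Fin n) → kronecker l l ≡ + 1
    kronecker-refl zero    = ≡.refl
    kronecker-refl (suc l) = kronecker-refl l

    kronecker-≢ : ∀ {n} (k l : Fin n) → k ≢ l → kronecker k l ≡ + 0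
    kronecker-≢ zero    zero    ne = contradiction ≡.refl ne
    kronecker-≢ zero    (suc l) ne = ≡.refl
    kronecker-≢ (suc k) zero    ne = ≡.refl
    kronecker-≢ (suc k) (suc l) ne = kronecker-≢ k l (λ eq → ne (≡.cong suc eq))

    combine-lemma : ∀ {n} a b (u v : Fin n → ℤ) (f : Fin n → Carrier) →
      sum (λ l → ι (a ℤ.* u l ℤ.+ b ℤ.* v l) * f l) ≈ ι a * sum (λ l → ι (u l) * f l) + ι b * sum (λ l → ι (v l) * f l)
    combine-lemma a b u v f = begin
      sum (λ l → ι (a ℤ.* u l ℤ.+ b ℤ.* v l) * f l)
        ≈⟨ sum-cong-≋ (λ l → trans (*-congʳ (trans (ι-+ (a ℤ.* u l) (b ℤ.* v l)) (+-cong (ι-* a (u l)) (ι-* b (v l))))) (trans (distribʳ _ _ _) (+-cong (*-assoc _ _ _) (*-assoc _ _ _)))) ⟩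
      sum (λ l → ι a * (ι (u l) * f l) + ι b * (ι (v l) * f l))
        ≈⟨ ∑-distrib-+ (λ l → ι a * (ι (u l) * f l)) (λ l → ι b * (ι (v l) * f l)) ⟩
      sum (λ l → ι a * (ι (u l) * f l)) + sum (λ l → ι b * (ι (v l) * f l))
        ≈⟨ +-cong (*-distribˡ-sum (ι a) (λ l → ι (u l) * f l)) (*-distribˡ-sum (ι b) (λ l → ι (v l) * f l)) ⟨
      ι a * sum (λ l → ι (u l) * f l) + ι b * sum (λ l → ι (v l) * f l) ∎

    span-vanishes : ∀ {m n} {M : Fin m → Fin n → ℤ} (f : Fin n → Carrier) → (∀ k → sum (λ l → ι (M k l) * f l) ≈ 0#) →
      ∀ {u} → Span M u → sum (λ l → ι (u l) * f l) ≈ 0#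
    span-vanishes f ker (row k) = ker k
    span-vanishes f ker null = sum-zeroᴷ _ (λ l → zeroˡ (f l))
    span-vanishes f ker (combine a b {u} {v} su sv) = trans (combine-lemma a b u v f)
      (trans (+-cong (trans (*-congˡ (span-vanishes f ker su)) (zeroʳ _)) (trans (*-congˡ (span-vanishes f ker sv)) (zeroʳ _))) (+-identityʳ _))
    span-vanishes f ker (respect eq su) = trans (sum-cong-≋ (λ l → *-congʳ (reflexive (≡.cong ι (≡.sym (eq l)))))) (span-vanishes f ker su)

    -- Every integer combination of rows annihilates `f`, in particular `D` times each unit vector;
    -- so `D` annihilates each coordinate of `f`, and `D` is invertible.
    kernel-transfer : CharZero K → ∀ {m n} {M : Fin m → Fin n → ℤ} → FullRowSpan M → (f : Fin n → Carrier) →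
      (∀ k → sum (λ l → ι (M k l) * f l) ≈ 0#) → ∀ l → f l ≈ 0#
    kernel-transfer char0 (D , D≢0 , sp) f ker l = cancel-invertible (inverse (ι D) (ι-≢0 char0 D D≢0)) (begin
      ι D * f l                                  ≈⟨ *-congʳ (reflexive (≡.cong ι (≡.trans (≡.cong (D ℤ.*_) (kronecker-refl l)) (ℤₚ.*-identityʳ D)))) ⟨
      ι (D ℤ.* kronecker l l) * f l              ≈⟨ sum-singleᴷ _ l (λ k k≢l → trans (*-congʳ (reflexive (≡.cong ι (≡.trans (≡.cong (D ℤ.*_) (kronecker-≢ l k (λ eq → k≢l (≡.sym eq)))) (ℤₚ.*-zeroʳ D))))) (zeroˡ _)) ⟨
      sum (λ k → ι (D ℤ.* kronecker l k) * f k)  ≈⟨ span-vanishes f ker (sp l) ⟩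
      0#                                         ∎)

    -- The system is that of the transpose: the unknowns are indexed by the rows of `M`, and a
    -- solution exhibits `g` in the row space over `K`.
    Reaches : ∀ {m n} → (Fin m → Fin n → ℤ) → (Fin n → Carrier) → Set (c ⊔ ℓ)
    Reaches {m} M g = Σ (Fin m → Carrier) λ x → ∀ k → sum (λ l → ι (M l k) * x l) ≈ g k

    reaches-null : ∀ {m n} (M : Fin m → Fin n → ℤ) → Reaches M (λ _ → 0#)
    reaches-null M = (λ _ → 0#) , (λ k → sum-zeroᴷ (λ l → ι (M l k) * 0#) (λ l → zeroʳ (ι (M l k))))

    reaches-combine : ∀ {m n} (M : Fin m → Fin n → ℤ) a b {g h} → Reaches M g → Reaches M h → Reaches M (λ k → a * g k + b * h k)
    reaches-combine M a b (x , eqx) (y , eqy) = (λ l → a * x l + b * y l) , λ k → begin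
      sum (λ l → ι (M l k) * (a * x l + b * y l))
        ≈⟨ sum-cong-≋ {x = λ l → ι (M l k) * (a * x l + b * y l)} {y = λ l → a * (ι (M l k) * x l) + b * (ι (M l k) * y l)} (λ l → trans (distribˡ (ι (M l k)) (a * x l) (b * y l)) (+-cong (swap (ι (M l k)) a (x l)) (swap (ι (M l k)) b (y l)))) ⟩
      sum (λ l → a * (ι (M l k) * x l) + b * (ι (M l k) * y l))
        ≈⟨ ∑-distrib-+ (λ l → a * (ι (M l k) * x l)) (λ l → b * (ι (M l k) * y l)) ⟩
      sum (λ l → a * (ι (M l k) * x l)) + sum (λ l → b * (ι (M l k) * y l))
        ≈⟨ +-cong (*-distribˡ-sum a (λ l → ι (M l k) * x l)) (*-distribˡ-sum b (λ l → ι (M l k) * y l)) ⟨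
      a * sum (λ l → ι (M l k) * x l) + b * sum (λ l → ι (M l k) * y l)
        ≈⟨ +-cong (*-congˡ (eqx k)) (*-congˡ (eqy k)) ⟩
      a * _ + b * _ ∎
      where
      swap : ∀ u v w → u * (v * w) ≈ v * (u * w)
      swap u v w = trans (sym (*-assoc u v w)) (trans (*-congʳ (*-comm u v)) (*-assoc v u w))

    reaches-span : ∀ {m n} (M : Fin m → Fin n → ℤ) {u} → Span M u → Reaches M (λ k → ι (u k))
    reaches-span M (row i) = (λ l → ι (kronecker i l)) , λ k →
      trans (sum-singleᴷ _ i (λ l l≢i → trans (*-congˡ (reflexive (≡.cong ι (kronecker-≢ i l (λ eq → l≢i (≡.sym eq)))))) (zeroʳ _)))
        (trans (*-congˡ (trans (reflexive (≡.cong ι (kronecker-refl i))) ι-1)) (*-identityʳ _))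
    reaches-span M null = reaches-null M
    reaches-span M (combine a b {u} {v} su sv) with reaches-combine M (ι a) (ι b) (reaches-span M su) (reaches-span M sv)
    ... | x , eq = x , λ k → trans (eq k) (sym (trans (ι-+ (a ℤ.* u k) (b ℤ.* v k)) (+-cong (ι-* a (u k)) (ι-* b (v k)))))
    reaches-span M (respect eq su) with reaches-span M su
    ... | x , eqx = x , λ k → trans (eqx k) (reflexive (≡.cong ι (eq k)))

    reaches-sum : ∀ {m n p} (M : Fin m → Fin n → ℤ) (a : Fin p → Carrier) (g : Fin p → Fin n → Carrier) →
      (∀ i → Reaches M (g i)) → Reaches M (λ k → sum (λ i → a i * g i k))
    reaches-sum {p = zero}  M a g rs = reaches-null M
    reaches-sum {p = suc p} M a g rs with reaches-combine M (a zero) 1# (rs zero) (reaches-sum M (λ i → a (suc i)) (λ i → g (suc i)) (λ i → rs (suc i)))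
    ... | x , eq = x , λ k → trans (eq k) (+-congˡ (*-identityˡ _))

    image-transfer : CharZero K → ∀ {m n} {M : Fin m → Fin n → ℤ} → FullRowSpan M → ∀ g → Reaches M g
    image-transfer char0 {M = M} (D , D≢0 , sp) g with inverse (ι D) (ι-≢0 char0 D D≢0)
    ... | z , Dz with reaches-sum M (λ k → z * g k) (λ k l → ι (D ℤ.* kronecker k l)) (λ k → reaches-span M (sp k))
    ...   | x , eq = x , λ k → trans (eq k) (begin
      sum (λ i → (z * g i) * ι (D ℤ.* kronecker i k))
        ≈⟨ sum-singleᴷ _ k (λ i i≢k → trans (*-congˡ (reflexive (≡.cong ι (≡.trans (≡.cong (D ℤ.*_) (kronecker-≢ i k i≢k)) (ℤₚ.*-zeroʳ D))))) (zeroʳ _)) ⟩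
      (z * g k) * ι (D ℤ.* kronecker k k)
        ≈⟨ *-congˡ (reflexive (≡.cong ι (≡.trans (≡.cong (D ℤ.*_) (kronecker-refl k)) (ℤₚ.*-identityʳ D)))) ⟩
      (z * g k) * ι D      ≈⟨ *-comm _ _ ⟩
      ι D * (z * g k)      ≈⟨ *-assoc _ _ _ ⟨
      (ι D * z) * g k      ≈⟨ *-congʳ Dz ⟩
      1# * g k             ≈⟨ *-identityˡ _ ⟩
      g k                  ∎)

    Fnᴷ : ℕ → Set c
    Fnᴷ r = Vec ℕ r → Carrier

    prevᴷ : (ℕ → Carrier) → ℕ → Carrier
    prevᴷ g zero    = 0#
    prevᴷ g (suc x) = g x

    Eᴸ : ∀ {r} → (Fin r → Carrier) → Fnᴷ r → Fnᴷ r
    Eᴸ L f []      = 0#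
    Eᴸ L f (x ∷ b) = L zero * prevᴷ (λ y → f (y ∷ b)) x + Eᴸ (λ i → L (suc i)) (λ b′ → f (x ∷ b′)) b

    Eᴸ^ : ∀ {r} → (Fin r → Carrier) → ℕ → Fnᴷ r → Fnᴷ r
    Eᴸ^ L zero    f = f
    Eᴸ^ L (suc s) f = Eᴸ L (Eᴸ^ L s f)

    Eᴸ-cong-on : ∀ {r p} {P : Vec ℕ r → Set p} L → (∀ {a b} → a ∣ₘ b → P b → P a) → ∀ {f g} →
      (∀ b → P b → f b ≈ g b) → ∀ b → P b → Eᴸ L f b ≈ Eᴸ L g b
    Eᴸ-cong-on L dc eq [] pb = refl
    Eᴸ-cong-on {P = P} L dc eq (zero ∷ b) pb =
      +-congˡ (Eᴸ-cong-on {P = λ b′ → P (zero ∷ b′)} _ (λ ab → dc (ℕ.z≤n ∷ ab)) (λ b′ → eq (zero ∷ b′)) b pb)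
    Eᴸ-cong-on {P = P} L dc eq (suc x ∷ b) pb =
      +-cong (*-congˡ (eq (x ∷ b) (dc (ℕₚ.n≤1+n x ∷ ∣ₘ-refl) pb)))
        (Eᴸ-cong-on {P = λ b′ → P (suc x ∷ b′)} _ (λ ab → dc (ℕₚ.≤-refl ∷ ab)) (λ b′ → eq (suc x ∷ b′)) b pb)

    Eᴸ^-cong-on : ∀ {r p} {P : Vec ℕ r → Set p} L → (∀ {a b} → a ∣ₘ b → P b → P a) → ∀ s {f g} →
      (∀ b → P b → f b ≈ g b) → ∀ b → P b → Eᴸ^ L s f b ≈ Eᴸ^ L s g b
    Eᴸ^-cong-on L dc zero    eq = eq
    Eᴸ^-cong-on L dc (suc s) eq = Eᴸ-cong-on L dc (Eᴸ^-cong-on L dc s eq)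

    mulVar-suc : ∀ {r} (gs : Gens (suc r)) i f x b →
      Algebra.mulVar K gs (suc i) f (x ∷ b) ≡ Algebra.mulVar K {r} [] i (λ b′ → f (x ∷ b′)) b
    mulVar-suc gs i f x b with lookup b i
    ... | zero  = ≡.refl
    ... | suc n = ≡.refl

    sumFin-cong : ∀ n {f g : Fin n → Carrier} → (∀ i → f i ≈ g i) → sumFin K n f ≈ sumFin K n g
    sumFin-cong zero    eq = refl
    sumFin-cong (suc n) eq = +-cong (eq zero) (sumFin-cong n (λ i → eq (suc i)))

    mulL≈Eᴸ : ∀ {r} (gs : Gens r) L f b → Algebra.mulL K gs L f b ≈ Eᴸ L f b
    mulL≈Eᴸ gs L f []      = refl
    mulL≈Eᴸ {suc r} gs L f (x ∷ b) = +-cong (head x) (trans (sumFin-cong r (λ i → *-congˡ (reflexive (mulVar-suc gs i f x b))))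
      (mulL≈Eᴸ [] (λ i → L (suc i)) (λ b′ → f (x ∷ b′)) b))
      where
      head : ∀ x → L zero * Algebra.mulVar K gs zero f (x ∷ b) ≈ L zero * prevᴷ (λ y → f (y ∷ b)) x
      head zero    = refl
      head (suc x) = refl

    mulLPow≈Eᴸ^ : ∀ {r} (gs : Gens r) L s f b → Algebra.mulLPow K gs L s f b ≈ Eᴸ^ L s f b
    mulLPow≈Eᴸ^ gs L zero    f b = refl
    mulLPow≈Eᴸ^ gs L (suc s) f b = trans (mulL≈Eᴸ gs L _ b)
      (Eᴸ-cong-on {P = λ _ → Fin 1} L (λ _ p → p) (λ b _ → mulLPow≈Eᴸ^ gs L s f b) b zero)

    ones : ∀ {r} → Fin r → Carrier
    ones _ = 1#

    Eᴸ-sum : ∀ {r n} (g : Fin n → Fn r) (h : Fin n → Carrier) b →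
      Eᴸ ones (λ b → sum (λ l → ι (g l b) * h l)) b ≈ sum (λ l → ι (E (g l) b) * h l)
    Eᴸ-sum g h []      = sym (sum-zeroᴷ _ (λ l → zeroˡ (h l)))
    Eᴸ-sum {r = suc r} {n} g h (x ∷ b) = begin
      1# * prevᴷ (λ y → sum (λ l → ι (g l (y ∷ b)) * h l)) x + Eᴸ ones (λ b′ → sum (λ l → ι (g l (x ∷ b′)) * h l)) b
        ≈⟨ +-cong (trans (*-identityˡ _) (head x)) (Eᴸ-sum (λ l b′ → g l (x ∷ b′)) h b) ⟩
      sum (λ l → ι (p l) * h l) + sum (λ l → ι (q l) * h l)
        ≈⟨ ∑-distrib-+ (λ l → ι (p l) * h l) (λ l → ι (q l) * h l) ⟨
      sum (λ l → ι (p l) * h l + ι (q l) * h l)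
        ≈⟨ sum-cong-≋ (λ l → trans (*-congʳ (ι-+ (p l) (q l))) (distribʳ _ _ _)) ⟨
      sum (λ l → ι (E (g l) (x ∷ b)) * h l) ∎
      where
      p q : Fin n → ℤ
      p l = prev (λ y → g l (y ∷ b)) x
      q l = E (λ b′ → g l (x ∷ b′)) b
      head : ∀ x → prevᴷ (λ y → sum (λ l → ι (g l (y ∷ b)) * h l)) x ≈ sum (λ l → ι (prev (λ y → g l (y ∷ b)) x) * h l)
      head zero    = sym (sum-zeroᴷ _ (λ l → zeroˡ (h l)))
      head (suc x) = refl

    module _ (char0 : CharZero K) {r} (gs : Gens r) (s j : ℕ) where
      open Algebra K gs
      open Enumeration (enumerateStandard gs j) renaming (size to n; at to S)
      open Enumeration (enumerateStandard gs (j ℕ.+ s)) using () renaming (size to m; at to T; complete to T-complete)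

      -- The induction on `t` stays among standard exponents because these are closed under
      -- division. Values of `f` at nonstandard exponents, which `InDeg` leaves arbitrary, are
      -- therefore never read.
      matrix-form : ∀ f → InDeg j f → ∀ t b → Standard gs b → Eᴸ^ ones t f b ≈ sum (λ l → ι (E^ t (δ (S l)) b) * f (S l))
      matrix-form f dg zero b std with deg b ℕ.≟ j
      ... | no ne = trans (dg b std ne) (sym (sum-zeroᴷ _ (λ l → trans (*-congʳ (reflexive (≡.cong ι (δ-≢ (S l) b (λ { ≡.refl → ne (proj₂ (sound l)) }))))) (zeroˡ _))))
      ... | yes eq with complete b (std , eq)
      ...   | i , ≡.refl = sym (trans (sum-singleᴷ _ i (λ l l≢i → trans (*-congʳ (reflexive (≡.cong ι (δ-≢ (S l) (S i) (λ eq → l≢i (injective l i eq)))))) (zeroˡ _)))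
              (trans (*-congʳ (trans (reflexive (≡.cong ι (δ-refl (S i)))) ι-1)) (*-identityˡ _)))
      matrix-form f dg (suc t) b std = trans (Eᴸ-cong-on {P = Standard gs} ones (standard-downClosed gs) (matrix-form f dg t) b std)
        (Eᴸ-sum (λ l → E^ t (δ (S l))) (λ l → f (S l)) b)

      primal⇒injective : PrimalInjective gs s j → Injective ones s j
      primal⇒injective prim f dg ker b std with deg b ℕ.≟ j
      ... | no ne = dg b std ne
      ... | yes eq with complete b (std , eq)
      ...   | i , ≡.refl = kernel-transfer char0 (primal-fullRowSpan gs s j prim) (λ l → f (S l))
              (λ k → trans (sym (matrix-form f dg s (T k) (stdT k))) (trans (sym (mulLPow≈Eᴸ^ gs ones s f (T k))) (ker (T k) (stdT k)))) i
        where
        stdT : ∀ k → Standard gs (T k)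
        stdT k = proj₁ (Enumeration.sound (enumerateStandard gs (j ℕ.+ s)) k)

      preimage : ∀ g → InDeg (j ℕ.+ s) g → Reaches (λ (l : Fin n) (k : Fin m) → E^ s (δ (S l)) (T k)) (λ k → g (T k)) →
        Σ Elt (λ f → InDeg j f × (mulLPow ones s f ≈A g))
      preimage g dg (x , eq) = f , f-inDeg , hits
        where
        f : Elt
        f b = sum (λ l → ι (δ (S l) b) * x l)
        f-inDeg : InDeg j f
        f-inDeg b std ne = sum-zeroᴷ _ (λ l → trans (*-congʳ (reflexive (≡.cong ι (δ-≢ (S l) b (λ { ≡.refl → ne (proj₂ (sound l)) }))))) (zeroˡ _))
        f-at : ∀ l → f (S l) ≈ x l
        f-at i = trans (sum-singleᴷ _ i (λ l l≢i → trans (*-congʳ (reflexive (≡.cong ι (δ-≢ (S l) (S i) (λ eq → l≢i (injective l i eq)))))) (zeroˡ _)))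
              (trans (*-congʳ (trans (reflexive (≡.cong ι (δ-refl (S i)))) ι-1)) (*-identityˡ _))
        hits : mulLPow ones s f ≈A g
        hits b std = trans (mulLPow≈Eᴸ^ gs ones s f b) (trans (matrix-form f f-inDeg s b std) (go (deg b ℕ.≟ j ℕ.+ s)))
          where
          go : Dec (deg b ≡ j ℕ.+ s) → sum (λ l → ι (E^ s (δ (S l)) b) * f (S l)) ≈ g b
          go (no ne) = trans (sum-zeroᴷ _ (λ l → trans (*-congʳ (reflexive (≡.cong ι (E^-homogeneous s (δ (S l)) j
            (λ b′ ne′ → δ-≢ (S l) b′ (λ { ≡.refl → ne′ (proj₂ (sound l)) })) b ne)))) (zeroˡ _))) (sym (dg b std ne))
          go (yes e) with T-complete b (std , e)
          ... | k , ≡.refl = trans (sum-cong-≋ (λ l → *-congˡ (f-at l))) (eq k)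

      dual⇒surjective : DualInjective gs s j → Surjective ones s j
      dual⇒surjective dual g dg = preimage g dg (image-transfer char0 (dual-fullRowSpan gs s j dual) (λ k → g (T k)))

      transfer : PrimalInjective gs s j ⊎ DualInjective gs s j → MaxRank ones s j
      transfer (inj₁ p) = inj₁ (primal⇒injective p)
      transfer (inj₂ d) = inj₂ (dual⇒surjective d)

-- Polynomials in one integer variable, finite differences, orthogonality and positivity.

module FiniteDifferences where
  open import Data.Integer using (_+_; _*_; -_; _-_)
  open ℤSolver using (solve-∀)
  open ≡ using (refl; sym; trans; cong; cong₂; subst; module ≡-Reasoning)
  open IntegerOperators using (prev)

  -- Pol κ f: f is a polynomial function with integer coefficients of degree < κ.
  data Pol : ℕ → (ℤ → ℤ) → Set where
    null   : ∀ {f} → (∀ y → f y ≡ + 0) → Pol 0 f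
    horner : ∀ {κ f} c g → Pol κ g → (∀ y → f y ≡ c + y * g y) → Pol (suc κ) f

  pol-resp : ∀ {κ f g} → (∀ y → f y ≡ g y) → Pol κ f → Pol κ g
  pol-resp eq (null z)         = null (λ y → trans (sym (eq y)) (z y))
  pol-resp eq (horner c h p z) = horner c h p (λ y → trans (sym (eq y)) (z y))

  pol-zero : ∀ κ → Pol κ (λ _ → + 0)
  pol-zero zero    = null (λ _ → refl)
  pol-zero (suc κ) = horner (+ 0) (λ _ → + 0) (pol-zero κ) go
    where
    go : ∀ y → + 0 ≡ + 0 + y * + 0
    go = solve-∀

  pol-const : ∀ κ c → Pol (suc κ) (λ _ → c)
  pol-const κ c = horner c (λ _ → + 0) (pol-zero κ) (go c)
    where
    go : ∀ c y → c ≡ c + y * + 0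
    go = solve-∀

  pol-suc : ∀ {κ f} → Pol κ f → Pol (suc κ) f
  pol-suc {f = f} (null z)    = pol-resp (λ y → sym (z y)) (pol-zero 1)
  pol-suc (horner c g p z) = horner c g (pol-suc p) z

  pol-≤ : ∀ {κ κ′ f} → κ ≤ κ′ → Pol κ f → Pol κ′ f
  pol-≤ {κ′ = zero}   z≤n     p                = p
  pol-≤ {κ′ = suc κ′} z≤n     p                = pol-suc (pol-≤ z≤n p)
  pol-≤               (s≤s l) (horner c g p z) = horner c g (pol-≤ l p) z

  pol-+ : ∀ {κ f g} → Pol κ f → Pol κ g → Pol κ (λ y → f y + g y)
  pol-+ (null z) (null w) = null (λ y → cong₂ _+_ (z y) (w y))
  pol-+ (horner c f p z) (horner d g q w) = horner (c + d) (λ y → f y + g y) (pol-+ p q)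
    (λ y → trans (cong₂ _+_ (z y) (w y)) (go c d y (f y) (g y)))
    where
    go : ∀ c d y u v → c + y * u + (d + y * v) ≡ c + d + y * (u + v)
    go = solve-∀

  pol-scale : ∀ {κ f} a → Pol κ f → Pol κ (λ y → a * f y)
  pol-scale a (null z) = null (λ y → trans (cong (a *_) (z y)) (ℤₚ.*-zeroʳ a))
  pol-scale a (horner c f p z) = horner (a * c) (λ y → a * f y) (pol-scale a p)
    (λ y → trans (cong (a *_) (z y)) (go a c y (f y)))
    where
    go : ∀ a c y u → a * (c + y * u) ≡ a * c + y * (a * u)
    go = solve-∀

  pol-linear : ∀ {κ f} a b → Pol κ f → Pol (suc κ) (λ y → (a + b * y) * f y)
  pol-linear {f = f} a b p = pol-resp (λ y → go a b y (f y))
    (pol-+ (pol-suc (pol-scale a p)) (horner (+ 0) (λ y → b * f y) (pol-scale b p) (λ _ → refl)))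
    where
    go : ∀ a b y u → a * u + (+ 0 + y * (b * u)) ≡ (a + b * y) * u
    go = solve-∀

  pol-affine : ∀ {κ f} a b → Pol κ f → Pol κ (λ y → f (a + b * y))
  pol-affine a b (null z) = null (λ y → z _)
  pol-affine {suc κ} {f} a b (horner c g p z) = pol-resp (λ y → sym (z _))
    (pol-+ (pol-const κ c) (pol-linear a b (pol-affine a b p)))

  pol-divide : ∀ {κ f} → Pol (suc κ) f → ∀ z → Σ (ℤ → ℤ) λ g → Pol κ g × (∀ y → f y ≡ f z + (y - z) * g y)
  pol-divide {f = f} (horner c g (null v) eq) z = (λ _ → + 0) , null (λ _ → refl) , λ y →
    trans (eq y) (trans (cong (λ t → c + y * t) (v y)) (trans (go c y z) (cong (λ t → t + (y - z) * + 0) (sym (trans (eq z) (cong (λ t → c + z * t) (v z)))))))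
    where
    go : ∀ c y z → c + y * + 0 ≡ c + z * + 0 + (y - z) * + 0
    go = solve-∀
  pol-divide {f = f} (horner c g p@(horner _ _ _ _) eq) z with pol-divide p z
  ... | h , q , heq = (λ y → g z + y * h y) , horner (g z) h q (λ _ → refl) , λ y →
    trans (eq y) (trans (cong (λ t → c + y * t) (heq y)) (trans (go c y z (g z) (h y)) (cong (λ t → t + (y - z) * (g z + y * h y)) (sym (eq z)))))
    where
    go : ∀ c y z u v → c + y * (u + (y - z) * v) ≡ c + z * u + (y - z) * (u + y * v)
    go = solve-∀

  pol-root : ∀ {κ f} → Pol (suc κ) f → ∀ z → f z ≡ + 0 → Σ (ℤ → ℤ) λ g → Pol κ g × (∀ y → f y ≡ (y - z) * g y)
  pol-root p z fz with pol-divide p z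
  ... | g , q , eq = g , q , λ y → trans (eq y) (trans (cong (λ t → t + (y - z) * g y) fz) (ℤₚ.+-identityˡ _))

  pol-difference : ∀ {κ f} → Pol (suc κ) f → Pol κ (λ y → f (+ 1 + y) - f y)
  pol-difference {f = f} (horner c g (null v) eq) = null (λ y → trans (cong₂ _-_ (const (+ 1 + y)) (const y)) (ℤₚ.+-inverseʳ c))
    where
    go : ∀ c y → c + y * + 0 ≡ c
    go = solve-∀
    const : ∀ y → f y ≡ c
    const y = trans (eq y) (trans (cong (λ t → c + y * t) (v y)) (go c y))
  pol-difference {f = f} (horner c g p@(horner _ _ _ _) eq) = pol-resp
    (λ y → trans (go c y (g (+ 1 + y)) (g y)) (sym (cong₂ _-_ (eq (+ 1 + y)) (eq y))))
    (pol-+ (pol-resp (λ y → cong (λ t → g (+ 1 + t)) (ℤₚ.*-identityˡ y)) (pol-affine (+ 1) (+ 1) p))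
      (horner (+ 0) _ (pol-difference p) (λ _ → refl)))
    where
    go : ∀ c y u v → u + (+ 0 + y * (u - v)) ≡ c + (+ 1 + y) * u - (c + y * v)
    go = solve-∀

  -- `Δ` looks forward and stays within a window; `∂` looks backward and reads 0 below the origin,
  -- so it also sees the jumps at the ends of a function extended by zero. Functionals lead to `Δ`,
  -- elements to `∂`.
  Δ ∂ : (ℕ → ℤ) → ℕ → ℤ
  Δ f y = f (suc y) - f y
  ∂ f y = f y - prev f y

  Δ^ ∂^ : ℕ → (ℕ → ℤ) → ℕ → ℤ
  Δ^ zero    f = f
  Δ^ (suc k) f = Δ (Δ^ k f)
  ∂^ zero    f = f
  ∂^ (suc k) f = ∂ (∂^ k f)

  ∂^-Δ^ : ∀ k f y → ∂^ k f (k ℕ.+ y) ≡ Δ^ k f y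
  ∂^-Δ^ zero    f y = refl
  ∂^-Δ^ (suc k) f y = cong₂ _-_ (trans (cong (∂^ k f) (sym (ℕₚ.+-suc k y))) (∂^-Δ^ k f (suc y))) (∂^-Δ^ k f y)

  Δ^-Δ : ∀ k f y → Δ^ k (Δ f) y ≡ Δ^ (suc k) f y
  Δ^-Δ zero    f y = refl
  Δ^-Δ (suc k) f y = cong₂ _-_ (Δ^-Δ k f (suc y)) (Δ^-Δ k f y)

  Δ^-+ : ∀ k l f y → Δ^ k (Δ^ l f) y ≡ Δ^ (k ℕ.+ l) f y
  Δ^-+ zero    l f y = refl
  Δ^-+ (suc k) l f y = cong₂ _-_ (Δ^-+ k l f (suc y)) (Δ^-+ k l f y)

  Δ^-vanish : ∀ k f n → (∀ y → y ≤ n → f y ≡ + 0) → ∀ y → y ℕ.+ k ≤ n → Δ^ k f y ≡ + 0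
  Δ^-vanish zero    f n v y l = v y (subst (_≤ n) (ℕₚ.+-identityʳ y) l)
  Δ^-vanish (suc k) f n v y l = cong₂ _-_
    (Δ^-vanish k f n v (suc y) (subst (_≤ n) (ℕₚ.+-suc y k) l))
    (Δ^-vanish k f n v y (ℕₚ.≤-trans (ℕₚ.+-monoʳ-≤ y (ℕₚ.n≤1+n k)) l))

  ∂^-vanish-high : ∀ s f m → (∀ y → m ≤ y → f y ≡ + 0) → ∀ y → m ℕ.+ s ≤ y → ∂^ s f y ≡ + 0
  ∂^-vanish-high zero    f m v y       l = v y (subst (_≤ y) (ℕₚ.+-identityʳ m) l)
  ∂^-vanish-high (suc s) f m v zero    l = contradiction (subst (_≤ 0) (ℕₚ.+-suc m s) l) λ ()
  ∂^-vanish-high (suc s) f m v (suc y) l with subst (_≤ suc y) (ℕₚ.+-suc m s) l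
  ... | s≤s l′ = cong₂ _-_ (∂^-vanish-high s f m v (suc y) (ℕₚ.m≤n⇒m≤1+n l′)) (∂^-vanish-high s f m v y l′)

  ∂^-vanish-low : ∀ s f m → (∀ y → y < m → f y ≡ + 0) → ∀ y → y < m → ∂^ s f y ≡ + 0
  ∂^-vanish-low zero    f m v y       l = v y l
  ∂^-vanish-low (suc s) f m v zero    l = cong (λ t → t - + 0) (∂^-vanish-low s f m v zero l)
  ∂^-vanish-low (suc s) f m v (suc y) l = cong₂ _-_ (∂^-vanish-low s f m v (suc y) l) (∂^-vanish-low s f m v y (ℕₚ.<-trans (ℕₚ.n<1+n y) l))

  ∂^-zero : ∀ s f → (∀ y → f y ≡ + 0) → ∀ y → ∂^ s f y ≡ + 0
  ∂^-zero s f v y = ∂^-vanish-low s f (suc y) (λ y _ → v y) y (ℕₚ.n<1+n y)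

  sumTo : ℕ → (ℕ → ℤ) → ℤ
  sumTo zero    t = + 0
  sumTo (suc M) t = sumTo M t + t M

  sumTo-cong : ∀ M {t t′} → (∀ y → t y ≡ t′ y) → sumTo M t ≡ sumTo M t′
  sumTo-cong zero    eq = refl
  sumTo-cong (suc M) eq = cong₂ _+_ (sumTo-cong M eq) (eq M)

  sumTo-scale : ∀ M a t → sumTo M (λ y → a * t y) ≡ a * sumTo M t
  sumTo-scale zero    a t = sym (ℤₚ.*-zeroʳ a)
  sumTo-scale (suc M) a t = trans (cong (λ x → x + a * t M) (sumTo-scale M a t)) (sym (ℤₚ.*-distribˡ-+ a (sumTo M t) (t M)))

  sumTo-+ : ∀ M t t′ → sumTo M (λ y → t y + t′ y) ≡ sumTo M t + sumTo M t′
  sumTo-+ zero    t t′ = refl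
  sumTo-+ (suc M) t t′ = trans (cong (λ x → x + (t M + t′ M)) (sumTo-+ M t t′)) (go (sumTo M t) (sumTo M t′) (t M) (t′ M))
    where
    go : ∀ a b c d → a + b + (c + d) ≡ a + c + (b + d)
    go = solve-∀

  NonNeg : ℤ → Set
  NonNeg x = ∃ λ n → x ≡ + n

  nonNeg-* : ∀ {x y} → NonNeg x → NonNeg y → NonNeg (x * y)
  nonNeg-* (m , refl) (n , refl) = m ℕ.* n , sym (ℤₚ.pos-* m n)

  nonNeg-square : ∀ x → NonNeg (x * x)
  nonNeg-square (+ n)    = nonNeg-* (n , refl) (n , refl)
  nonNeg-square -[1+ n ] = suc n ℕ.* suc n , refl

  sumTo-nonNeg : ∀ M t → (∀ y → y < M → NonNeg (t y)) → NonNeg (sumTo M t)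
  sumTo-nonNeg zero    t nn = 0 , refl
  sumTo-nonNeg (suc M) t nn with sumTo-nonNeg M t (λ y l → nn y (ℕₚ.m≤n⇒m≤1+n l)) | nn M (ℕₚ.n<1+n M)
  ... | a , ea | b , eb = a ℕ.+ b , cong₂ _+_ ea eb

  sumTo-nonNeg-zero : ∀ M t → (∀ y → y < M → NonNeg (t y)) → sumTo M t ≡ + 0 → ∀ y → y < M → t y ≡ + 0
  sumTo-nonNeg-zero (suc M) t nn s0 y l
    with sumTo-nonNeg M t (λ y l → nn y (ℕₚ.m≤n⇒m≤1+n l)) | nn M (ℕₚ.n<1+n M)
  ... | a , ea | b , eb with ℤₚ.+-injective (trans (sym (cong₂ _+_ ea eb)) s0)
  ... | ab with ℕₚ.m≤n⇒m<n∨m≡n (ℕₚ.≤-pred l)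
  ...   | inj₂ refl = trans eb (cong +_ (ℕₚ.m+n≡0⇒n≡0 a ab))
  ...   | inj₁ y<M  = sumTo-nonNeg-zero M t (λ y l → nn y (ℕₚ.m≤n⇒m≤1+n l)) (trans ea (cong +_ (ℕₚ.m+n≡0⇒m≡0 a ab))) y y<M

  summation-by-parts : ∀ M F (η : ℤ → ℤ) →
    sumTo M (λ y → ∂ F y * η (+ y)) ≡ prev F M * η (+ M) + (- (+ 1)) * sumTo M (λ y → F y * (η (+ 1 + + y) - η (+ y)))
  summation-by-parts zero    F η = refl
  summation-by-parts (suc M) F η = trans (cong (λ x → x + ∂ F M * η (+ M)) (summation-by-parts M F η))
    (go (prev F M) (F M) (η (+ M)) (η (+ suc M)) (sumTo M (λ y → F y * (η (+ 1 + + y) - η (+ y)))))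
    where
    go : ∀ a b u v s → a * u + (- (+ 1)) * s + (b - a) * u ≡ b * v + (- (+ 1)) * (s + b * (v - u))
    go = solve-∀

  -- Each summation by parts trades one `∂` for one difference of `η`, until `η` has become zero.
  -- The boundary terms vanish because `M` lies beyond the supports of all intermediate differences.
  orthogonality : ∀ s F m M η → Pol s η → (∀ y → m ≤ y → F y ≡ + 0) → m ℕ.+ s ≤ M →
    sumTo M (λ y → ∂^ s F y * η (+ y)) ≡ + 0
  orthogonality zero F m M η (null z) v l = trans (sumTo-cong M {t′ = λ y → + 0 * F y} (λ y → trans (cong (F y *_) (z (+ y))) (trans (ℤₚ.*-zeroʳ (F y)) (sym (ℤₚ.*-zeroˡ (F y))))))
    (trans (sumTo-scale M (+ 0) F) (ℤₚ.*-zeroˡ (sumTo M F)))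
  orthogonality (suc s) F m zero η p v l = refl
  orthogonality (suc s) F m (suc M) η p v l = trans (summation-by-parts (suc M) (∂^ s F) η)
    (cong₂ _+_ (trans (cong (_* η (+ suc M)) (∂^-vanish-high s F m v M m+s≤M)) (ℤₚ.*-zeroˡ (η (+ suc M))))
      (cong (- (+ 1) *_) (orthogonality s F m (suc M) (λ y → η (+ 1 + y) - η y) (pol-difference p) v (ℕₚ.m≤n⇒m≤1+n m+s≤M))))
    where
    m+s≤M : m ℕ.+ s ≤ M
    m+s≤M = ℕₚ.≤-pred (subst (_≤ suc M) (ℕₚ.+-suc m s) l)

  bin : ℕ → ℕ → ℤ
  bin y       zero    = + 1
  bin zero    (suc k) = + 0
  bin (suc y) (suc k) = bin y k + bin y (suc k)

  -- Absorption turns a binomial coefficient, once its denominator is cleared, into a product of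
  -- linear factors in `y`; `polOn-bin` rests on it.
  bin-absorb : ∀ y k → (+ suc k) * bin y (suc k) ≡ (+ y - + k) * bin y k
  bin-absorb zero zero = refl
  bin-absorb zero (suc k) = trans (ℤₚ.*-zeroʳ (+ suc (suc k))) (sym (ℤₚ.*-zeroʳ (+ 0 - + suc k)))
  bin-absorb (suc y) zero = trans (go (bin y 1)) (trans (cong (λ t → + 1 + t) (bin-absorb y zero)) (go′ (+ y)))
    where
    go : ∀ x → + 1 * (+ 1 + x) ≡ + 1 + + 1 * x
    go = solve-∀
    go′ : ∀ y → + 1 + (y - + 0) * + 1 ≡ (+ 1 + y - + 0) * + 1
    go′ = solve-∀
  bin-absorb (suc y) (suc k) = trans (ℤₚ.*-distribˡ-+ (+ suc (suc k)) X (bin y (suc (suc k))))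
    (trans (cong (λ t → (+ suc (suc k)) * X + t) (bin-absorb y (suc k)))
    (trans (go (+ y) (+ k) X (bin y k)) (trans (cong (λ t → t + (+ y - + k) * X) (bin-absorb y k)) (go″ (+ y) (+ k) X (bin y k)))))
    where
    X : ℤ
    X = bin y (suc k)
    go : ∀ y k X Z → (+ 2 + k) * X + (y - (+ 1 + k)) * X ≡ (+ 1 + k) * X + (y - k) * X
    go = solve-∀
    go″ : ∀ y k X Z → (y - k) * Z + (y - k) * X ≡ (+ 1 + y - (+ 1 + k)) * (Z + X)
    go″ = solve-∀

  -- Up to a positive integer factor, f agrees on [0,n] with an integer polynomial of degree < κ.
  PolOn : ℕ → ℕ → (ℕ → ℤ) → Set
  PolOn n κ f = Σ ℕ λ d → Σ (ℤ → ℤ) λ P → Pol κ P × (∀ y → y ≤ n → (+ suc d) * f y ≡ P (+ y))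

  polOn-bin : ∀ n k → PolOn n (suc k) (λ y → bin y k)
  polOn-bin n zero = 0 , (λ _ → + 1) , pol-const 0 (+ 1) , λ _ _ → refl
  polOn-bin n (suc k) with polOn-bin n k
  ... | d , P , p , eq = k ℕ.+ d ℕ.* suc k , (λ y → (- (+ k) + + 1 * y) * P y) , pol-linear (- (+ k)) (+ 1) p , λ y y≤n → begin
    (+ (suc d ℕ.* suc k)) * bin y (suc k)      ≡⟨ cong (_* bin y (suc k)) (ℤₚ.pos-* (suc d) (suc k)) ⟩
    (+ suc d) * (+ suc k) * bin y (suc k)      ≡⟨ ℤₚ.*-assoc (+ suc d) (+ suc k) (bin y (suc k)) ⟩
    (+ suc d) * ((+ suc k) * bin y (suc k))    ≡⟨ cong ((+ suc d) *_) (bin-absorb y k) ⟩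
    (+ suc d) * ((+ y - + k) * bin y k)        ≡⟨ go (+ suc d) (+ y) (+ k) (bin y k) ⟩
    (- (+ k) + + 1 * + y) * ((+ suc d) * bin y k) ≡⟨ cong ((- (+ k) + + 1 * + y) *_) (eq y y≤n) ⟩
    (- (+ k) + + 1 * + y) * P (+ y) ∎
    where
    open ≡-Reasoning
    go : ∀ d y k b → d * ((y - k) * b) ≡ (- k + + 1 * y) * (d * b)
    go = solve-∀

  polOn-+ : ∀ {n κ f g} → PolOn n κ f → PolOn n κ g → PolOn n κ (λ y → f y + g y)
  polOn-+ {f = f} {g} (d , P , p , eq) (e , Q , q , eq′) =
    e ℕ.+ d ℕ.* suc e , (λ y → (+ suc e) * P y + (+ suc d) * Q y) , pol-+ (pol-scale (+ suc e) p) (pol-scale (+ suc d) q) , λ y y≤n →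
    trans (cong (_* (f y + g y)) (ℤₚ.pos-* (suc d) (suc e))) (trans (go (+ suc d) (+ suc e) (f y) (g y)) (cong₂ (λ u v → (+ suc e) * u + (+ suc d) * v) (eq y y≤n) (eq′ y y≤n)))
    where
    go : ∀ d e u v → d * e * (u + v) ≡ e * (d * u) + d * (e * v)
    go = solve-∀

  polOn-scale : ∀ {n κ f} a → PolOn n κ f → PolOn n κ (λ y → f y * a)
  polOn-scale {f = f} a (d , P , p , eq) = d , (λ y → a * P y) , pol-scale a p , λ y y≤n → trans (go (+ suc d) (f y) a) (cong (a *_) (eq y y≤n))
    where
    go : ∀ d f a → d * (f * a) ≡ a * (d * f)
    go = solve-∀

  polOn-≤ : ∀ {n κ κ′ f} → κ ≤ κ′ → PolOn n κ f → PolOn n κ′ f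
  polOn-≤ l (d , P , p , eq) = d , P , pol-≤ l p , eq

  polOn-newton : ∀ n κ (a : ℕ → ℤ) → PolOn n κ (λ y → sumTo κ (λ k → bin y k * a k))
  polOn-newton n zero    a = 0 , (λ _ → + 0) , pol-zero 0 , λ _ _ → refl
  polOn-newton n (suc κ) a = polOn-+ {f = λ y → sumTo κ (λ k → bin y k * a k)} (polOn-≤ (ℕₚ.n≤1+n κ) (polOn-newton n κ a)) (polOn-scale (a κ) (polOn-bin n κ))

  sumTo-front : ∀ κ (g : ℕ → ℤ) → sumTo (suc κ) (prev g) ≡ sumTo κ g
  sumTo-front zero    g = refl
  sumTo-front (suc κ) g = cong (λ x → x + g κ) (sumTo-front κ g)

  newton-sum : ℕ → (ℕ → ℤ) → ℕ → ℤ
  newton-sum κ f y = sumTo κ (λ k → bin y k * Δ^ k f 0)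

  newton-sum-0 : ∀ κ f → newton-sum (suc κ) f 0 ≡ f 0
  newton-sum-0 zero    f = trans (ℤₚ.+-identityˡ _) (ℤₚ.*-identityˡ (f 0))
  newton-sum-0 (suc κ) f = trans (cong₂ _+_ (newton-sum-0 κ f) (ℤₚ.*-zeroˡ (Δ^ (suc κ) f 0))) (ℤₚ.+-identityʳ (f 0))

  newton-sum-suc : ∀ κ f y → newton-sum (suc κ) f (suc y) ≡ newton-sum (suc κ) f y + newton-sum κ (Δ f) y
  newton-sum-suc κ f y = trans (sumTo-cong (suc κ) {t′ = λ k → bin y k * Δ^ k f 0 + prev (λ k → bin y k * Δ^ k (Δ f) 0) k} pascal)
    (trans (sumTo-+ (suc κ) (λ k → bin y k * Δ^ k f 0) (prev (λ k → bin y k * Δ^ k (Δ f) 0))) (cong (λ t → newton-sum (suc κ) f y + t) (sumTo-front κ (λ k → bin y k * Δ^ k (Δ f) 0))))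
    where
    go : ∀ a b x → (a + b) * x ≡ b * x + a * x
    go = solve-∀
    pascal : ∀ k → bin (suc y) k * Δ^ k f 0 ≡ bin y k * Δ^ k f 0 + prev (λ k → bin y k * Δ^ k (Δ f) 0) k
    pascal zero    = sym (ℤₚ.+-identityʳ _)
    pascal (suc k) = trans (go (bin y k) (bin y (suc k)) (Δ^ (suc k) f 0)) (cong (λ t → bin y (suc k) * Δ^ (suc k) f 0 + bin y k * t) (sym (Δ^-Δ k f 0)))

  -- Newton's forward series at 0. Passing from `y` to `y + 1` adds the series of `Δ f`, which has
  -- one term fewer and is needed on one point fewer, hence the simultaneous induction on `n` and
  -- `κ`.
  newton-formula : ∀ n κ f → (∀ y → y ℕ.+ κ ≤ n → Δ^ κ f y ≡ + 0) → ∀ y → y ≤ n → f y ≡ newton-sum κ f y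
  newton-formula n zero    f v y       l = v y (subst (_≤ n) (sym (ℕₚ.+-identityʳ y)) l)
  newton-formula n (suc κ) f v zero    l = sym (newton-sum-0 κ f)
  newton-formula (suc n) (suc κ) f v (suc y) (s≤s l) = begin
    f (suc y)                                        ≡⟨ go (f (suc y)) (f y) ⟩
    f y + Δ f y                                      ≡⟨ cong₂ _+_ (newton-formula (suc n) (suc κ) f v y (ℕₚ.m≤n⇒m≤1+n l))
                                                        (newton-formula n κ (Δ f) (λ x x≤ → trans (Δ^-Δ κ f x) (v x (subst (_≤ suc n) (sym (ℕₚ.+-suc x κ)) (s≤s x≤)))) y l) ⟩
    newton-sum (suc κ) f y + newton-sum κ (Δ f) y    ≡⟨ newton-sum-suc κ f y ⟨
    newton-sum (suc κ) f (suc y)                     ∎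
    where
    open ≡-Reasoning
    go : ∀ a b → a ≡ b + (a - b)
    go = solve-∀

  polOn-difference : ∀ n κ f → (∀ y → y ℕ.+ κ ≤ n → Δ^ κ f y ≡ + 0) → PolOn n κ f
  polOn-difference n κ f v with polOn-newton n κ (λ k → Δ^ k f 0)
  ... | d , P , p , eq = d , P , p , λ y l → trans (cong ((+ suc d) *_) (newton-formula n κ f v y l)) (eq y l)

  cancel : ∀ {a b} → a ≢ + 0 → a * b ≡ + 0 → b ≡ + 0
  cancel {a} a≢0 ab with ℤₚ.i*j≡0⇒i≡0∨j≡0 a ab
  ... | inj₁ a≡0 = contradiction a≡0 a≢0
  ... | inj₂ b≡0 = b≡0

  suc≢0 : ∀ {n} → + suc n ≢ + 0
  suc≢0 ()

  -- The falling factorial y(y - 1)⋯(y - α + 1), which vanishes at 0, ..., α - 1 and is positive at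
  -- every later integer.
  ff : ℕ → ℤ → ℤ
  ff zero    y = + 1
  ff (suc α) y = ff α y * (y - + α)

  minus : ∀ {a b} → b ≤ a → + a - + b ≡ + (a ∸ b)
  minus {a} {b} l = trans (ℤₚ.m-n≡m⊖n a b) (ℤₚ.⊖-≥ l)

  ff-zero : ∀ α y → y < α → ff α (+ y) ≡ + 0
  ff-zero (suc α) y l with ℕₚ.m≤n⇒m<n∨m≡n (ℕₚ.≤-pred l)
  ... | inj₁ y<α  = trans (cong (_* (+ y - + α)) (ff-zero α y y<α)) (ℤₚ.*-zeroˡ (+ y - + α))
  ... | inj₂ refl = trans (cong (ff y (+ y) *_) (ℤₚ.+-inverseʳ (+ y))) (ℤₚ.*-zeroʳ (ff y (+ y)))

  ff-pos : ∀ α y → α ≤ y → ∃ λ n → ff α (+ y) ≡ + suc n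
  ff-pos zero    y l = 0 , refl
  ff-pos (suc α) y l with ff-pos α y (ℕₚ.<⇒≤ l)
  ... | n , eq = _ , trans (cong₂ _*_ eq (trans (minus (ℕₚ.<⇒≤ l)) (cong +_ (ℕₚ.+-∸-assoc 1 l)))) (sym (ℤₚ.pos-* (suc n) (suc (y ∸ suc α))))

  ff-nonNeg : ∀ α y → NonNeg (ff α (+ y))
  ff-nonNeg α y with ℕₚ.<-≤-connex y α
  ... | inj₁ l = 0 , ff-zero α y l
  ... | inj₂ l with ff-pos α y l
  ...   | n , eq = suc n , eq

  ff-≢0 : ∀ α y → α ≤ y → ff α (+ y) ≢ + 0
  ff-≢0 α y l eq with ff-pos α y l
  ... | n , eq′ = suc≢0 (trans (sym eq′) eq)

  divide-left : ∀ α κ P → Pol (α ℕ.+ κ) P → (∀ i → i < α → P (+ i) ≡ + 0) →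
    Σ (ℤ → ℤ) λ θ → Pol κ θ × (∀ y → P y ≡ ff α y * θ y)
  divide-left zero    κ P p v = P , p , λ y → sym (ℤₚ.*-identityˡ (P y))
  divide-left (suc α) κ P p v with divide-left α (suc κ) P (subst (λ k → Pol k P) (sym (ℕₚ.+-suc α κ)) p) (λ i l → v i (ℕₚ.m≤n⇒m≤1+n l))
  ... | θ , q , eq with pol-root q (+ α) (cancel (ff-≢0 α α ℕₚ.≤-refl) (trans (sym (eq (+ α))) (v α (ℕₚ.n<1+n α))))
  ... | θ′ , q′ , eq′ = θ′ , q′ , λ y → trans (eq y) (trans (cong (ff α y *_) (eq′ y)) (sym (ℤₚ.*-assoc (ff α y) (y - + α) (θ′ y))))

  -- The reflection y ↦ M - y turns the right run of roots into a left one. The bound on `α + β`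
  -- keeps the runs disjoint, so the quotient by the left factor still vanishes on the right run.
  divide-both : ∀ M α β κ P → Pol (α ℕ.+ (β ℕ.+ κ)) P → α ℕ.+ β ≤ suc M →
    (∀ i → i < α → P (+ i) ≡ + 0) → (∀ i i′ → i ℕ.+ i′ ≡ M → i < β → P (+ i′) ≡ + 0) →
    Σ (ℤ → ℤ) λ θ → Pol κ θ × (∀ y → P y ≡ ff α y * ff β (+ M - y) * θ y)
  divide-both M α β κ P p αβ vl vr with divide-left α (β ℕ.+ κ) P p vl
  ... | θ , q , eq with divide-left β κ (λ y → θ (+ M + (- (+ 1)) * y)) (pol-affine (+ M) (- (+ 1)) q) right
    where
    right : ∀ i → i < β → θ (+ M + (- (+ 1)) * + i) ≡ + 0
    right i i<β = trans (cong θ index) (cancel (ff-≢0 α (M ∸ i) α≤) (trans (sym (eq (+ (M ∸ i)))) (vr i (M ∸ i) (ℕₚ.m+[n∸m]≡n i≤M) i<β)))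
      where
      go : ∀ x y → x + (- (+ 1)) * y ≡ x - y
      go = solve-∀
      i+α≤M : i ℕ.+ α ≤ M
      i+α≤M = ℕₚ.≤-pred (ℕₚ.≤-trans (ℕₚ.+-monoˡ-≤ α i<β) (subst (_≤ suc M) (ℕₚ.+-comm α β) αβ))
      i≤M : i ≤ M
      i≤M = ℕₚ.m+n≤o⇒m≤o i i+α≤M
      α≤ : α ≤ M ∸ i
      α≤ = ℕₚ.m+n≤o⇒m≤o∸n α (subst (_≤ M) (ℕₚ.+-comm i α) i+α≤M)
      index : + M + (- (+ 1)) * + i ≡ + (M ∸ i)
      index = trans (go (+ M) (+ i)) (minus i≤M)
  ... | θ′ , q′ , eq′ = (λ y → θ′ (+ M + (- (+ 1)) * y)) , pol-affine (+ M) (- (+ 1)) q′ , λ y →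
    trans (eq y) (trans (cong (ff α y *_) (trans (cong θ (flip (+ M) y)) (trans (eq′ (+ M + (- (+ 1)) * y)) (cong (λ t → ff β t * θ′ (+ M + (- (+ 1)) * y)) (go (+ M) y)))))
      (sym (ℤₚ.*-assoc (ff α y) (ff β (+ M - y)) (θ′ (+ M + (- (+ 1)) * y)))))
    where
    go : ∀ x y → x + (- (+ 1)) * y ≡ x - y
    go = solve-∀
    flip : ∀ x y → y ≡ x + (- (+ 1)) * (x + (- (+ 1)) * y)
    flip = solve-∀

  pol-vanish : ∀ M α β κ P → Pol κ P → κ ≤ suc M → κ ≤ α ℕ.+ β →
    (∀ i → i < α → P (+ i) ≡ + 0) → (∀ i i′ → i ℕ.+ i′ ≡ M → i < β → P (+ i′) ≡ + 0) → ∀ y → P y ≡ + 0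
  pol-vanish M α β κ P p κ≤M κ≤αβ vl vr = go (divide-both M α′ β′ 0 P (subst (λ k → Pol k P) (sym total) p)
      (subst (_≤ suc M) (sym total′) κ≤M) (λ i l → vl i (ℕₚ.≤-trans l (ℕₚ.m⊓n≤m α κ))) (λ i i′ e l → vr i i′ e (ℕₚ.≤-trans l β′≤β)))
    where
    -- Exactly `κ` roots are used, as many as possible from the left. As `κ` is at most M + 1, the
    -- shortened runs cannot overlap.
    α′ β′ : ℕ
    α′ = α ⊓ κ
    β′ = κ ∸ α′
    total′ : α′ ℕ.+ β′ ≡ κ
    total′ = ℕₚ.m+[n∸m]≡n (ℕₚ.m⊓n≤n α κ)
    total : α′ ℕ.+ (β′ ℕ.+ 0) ≡ κ
    total = trans (cong (α′ ℕ.+_) (ℕₚ.+-identityʳ β′)) total′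
    β′≤β : β′ ≤ β
    β′≤β with ℕₚ.≤-total α κ
    ... | inj₁ α≤κ rewrite ℕₚ.m≤n⇒m⊓n≡m α≤κ = ℕₚ.m≤n+o⇒m∸n≤o κ α κ≤αβ
    ... | inj₂ κ≤α rewrite ℕₚ.m≥n⇒m⊓n≡n κ≤α = subst (_≤ β) (sym (ℕₚ.n∸n≡0 κ)) z≤n
    go : (Σ (ℤ → ℤ) λ θ → Pol 0 θ × (∀ y → P y ≡ ff α′ y * ff β′ (+ M - y) * θ y)) → ∀ y → P y ≡ + 0
    go (θ , null z , eq) y = trans (eq y) (trans (cong (ff α′ y * ff β′ (+ M - y) *_) (z y)) (ℤₚ.*-zeroʳ (ff α′ y * ff β′ (+ M - y))))

  polOn-vanish : ∀ M α β κ f → PolOn M κ f → κ ≤ suc M → κ ≤ α ℕ.+ β →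
    (∀ i → i < α → i ≤ M → f i ≡ + 0) → (∀ i i′ → i ℕ.+ i′ ≡ M → i < β → f i′ ≡ + 0) → ∀ y → y ≤ M → f y ≡ + 0
  polOn-vanish M α β κ f (d , P , p , eq) κ≤M κ≤αβ vl vr y y≤M = cancel {+ suc d} suc≢0 (trans (eq y y≤M)
    (pol-vanish M (α ⊓ suc M) β κ P p κ≤M κ≤ (λ i l → let i≤M = ℕₚ.≤-pred (ℕₚ.≤-trans l (ℕₚ.m⊓n≤n α (suc M))) in
       trans (sym (eq i i≤M)) (trans (cong ((+ suc d) *_) (vl i (ℕₚ.≤-trans l (ℕₚ.m⊓n≤m α (suc M))) i≤M)) (ℤₚ.*-zeroʳ (+ suc d))))
     (λ i i′ e l → trans (sym (eq i′ (subst (i′ ≤_) e (ℕₚ.m≤n+m i′ i)))) (trans (cong ((+ suc d) *_) (vr i i′ e l)) (ℤₚ.*-zeroʳ (+ suc d)))) (+ y)))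
    where
    κ≤ : κ ≤ α ⊓ suc M ℕ.+ β
    κ≤ with ℕₚ.≤-total α (suc M)
    ... | inj₁ l rewrite ℕₚ.m≤n⇒m⊓n≡m l = κ≤αβ
    ... | inj₂ l rewrite ℕₚ.m≥n⇒m⊓n≡n l = ℕₚ.≤-trans κ≤M (ℕₚ.m≤m+n (suc M) β)

  rootProduct : List ℕ → ℤ → ℤ
  rootProduct []       y = + 1
  rootProduct (z ∷ zs) y = (- (+ z) + + 1 * y) * rootProduct zs y

  pol-rootProduct : ∀ zs → Pol (suc (length zs)) (rootProduct zs)
  pol-rootProduct []       = pol-const 0 (+ 1)
  pol-rootProduct (z ∷ zs) = pol-linear (- (+ z)) (+ 1) (pol-rootProduct zs)

  rootProduct-zero : ∀ {zs z} → z ∈ zs → rootProduct zs (+ z) ≡ + 0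
  rootProduct-zero {z ∷ zs} (here refl) = go (+ z) (rootProduct zs (+ z))
    where
    go : ∀ z x → (- z + + 1 * z) * x ≡ + 0
    go = solve-∀
  rootProduct-zero {z′ ∷ zs} {z} (there z∈) = trans (cong ((- (+ z′) + + 1 * + z) *_) (rootProduct-zero z∈)) (ℤₚ.*-zeroʳ (- (+ z′) + + 1 * + z))

  difference≢0 : ∀ z y → y ≢ z → - (+ z) + + 1 * + y ≢ + 0
  difference≢0 z y y≢z eq = y≢z (trans (ℤₚ.+-injective (trans (go (+ z) (+ y)) (cong (λ t → + z + t) eq))) (ℕₚ.+-identityʳ z))
    where
    go : ∀ z y → y ≡ z + (- z + + 1 * y)
    go = solve-∀

  rootProduct-≢0 : ∀ {zs y} → All (y ≢_) zs → rootProduct zs (+ y) ≢ + 0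
  rootProduct-≢0 [] = λ ()
  rootProduct-≢0 {z ∷ zs} {y} (p ∷ ps) eq = rootProduct-≢0 ps (cancel (difference≢0 z y p) eq)

  pol-many-roots : ∀ {κ P} zs → Pol κ P → Unique zs → κ ≤ length zs → (∀ {z} → z ∈ zs → P (+ z) ≡ + 0) → ∀ y → P y ≡ + 0
  pol-many-roots zs (null z) u l v = z
  pol-many-roots (z ∷ zs) p@(horner _ _ _ _) (px ∷ u) (s≤s l) v y with pol-root p (+ z) (v (here refl))
  ... | g , q , eq = trans (eq y) (trans (cong ((y - + z) *_) (pol-many-roots zs q u l root y)) (ℤₚ.*-zeroʳ (y - + z)))
    where
    go : ∀ a b → - b + + 1 * a ≡ a - b
    go = solve-∀
    root : ∀ {w} → w ∈ zs → g (+ w) ≡ + 0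
    root {w} w∈ = cancel (λ e → difference≢0 z w (λ w≡z → All.lookup px w∈ (sym w≡z)) (trans (go (+ w) (+ z)) e)) (trans (sym (eq (+ w))) (v (there w∈)))

  -- The product of y - p + i for 1 ≤ i ≤ u: it vanishes at the `u` integers just below `p` and is
  -- positive from `p` on. `falling` is its mirror image, with roots at the `v` integers just above
  -- `N`.
  rising : ℕ → ℕ → ℤ → ℤ
  rising p zero    y = + 1
  rising p (suc u) y = (+ suc u - + p + + 1 * y) * rising p u y

  pol-rising : ∀ {κ f} p u → Pol κ f → Pol (u ℕ.+ κ) (λ y → rising p u y * f y)
  pol-rising {f = f} p zero    q = pol-resp (λ y → sym (ℤₚ.*-identityˡ (f y))) q
  pol-rising {f = f} p (suc u) q = pol-resp (λ y → sym (ℤₚ.*-assoc (+ suc u - + p + + 1 * y) (rising p u y) (f y))) (pol-linear (+ suc u - + p) (+ 1) (pol-rising p u q))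

  rising-zero : ∀ p u y → y < p → p ≤ y ℕ.+ u → rising p u (+ y) ≡ + 0
  rising-zero p zero    y l l′ = contradiction (ℕₚ.≤-trans l (subst (p ≤_) (ℕₚ.+-identityʳ y) l′)) (ℕₚ.<-irrefl refl)
  rising-zero p (suc u) y l l′ with ℕₚ.m≤n⇒m<n∨m≡n l′
  ... | inj₂ refl = trans (cong (_* rising p u (+ y)) (trans (cong (λ t → + suc u - t + + 1 * + y) (ℤₚ.pos-+ y (suc u))) (go (+ suc u) (+ y)))) (ℤₚ.*-zeroˡ (rising p u (+ y)))
    where
    go : ∀ u y → u - (y + u) + + 1 * y ≡ + 0
    go = solve-∀
  ... | inj₁ l″ = trans (cong ((+ suc u - + p + + 1 * + y) *_) (rising-zero p u y l (ℕₚ.≤-pred (subst (p <_) (ℕₚ.+-suc y u) l″)))) (ℤₚ.*-zeroʳ (+ suc u - + p + + 1 * + y))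

  rising-pos : ∀ p u t → ∃ λ n → rising p u (+ (p ℕ.+ t)) ≡ + suc n
  rising-pos p zero    t = 0 , refl
  rising-pos p (suc u) t with rising-pos p u t
  ... | n , eq = _ , trans (cong₂ _*_ (trans (cong (λ x → + suc u - + p + + 1 * x) (ℤₚ.pos-+ p t)) (go (+ suc u) (+ p) (+ t))) eq) (sym (ℤₚ.pos-* (suc (u ℕ.+ t)) (suc n)))
    where
    go : ∀ u p t → u - p + + 1 * (p + t) ≡ u + t
    go = solve-∀

  falling : ℕ → ℕ → ℤ → ℤ
  falling N zero    y = + 1
  falling N (suc v) y = (+ N + + suc v + (- (+ 1)) * y) * falling N v y

  pol-falling : ∀ {κ f} N v → Pol κ f → Pol (v ℕ.+ κ) (λ y → falling N v y * f y)
  pol-falling {f = f} N zero    q = pol-resp (λ y → sym (ℤₚ.*-identityˡ (f y))) q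
  pol-falling {f = f} N (suc v) q = pol-resp (λ y → sym (ℤₚ.*-assoc (+ N + + suc v + (- (+ 1)) * y) (falling N v y) (f y))) (pol-linear (+ N + + suc v) (- (+ 1)) (pol-falling N v q))

  falling-zero : ∀ N v y → N < y → y ≤ N ℕ.+ v → falling N v (+ y) ≡ + 0
  falling-zero N zero    y l l′ = contradiction (ℕₚ.≤-trans l (subst (y ≤_) (ℕₚ.+-identityʳ N) l′)) (ℕₚ.<-irrefl refl)
  falling-zero N (suc v) y l l′ with ℕₚ.m≤n⇒m<n∨m≡n l′
  ... | inj₂ refl = trans (cong (_* falling N v (+ y)) (trans (cong (λ t → + N + + suc v + (- (+ 1)) * t) (ℤₚ.pos-+ N (suc v))) (go (+ N) (+ suc v)))) (ℤₚ.*-zeroˡ (falling N v (+ y)))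
    where
    go : ∀ n v → n + v + (- (+ 1)) * (n + v) ≡ + 0
    go = solve-∀
  ... | inj₁ l″ = trans (cong ((+ N + + suc v + (- (+ 1)) * + y) *_) (falling-zero N v y l (ℕₚ.≤-pred (subst (y <_) (ℕₚ.+-suc N v) l″)))) (ℤₚ.*-zeroʳ (+ N + + suc v + (- (+ 1)) * + y))

  falling-pos : ∀ N v y t → y ℕ.+ t ≡ N → ∃ λ n → falling N v (+ y) ≡ + suc n
  falling-pos N zero    y t e = 0 , refl
  falling-pos N (suc v) y t refl with falling-pos N v y t refl
  ... | n , eq = _ , trans (cong₂ _*_ (trans (cong (λ x → x + + suc v + (- (+ 1)) * + y) (ℤₚ.pos-+ y t)) (go (+ y) (+ t) (+ suc v))) eq) (sym (ℤₚ.pos-* (suc (v ℕ.+ t)) (suc n)))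
    where
    go : ∀ y t v → y + t + v + (- (+ 1)) * y ≡ v + t
    go = solve-∀

  -- Test ∂ᵖF against rising · falling · θ: on [p, N] every summand is a nonnegative multiple of θ², outside it
  -- vanishes, so all summands are zero.
  gap-lemma : ∀ p N (F : ℕ → ℤ) u v κ θ (w : ℕ → ℤ) d →
    (∀ y → N < y → F y ≡ + 0) →
    (∀ y → y < p → ∂^ p F y ≡ + 0 ⊎ p ≤ y ℕ.+ u) →
    (∀ y → N < y → ∂^ p F y ≡ + 0 ⊎ y ≤ N ℕ.+ v) →
    Pol κ θ → u ℕ.+ (v ℕ.+ κ) ≤ p →
    (∀ y → p ≤ y → y ≤ N → NonNeg (w y)) →
    (∀ y → p ≤ y → y ≤ N → (+ suc d) * ∂^ p F y ≡ w y * θ (+ y)) →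
    ∀ y → p ≤ y → y ≤ N → w y * θ (+ y) ≡ + 0
  gap-lemma p N F u v κ θ w d high left right q size w≥0 eq y p≤y y≤N =
    [ (λ wθ≡0 → wθ≡0) , (λ θ≡0 → trans (cong (w y *_) θ≡0) (ℤₚ.*-zeroʳ (w y))) ]′ (ℤₚ.i*j≡0⇒i≡0∨j≡0 (w y * θ (+ y)) product-zero)
    where
    η : ℤ → ℤ
    η y = rising p u y * (falling N v y * θ y)
    term : ℕ → ℤ
    term y = (+ suc d) * (∂^ p F y * η (+ y))
    -- `F` vanishes from N + 1 on, hence ∂ᵖF from N + 1 + p on: the sum runs over the whole support.
    M : ℕ
    M = suc N ℕ.+ p
    total : sumTo M term ≡ + 0
    total = trans (sumTo-scale M (+ suc d) (λ y → ∂^ p F y * η (+ y)))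
      (trans (cong ((+ suc d) *_) (orthogonality p F (suc N) M η (pol-≤ size (pol-rising p u (pol-falling N v q))) high ℕₚ.≤-refl)) (ℤₚ.*-zeroʳ (+ suc d)))
    arrange : ∀ d x r f t → d * (x * (r * (f * t))) ≡ r * f * (d * x * t)
    arrange = solve-∀
    inner : ∀ y → p ≤ y → y ≤ N → term y ≡ rising p u (+ y) * falling N v (+ y) * (w y * θ (+ y) * θ (+ y))
    inner y l l′ = trans (arrange (+ suc d) (∂^ p F y) (rising p u (+ y)) (falling N v (+ y)) (θ (+ y)))
      (cong (λ t → rising p u (+ y) * falling N v (+ y) * (t * θ (+ y))) (eq y l l′))
    killed : ∀ y → (∂^ p F y ≡ + 0 ⊎ η (+ y) ≡ + 0) → term y ≡ + 0
    killed y (inj₁ e) = trans (cong (λ t → (+ suc d) * (t * η (+ y))) e) (trans (cong ((+ suc d) *_) (ℤₚ.*-zeroˡ (η (+ y)))) (ℤₚ.*-zeroʳ (+ suc d)))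
    killed y (inj₂ e) = trans (cong (λ t → (+ suc d) * (∂^ p F y * t)) e) (trans (cong ((+ suc d) *_) (ℤₚ.*-zeroʳ (∂^ p F y))) (ℤₚ.*-zeroʳ (+ suc d)))
    positive : ∀ y → p ≤ y → y ≤ N → ∃ λ n → rising p u (+ y) * falling N v (+ y) ≡ + suc n
    positive y l l′ with subst (λ z → ∃ λ n → rising p u (+ z) ≡ + suc n) (ℕₚ.m+[n∸m]≡n l) (rising-pos p u (y ∸ p)) | falling-pos N v y (N ∸ y) (ℕₚ.m+[n∸m]≡n l′)
    ... | m , e | n , e′ = _ , trans (cong₂ _*_ e e′) (sym (ℤₚ.pos-* (suc m) (suc n)))
    nonNeg-θ² : ∀ y → p ≤ y → y ≤ N → NonNeg (w y * θ (+ y) * θ (+ y))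
    nonNeg-θ² y l l′ = subst NonNeg (sym (ℤₚ.*-assoc (w y) (θ (+ y)) (θ (+ y)))) (nonNeg-* (w≥0 y l l′) (nonNeg-square (θ (+ y))))
    nonNeg : ∀ y → y < M → NonNeg (term y)
    nonNeg y _ with ℕₚ.<-≤-connex y p
    ... | inj₁ y<p = 0 , killed y (Sum.map₂ (λ l → trans (cong (_* (falling N v (+ y) * θ (+ y))) (rising-zero p u y y<p l)) (ℤₚ.*-zeroˡ (falling N v (+ y) * θ (+ y)))) (left y y<p))
    ... | inj₂ p≤y with ℕₚ.<-≤-connex N y
    ...   | inj₁ N<y = 0 , killed y (Sum.map₂ (λ l → trans (cong (λ t → rising p u (+ y) * (t * θ (+ y))) (falling-zero N v y N<y l))
                            (trans (cong (rising p u (+ y) *_) (ℤₚ.*-zeroˡ (θ (+ y)))) (ℤₚ.*-zeroʳ (rising p u (+ y))))) (right y N<y))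
    ...   | inj₂ y≤N with positive y p≤y y≤N
    ...     | n , e = subst NonNeg (sym (inner y p≤y y≤N)) (nonNeg-* (suc n , e) (nonNeg-θ² y p≤y y≤N))
    product-zero : w y * θ (+ y) * θ (+ y) ≡ + 0
    product-zero with positive y p≤y y≤N
    ... | n , e = cancel {+ suc n} suc≢0 (trans (cong (_* (w y * θ (+ y) * θ (+ y))) (sym e)) (trans (sym (inner y p≤y y≤N))
          (sumTo-nonNeg-zero M term nonNeg total y (ℕₚ.≤-trans (s≤s y≤N) (ℕₚ.m≤m+n (suc N) p)))))

-- One and two variables.

module TwoVariables where
  open import Data.Integer using (_+_; _*_; -_; _-_)
  open ℤSolver using (solve-∀)
  open ≡ using (refl; sym; trans; cong; cong₂; subst)
  open IntegerOperators
  open Enumerations using (standard?; standard-downClosed)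
  open FieldTransfer using (PrimalInjective; DualInjective)
  open FiniteDifferences

  sgn : ℕ → ℤ
  sgn zero    = + 1
  sgn (suc n) = - sgn n

  sgn-square : ∀ n → sgn n * sgn n ≡ + 1
  sgn-square zero    = refl
  sgn-square (suc n) = trans (go (sgn n)) (sgn-square n)
    where
    go : ∀ x → (- x) * (- x) ≡ x * x
    go = solve-∀

  sgn-cancel : ∀ n {x} → sgn n * x ≡ + 0 → x ≡ + 0
  sgn-cancel n {x} eq = trans (sym (ℤₚ.*-identityˡ x)) (trans (cong (_* x) (sym (sgn-square n)))
    (trans (ℤₚ.*-assoc (sgn n) (sgn n) x) (trans (cong (sgn n *_) eq) (ℤₚ.*-zeroʳ (sgn n)))))

  D-above : ∀ {r} (f : Fn r) a → (∀ b → a ∣ₘ b → f b ≡ + 0) → D f a ≡ + 0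
  D-above f []      v = refl
  D-above f (x ∷ a) v = cong₂ _+_ (v (suc x ∷ a) (ℕₚ.n≤1+n x ∷ ∣ₘ-refl)) (D-above (λ b → f (x ∷ b)) a (λ b ab → v (x ∷ b) (ℕₚ.≤-refl ∷ ab)))

  D^-above : ∀ {r} s (f : Fn r) a → (∀ b → a ∣ₘ b → f b ≡ + 0) → D^ s f a ≡ + 0
  D^-above zero    f a v = v a ∣ₘ-refl
  D^-above (suc s) f a v = D^-above s (D f) a (λ b ab → D-above f b (λ c bc → v c (∣ₘ-trans ab bc)))

  -- Everything above a nonstandard exponent is nonstandard, and there `φ` vanishes. So the kernel
  -- equations hold throughout degree `j`, as difference equations without gaps.
  D^-kills-all : ∀ {r} (gs : Gens r) s j (φ : Fn r) → (∀ b → ¬ (Standard gs b × deg b ≡ j ℕ.+ s) → φ b ≡ + 0) →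
    (∀ a → Standard gs a → deg a ≡ j → D^ s φ a ≡ + 0) → ∀ a → deg a ≡ j → D^ s φ a ≡ + 0
  D^-kills-all gs s j φ supp ker a dg with standard? gs a
  ... | yes std = ker a std dg
  ... | no ¬std = D^-above s φ a (λ b ab → supp b (λ p → ¬std (standard-downClosed gs ab (proj₁ p))))

  lefschetz₁ : ∀ (gs : Gens 1) s j → PrimalInjective gs s j ⊎ DualInjective gs s j
  lefschetz₁ gs s j = inj₂ dual
    where
    shift : ∀ s (φ : Fn 1) x → D^ s φ (x ∷ []) ≡ φ (x ℕ.+ s ∷ [])
    shift zero    φ x = cong (λ t → φ (t ∷ [])) (sym (ℕₚ.+-identityʳ x))
    shift (suc s) φ x = trans (shift s (D φ) x) (trans (ℤₚ.+-identityʳ _) (cong (λ t → φ (t ∷ [])) (sym (ℕₚ.+-suc x s))))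
    dual : DualInjective gs s j
    dual φ supp ker (y ∷ []) with y ℕ.≟ j ℕ.+ s
    ... | no ne = supp (y ∷ []) (λ p → ne (trans (sym (ℕₚ.+-identityʳ y)) (proj₂ p)))
    ... | yes refl = trans (sym (shift s φ j)) (D^-kills-all gs s j φ supp ker (j ∷ []) (ℕₚ.+-identityʳ j))

  sumTo-single : ∀ M t y → y < M → (∀ x → x < M → x ≢ y → t x ≡ + 0) → sumTo M t ≡ t y
  sumTo-single (suc M) t y l v with y ℕ.≟ M
  ... | yes refl = trans (cong (λ x → x + t M) (all-zero M (λ x x<M → v x (ℕₚ.m≤n⇒m≤1+n x<M) (ℕₚ.<⇒≢ x<M)))) (ℤₚ.+-identityˡ (t M))
    where
    all-zero : ∀ N → (∀ x → x < N → t x ≡ + 0) → sumTo N t ≡ + 0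
    all-zero zero    z = refl
    all-zero (suc N) z = cong₂ _+_ (all-zero N (λ x l → z x (ℕₚ.m≤n⇒m≤1+n l))) (z N (ℕₚ.n<1+n N))
  ... | no ne = trans (cong₂ _+_ (sumTo-single M t y (ℕₚ.≤∧≢⇒< (ℕₚ.≤-pred l) ne) (λ x x<M → v x (ℕₚ.m≤n⇒m≤1+n x<M))) (v M (ℕₚ.n<1+n M) (λ e → ne (sym e)))) (ℤₚ.+-identityʳ (t y))

  ∂-injective : ∀ F → (∀ y → ∂ F y ≡ + 0) → ∀ y → F y ≡ + 0
  ∂-injective F v zero    = trans (sym (ℤₚ.+-identityʳ (F 0))) (v 0)
  ∂-injective F v (suc y) = trans (sym (go (F (suc y)))) (trans (cong (λ t → F (suc y) - t) (sym (∂-injective F v y))) (v (suc y)))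
    where
    go : ∀ x → x - + 0 ≡ x
    go = solve-∀

  ∂^-injective : ∀ s F → (∀ y → ∂^ s F y ≡ + 0) → ∀ y → F y ≡ + 0
  ∂^-injective zero    F v = v
  ∂^-injective (suc s) F v = ∂^-injective s F (∂-injective (∂^ s F) v)

  module TwistD (φ : Fn 2) (N : ℕ) where

    ψ : ℕ → ℤ
    ψ y = sgn (N ∸ y) * φ (y ∷ N ∸ y ∷ [])

    -- The sign changes whenever `z` grows by one, so the sum of the two upper neighbours becomes a
    -- forward difference along the diagonal.
    twist-D : ∀ k y z → y ℕ.+ z ℕ.+ k ≡ N → sgn z * D^ k φ (y ∷ z ∷ []) ≡ Δ^ k ψ y
    twist-D zero y z eq = sym (cong (λ t → sgn t * φ (y ∷ t ∷ [])) (trans (cong (_∸ y) (trans (sym eq) (ℕₚ.+-identityʳ _))) (ℕₚ.m+n∸m≡n y z)))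
    twist-D (suc k) y z eq = trans (cong (sgn z *_) (D-suc k φ (y ∷ z ∷ [])))
      (trans (go (sgn z) (D^ k φ (suc y ∷ z ∷ [])) (D^ k φ (y ∷ suc z ∷ [])))
      (cong₂ _-_ (twist-D k (suc y) z (trans (sym (ℕₚ.+-suc (y ℕ.+ z) k)) eq))
        (twist-D k y (suc z) (trans (cong (ℕ._+ k) (ℕₚ.+-suc y z)) (trans (sym (ℕₚ.+-suc (y ℕ.+ z) k)) eq)))))
      where
      go : ∀ s a b → s * (a + (b + + 0)) ≡ s * a - (- s) * b
      go = solve-∀

  module TwistE (f : Fn 2) (j : ℕ) where

    F : ℕ → ℤ
    F y with y ℕ.≤? j
    ... | yes _ = sgn y * f (y ∷ j ∸ y ∷ [])
    ... | no  _ = + 0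

    F-high : ∀ y → suc j ≤ y → F y ≡ + 0
    F-high y l with y ℕ.≤? j
    ... | yes y≤j = contradiction (ℕₚ.≤-trans l y≤j) (ℕₚ.<-irrefl refl)
    ... | no  _   = refl

    F-at : ∀ y z → y ℕ.+ z ≡ j → F y ≡ sgn y * f (y ∷ z ∷ [])
    F-at y z eq with y ℕ.≤? j
    ... | yes _   = cong (λ t → sgn y * f (y ∷ t ∷ [])) (trans (cong (_∸ y) (sym eq)) (ℕₚ.m+n∸m≡n y z))
    ... | no  y≰j = contradiction (subst (y ≤_) eq (ℕₚ.m≤m+n y z)) y≰j

    twist-E : ∀ k y z → y ℕ.+ z ≡ j ℕ.+ k → sgn y * E^ k f (y ∷ z ∷ []) ≡ ∂^ k F y
    twist-E zero    y z eq = sym (F-at y z (trans eq (ℕₚ.+-identityʳ j)))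
    twist-E (suc k) y z eq = trans (distrib (sgn y) (prev (λ x → E^ k f (x ∷ z ∷ [])) y) (prev (λ x → E^ k f (y ∷ x ∷ [])) z))
      (cong₂ _+_ (second z eq) (first y eq))
      where
      distrib : ∀ s a b → s * (a + (b + + 0)) ≡ s * b + s * a
      distrib = solve-∀
      neg : ∀ s a → (- s) * a ≡ - (s * a)
      neg = solve-∀
      first : ∀ y → y ℕ.+ z ≡ j ℕ.+ suc k → sgn y * prev (λ x → E^ k f (x ∷ z ∷ [])) y ≡ - prev (∂^ k F) y
      first zero    eq = refl
      first (suc y) eq = trans (neg (sgn y) (E^ k f (y ∷ z ∷ []))) (cong -_ (twist-E k y z (ℕₚ.suc-injective (trans eq (ℕₚ.+-suc j k)))))
      second : ∀ z → y ℕ.+ z ≡ j ℕ.+ suc k → sgn y * prev (λ x → E^ k f (y ∷ x ∷ [])) z ≡ ∂^ k F y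
      -- The neighbour missing at z = 0 corresponds to a point beyond the support of ∂ᵏF.
      second zero    eq = trans (ℤₚ.*-zeroʳ (sgn y)) (sym (∂^-vanish-high k F (suc j) F-high y
        (ℕₚ.≤-reflexive (sym (trans (sym (ℕₚ.+-identityʳ y)) (trans eq (ℕₚ.+-suc j k)))))))
      second (suc z) eq = twist-E k y z (ℕₚ.suc-injective (trans (sym (ℕₚ.+-suc y z)) (trans eq (ℕₚ.+-suc j k))))

  module _ (gs : Gens 2) (s j : ℕ) where

    N : ℕ
    N = j ℕ.+ s

    nonstandard? : ∀ y → Dec (¬ Standard gs (y ∷ N ∸ y ∷ []))
    nonstandard? y = ¬? (standard? gs (y ∷ N ∸ y ∷ []))

    nonstandardPoints : List ℕ
    nonstandardPoints = filter nonstandard? (upTo (suc N))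

    private
      zs : List ℕ
      zs = nonstandardPoints

    many⇒dual : s ≤ length nonstandardPoints → DualInjective gs s j
    many⇒dual s≤ φ supp ker (y ∷ z ∷ []) with y ℕ.+ z ℕ.≟ N
    ... | no ne = supp (y ∷ z ∷ []) (λ p → ne (trans (cong (y ℕ.+_) (sym (ℕₚ.+-identityʳ z))) (proj₂ p)))
    ... | yes eq = sgn-cancel z (trans (twist-D 0 y z (trans (ℕₚ.+-identityʳ _) eq)) (ψ-zero (polOn-difference N s ψ differences) y (subst (y ≤_) eq (ℕₚ.m≤m+n y z))))
      where
      open TwistD φ N
      differences : ∀ y → y ℕ.+ s ≤ N → Δ^ s ψ y ≡ + 0
      differences y l = trans (sym (twist-D s y (j ∸ y) (cong (ℕ._+ s) (ℕₚ.m+[n∸m]≡n y≤j))))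
        (trans (cong (sgn (j ∸ y) *_) (D^-kills-all gs s j φ supp ker (y ∷ j ∸ y ∷ []) (trans (cong (y ℕ.+_) (ℕₚ.+-identityʳ (j ∸ y))) (ℕₚ.m+[n∸m]≡n y≤j)))) (ℤₚ.*-zeroʳ (sgn (j ∸ y))))
        where
        y≤j : y ≤ j
        y≤j = ℕₚ.+-cancelʳ-≤ s y j l
      ψ-zero : PolOn N s ψ → ∀ y → y ≤ N → ψ y ≡ + 0
      ψ-zero (d , P , p , eq) y y≤N = cancel {+ suc d} suc≢0 (trans (eq y y≤N) (pol-many-roots zs p (Uniqueₚ.filter⁺ nonstandard? (Uniqueₚ.upTo⁺ (suc N))) s≤ root (+ y)))
        where
        root : ∀ {z} → z ∈ zs → P (+ z) ≡ + 0
        root {z} z∈ with ∈-filter⁻ nonstandard? {xs = upTo (suc N)} z∈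
        ... | z∈up , ¬std = trans (sym (eq z (ℕₚ.≤-pred (∈-upTo⁻ z∈up))))
              (trans (cong (λ t → (+ suc d) * (sgn (N ∸ z) * t)) (supp _ (λ p → ¬std (proj₁ p)))) (trans (cong ((+ suc d) *_) (ℤₚ.*-zeroʳ (sgn (N ∸ z)))) (ℤₚ.*-zeroʳ (+ suc d))))

    -- To isolate one value of ∂ˢF, the test polynomial has as roots all nonstandard exponents other
    -- than `y`; the standard ones contribute nothing by `ker`. With fewer than `s` nonstandard
    -- exponents its degree stays below `s`, as orthogonality requires.
    few⇒primal : length nonstandardPoints < s → PrimalInjective gs s j
    few⇒primal few f supp ker (y ∷ z ∷ []) with y ℕ.+ z ℕ.≟ j
    ... | no ne = supp (y ∷ z ∷ []) (λ p → ne (trans (cong (y ℕ.+_) (sym (ℕₚ.+-identityʳ z))) (proj₂ p)))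
    ... | yes eq = sgn-cancel y (trans (sym (F-at y z eq)) (∂^-injective s F everywhere y))
      where
      open TwistE f j
      standard-zero : ∀ y → y ≤ N → Standard gs (y ∷ N ∸ y ∷ []) → ∂^ s F y ≡ + 0
      standard-zero y y≤N std = trans (sym (twist-E s y (N ∸ y) (ℕₚ.m+[n∸m]≡n y≤N)))
        (trans (cong (sgn y *_) (ker _ std (trans (cong (y ℕ.+_) (ℕₚ.+-identityʳ (N ∸ y))) (ℕₚ.m+[n∸m]≡n y≤N)))) (ℤₚ.*-zeroʳ (sgn y)))
      high : ∀ y → N < y → ∂^ s F y ≡ + 0
      high = ∂^-vanish-high s F (suc j) F-high
      module _ (y : ℕ) (y≤N : y ≤ N) where
        others : List ℕ
        others = filter (λ x → ¬? (y ℕ.≟ x)) zs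
        η : ℤ → ℤ
        η = rootProduct others
        rest : ∀ x → x < suc N → x ≢ y → ∂^ s F x * η (+ x) ≡ + 0
        rest x (s≤s x≤N) x≢y with standard? gs (x ∷ N ∸ x ∷ [])
        ... | yes std = trans (cong (_* η (+ x)) (standard-zero x x≤N std)) (ℤₚ.*-zeroˡ (η (+ x)))
        ... | no ¬std = trans (cong (∂^ s F x *_) (rootProduct-zero (∈-filter⁺ (λ x → ¬? (y ℕ.≟ x)) (∈-filter⁺ nonstandard? (∈-upTo⁺ (s≤s x≤N)) ¬std) (λ e → x≢y (sym e))))) (ℤₚ.*-zeroʳ (∂^ s F x))
        η≢0 : η (+ y) ≢ + 0
        η≢0 = rootProduct-≢0 (All.tabulate (λ x∈ → proj₂ (∈-filter⁻ (λ x → ¬? (y ℕ.≟ x)) {xs = zs} x∈)))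
        at-y : ∂^ s F y ≡ + 0
        at-y = cancel η≢0 (trans (ℤₚ.*-comm (η (+ y)) (∂^ s F y)) (trans (sym (sumTo-single (suc N) _ y (s≤s y≤N) rest))
          (orthogonality s F (suc j) (suc N) η (pol-≤ (ℕₚ.≤-trans (s≤s (Listₚ.length-filter (λ x → ¬? (y ℕ.≟ x)) zs)) few) (pol-rootProduct others)) F-high ℕₚ.≤-refl)))
      everywhere : ∀ y → ∂^ s F y ≡ + 0
      everywhere y with ℕₚ.<-≤-connex N y
      ... | inj₁ N<y = high y N<y
      ... | inj₂ y≤N = at-y y y≤N

    -- The standard monomials in degree j + s number j + s + 1 minus the counted points, so the case
    -- distinction compares dim A in degree j + s with j + 1, the dimension of k[x, y] in degree j.
    lefschetz₂ : PrimalInjective gs s j ⊎ DualInjective gs s j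
    lefschetz₂ with ℕₚ.<-≤-connex (length nonstandardPoints) s
    ... | inj₁ few  = inj₁ (few⇒primal few)
    ... | inj₂ many = inj₂ (many⇒dual many)

-- Monomial complete intersections: the sl₂ argument.

module CompleteIntersections where
  open import Data.Integer using (_+_; _*_; -_; _-_)
  open ℤSolver using (solve-∀)
  open ≡ using (refl; sym; trans; cong; cong₂; subst; module ≡-Reasoning)
  open IntegerOperators
  open FieldTransfer using (PrimalInjective; DualInjective)
  open FiniteDifferences using (cancel)
  open TwoVariables using (D-above)

  -- Consecutive weights differ by k - 2x, the eigenvalue of the semisimple element of sl₂ up to
  -- sign. Truncated subtraction makes the weight zero from x = k on, so that `Lo` sees nothing
  -- outside the box.
  weight : ℕ → ℕ → ℤ
  weight k x = + (suc x ℕ.* (k ∸ x))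

  -- The operator completing multiplication by x₁ + ⋯ + xᵣ to an sl₂-triple on the span of the divisors of x^m.
  Lo : ∀ {r} → Vec ℕ r → Fn r → Fn r
  Lo []      f []      = + 0
  Lo (k ∷ m) f (x ∷ b) = weight k x * f (suc x ∷ b) + Lo m (λ b′ → f (x ∷ b′)) b

  weight-zero : ∀ k x → ¬ (suc x ≤ k) → weight k x ≡ + 0
  weight-zero k x x≮k = trans (cong (λ t → + (suc x ℕ.* t)) (ℕₚ.m≤n⇒m∸n≡0 (ℕₚ.≮⇒≥ x≮k))) (cong +_ (ℕₚ.*-zeroʳ (suc x)))

  Lo-cong-on : ∀ {r} (m : Vec ℕ r) {f g} → (∀ b → b ∣ₘ m → f b ≡ g b) → ∀ b → b ∣ₘ m → Lo m f b ≡ Lo m g b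
  Lo-cong-on []      eq []      []        = refl
  Lo-cong-on (k ∷ m) {f} {g} eq (x ∷ b) (x≤k ∷ bm) = cong₂ _+_ head (Lo-cong-on m (λ b′ l → eq (x ∷ b′) (x≤k ∷ l)) b bm)
    where
    head : weight k x * f (suc x ∷ b) ≡ weight k x * g (suc x ∷ b)
    head with suc x ℕ.≤? k
    ... | yes x<k = cong (weight k x *_) (eq (suc x ∷ b) (x<k ∷ bm))
    ... | no  x≮k = trans (cong (_* f (suc x ∷ b)) (weight-zero k x x≮k)) (trans (ℤₚ.*-zeroˡ (f (suc x ∷ b)))
                      (sym (trans (cong (_* g (suc x ∷ b)) (weight-zero k x x≮k)) (ℤₚ.*-zeroˡ (g (suc x ∷ b))))))

  Lo-+ : ∀ {r} (m : Vec ℕ r) f g b → Lo m (λ b → f b + g b) b ≡ Lo m f b + Lo m g b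
  Lo-+ []      f g []      = refl
  Lo-+ (k ∷ m) f g (x ∷ b) = trans (+-right (weight k x * (f (suc x ∷ b) + g (suc x ∷ b))) (Lo-+ m (λ b′ → f (x ∷ b′)) (λ b′ → g (x ∷ b′)) b))
    (go (weight k x) (f (suc x ∷ b)) (g (suc x ∷ b)) _ _)
    where
    go : ∀ w a b c d → w * (a + b) + (c + d) ≡ w * a + c + (w * b + d)
    go = solve-∀

  Lo-zero : ∀ {r} (m : Vec ℕ r) b → Lo m (λ _ → + 0) b ≡ + 0
  Lo-zero []      []      = refl
  Lo-zero (k ∷ m) (x ∷ b) = cong₂ _+_ (ℤₚ.*-zeroʳ (weight k x)) (Lo-zero m b)

  Lo-homogeneous : ∀ {r} (m : Vec ℕ r) f b → (∀ b′ → b′ ∣ₘ m → deg b′ ≡ suc (deg b) → f b′ ≡ + 0) → b ∣ₘ m → Lo m f b ≡ + 0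
  Lo-homogeneous []      f []      v []         = refl
  Lo-homogeneous (k ∷ m) f (x ∷ b) v (x≤k ∷ bm) = cong₂ _+_ head
    (Lo-homogeneous m (λ b′ → f (x ∷ b′)) b (λ b′ l e → v (x ∷ b′) (x≤k ∷ l) (trans (cong (x ℕ.+_) e) (ℕₚ.+-suc x (deg b)))) bm)
    where
    head : weight k x * f (suc x ∷ b) ≡ + 0
    head with suc x ℕ.≤? k
    ... | yes x<k = trans (cong (weight k x *_) (v (suc x ∷ b) (x<k ∷ bm) refl)) (ℤₚ.*-zeroʳ (weight k x))
    ... | no  x≮k = trans (cong (_* f (suc x ∷ b)) (weight-zero k x x≮k)) (ℤₚ.*-zeroˡ (f (suc x ∷ b)))

  weight-step : ∀ k y → suc y ≤ k → weight k y + + k ≡ weight k (suc y) + + 2 * + suc y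
  weight-step k y l = subst (λ k → weight k y + + k ≡ weight k (suc y) + + 2 * + suc y) (ℕₚ.m+[n∸m]≡n l) (go (k ∸ suc y))
    where
    nat : ∀ y t → suc y ℕ.* suc t ℕ.+ (suc y ℕ.+ t) ≡ suc (suc y) ℕ.* t ℕ.+ 2 ℕ.* suc y
    nat = ℕSolver.solve-∀
    diff : ∀ y t → suc (y ℕ.+ t) ∸ y ≡ suc t
    diff zero    t = refl
    diff (suc y) t = diff y t
    go : ∀ t → weight (suc y ℕ.+ t) y + + (suc y ℕ.+ t) ≡ weight (suc y ℕ.+ t) (suc y) + + 2 * + suc y
    go t = trans (cong (λ n → + (suc y ℕ.* n) + + (suc y ℕ.+ t)) (diff y t)) (trans (cong +_ (nat y t))
      (trans (cong (λ n → + (suc (suc y) ℕ.* n ℕ.+ 2 ℕ.* suc y)) (sym (ℕₚ.m+n∸m≡n y t))) (+-right (weight (suc y ℕ.+ t) (suc y)) (ℤₚ.pos-* 2 (suc y)))))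

  -- Raising in one variable commutes with lowering in another, so only the difference of adjacent
  -- weights in each single variable survives. The two signs are kept on opposite sides of the
  -- equation.
  commutator : ∀ {r} (m : Vec ℕ r) f b → b ∣ₘ m →
    E (Lo m f) b + + deg m * f b ≡ Lo m (E f) b + + 2 * + deg b * f b
  commutator []      f []         []         = refl
  commutator (k ∷ m) f (zero ∷ b) (_ ∷ bm) = begin
      + 0 + E (λ b′ → W * f₁ b′ + Lo m f₀ b′) b + + (k ℕ.+ deg m) * f₀ b
        ≡⟨ cong₂ (λ t u → + 0 + t + u * f₀ b) (trans (E-+ (λ b′ → W * f₁ b′) (Lo m f₀) b) (cong (λ t → t + E (Lo m f₀) b) (E-scale W f₁ b))) (ℤₚ.pos-+ k (deg m)) ⟩
      + 0 + (W * E f₁ b + E (Lo m f₀) b) + (+ k + + deg m) * f₀ b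
        ≡⟨ arrange W (E f₁ b) (E (Lo m f₀) b) (+ k) (+ deg m) (f₀ b) ⟩
      W * E f₁ b + + k * f₀ b + (E (Lo m f₀) b + + deg m * f₀ b)
        ≡⟨ cong (λ t → W * E f₁ b + + k * f₀ b + t) (commutator m f₀ b bm) ⟩
      W * E f₁ b + + k * f₀ b + (Lo m (E f₀) b + + 2 * + deg b * f₀ b)
        ≡⟨ cong (λ w → W * E f₁ b + w * f₀ b + (Lo m (E f₀) b + + 2 * + deg b * f₀ b)) (cong +_ (sym (ℕₚ.*-identityˡ k))) ⟩
      W * E f₁ b + W * f₀ b + (Lo m (E f₀) b + + 2 * + deg b * f₀ b)
        ≡⟨ arrange′ W (E f₁ b) (f₀ b) (Lo m (E f₀) b) (+ 2 * + deg b * f₀ b) ⟩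
      W * (f₀ b + E f₁ b) + Lo m (E f₀) b + + 2 * + deg b * f₀ b
        ≡⟨ cong (λ t → W * (f₀ b + E f₁ b) + t + + 2 * + deg b * f₀ b) (Lo-cong-on m {f = E f₀} (λ b′ _ → sym (ℤₚ.+-identityˡ (E f₀ b′))) b bm) ⟩
      W * (f₀ b + E f₁ b) + Lo m (λ b′ → + 0 + E f₀ b′) b + + 2 * + deg b * f₀ b ∎
    where
    open ≡-Reasoning
    W : ℤ
    W = weight k 0
    f₀ f₁ : Fn _
    f₀ b = f (0 ∷ b)
    f₁ b = f (1 ∷ b)
    arrange : ∀ w e l k d x → + 0 + (w * e + l) + (k + d) * x ≡ w * e + k * x + (l + d * x)
    arrange = solve-∀
    arrange′ : ∀ w e x l u → w * e + w * x + (l + u) ≡ w * (x + e) + l + u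
    arrange′ = solve-∀
  commutator (k ∷ m) f (suc y ∷ b) (y<k ∷ bm) = begin
      V * f₁ b + Lo m f₀ b + E (λ b′ → W * f₂ b′ + Lo m f₁ b′) b + + (k ℕ.+ deg m) * f₁ b
        ≡⟨ cong₂ (λ t u → V * f₁ b + Lo m f₀ b + t + u * f₁ b) (trans (E-+ (λ b′ → W * f₂ b′) (Lo m f₁) b) (cong (λ t → t + E (Lo m f₁) b) (E-scale W f₂ b))) (ℤₚ.pos-+ k (deg m)) ⟩
      V * f₁ b + Lo m f₀ b + (W * E f₂ b + E (Lo m f₁) b) + (+ k + + deg m) * f₁ b
        ≡⟨ arrange V (f₁ b) (Lo m f₀ b) (W * E f₂ b) (E (Lo m f₁) b) (+ k) (+ deg m) ⟩
      (V + + k) * f₁ b + Lo m f₀ b + W * E f₂ b + (E (Lo m f₁) b + + deg m * f₁ b)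
        ≡⟨ cong₂ (λ v t → v * f₁ b + Lo m f₀ b + W * E f₂ b + t) (weight-step k y y<k) (commutator m f₁ b bm) ⟩
      (W + + 2 * + suc y) * f₁ b + Lo m f₀ b + W * E f₂ b + (Lo m (E f₁) b + + 2 * + deg b * f₁ b)
        ≡⟨ arrange′ W (+ suc y) (f₁ b) (Lo m f₀ b) (E f₂ b) (Lo m (E f₁) b) (+ deg b) ⟩
      W * (f₁ b + E f₂ b) + (Lo m f₀ b + Lo m (E f₁) b) + + 2 * (+ suc y + + deg b) * f₁ b
        ≡⟨ cong₂ (λ t u → W * (f₁ b + E f₂ b) + t + + 2 * u * f₁ b) (sym (Lo-+ m f₀ (E f₁) b)) (sym (ℤₚ.pos-+ (suc y) (deg b))) ⟩
      W * (f₁ b + E f₂ b) + Lo m (λ b′ → f₀ b′ + E f₁ b′) b + + 2 * + (suc y ℕ.+ deg b) * f₁ b ∎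
    where
    open ≡-Reasoning
    V W : ℤ
    V = weight k y
    W = weight k (suc y)
    f₀ f₁ f₂ : Fn _
    f₀ b = f (y ∷ b)
    f₁ b = f (suc y ∷ b)
    f₂ b = f (suc (suc y) ∷ b)
    arrange : ∀ v x l we e k d → v * x + l + (we + e) + (k + d) * x ≡ (v + k) * x + l + we + (e + d * x)
    arrange = solve-∀
    arrange′ : ∀ w y x l e l′ d → (w + + 2 * y) * x + l + w * e + (l′ + + 2 * d * x) ≡ w * (x + e) + (l + l′) + + 2 * (y + d) * x
    arrange′ = solve-∀

  module Box {r} (m : Vec ℕ r) where

    e : ℕ
    e = deg m

    box-closed : DownClosed (_∣ₘ m)
    box-closed = ∣ₘ-trans

    Graded : ℕ → Fn r → Set
    Graded j v = ∀ b → b ∣ₘ m → deg b ≢ j → v b ≡ + 0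

    E-graded : ∀ j v → Graded j v → Graded (suc j) (E v)
    E-graded j v gr b bm ne = go v b bm (λ b′ l e → gr b′ l (λ e′ → ne (trans (sym e) (cong suc e′))))
      where
      go : ∀ {r} {m : Vec ℕ r} (v : Fn r) b → b ∣ₘ m → (∀ b′ → b′ ∣ₘ m → suc (deg b′) ≡ deg b → v b′ ≡ + 0) → E v b ≡ + 0
      go v []          []         z = refl
      go v (zero ∷ b)  (l ∷ bm)   z = trans (ℤₚ.+-identityˡ _) (go (λ b′ → v (zero ∷ b′)) b bm (λ b′ l′ → z (zero ∷ b′) (l ∷ l′)))
      go v (suc x ∷ b) (l ∷ bm)   z = cong₂ _+_ (z (x ∷ b) (ℕₚ.<⇒≤ l ∷ bm) refl)
        (go (λ b′ → v (suc x ∷ b′)) b bm (λ b′ l′ e → z (suc x ∷ b′) (l ∷ l′) (trans (sym (ℕₚ.+-suc (suc x) (deg b′))) (cong (suc x ℕ.+_) e))))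

    E^-graded : ∀ s j v → Graded j v → Graded (s ℕ.+ j) (E^ s v)
    E^-graded zero    j v gr = gr
    E^-graded (suc s) j v gr = E-graded (s ℕ.+ j) (E^ s v) (E^-graded s j v gr)

    Lo-graded : ∀ j v → Graded (suc j) v → Graded j (Lo m v)
    Lo-graded j v gr b bm ne = Lo-homogeneous m v b (λ b′ l e → gr b′ l (λ e′ → ne (ℕₚ.suc-injective (trans (sym e) e′)))) bm

    graded-commutator : ∀ j v → Graded j v → ∀ b → b ∣ₘ m → Lo m (E v) b ≡ E (Lo m v) b + (+ e - + 2 * + j) * v b
    graded-commutator j v gr b bm = trans (go (Lo m (E v) b) (+ 2 * + deg b * v b))
      (trans (cong₂ (λ t u → t - u) (sym (commutator m v b bm)) weight-of-b) (go′ (E (Lo m v) b) (+ e) (+ j) (v b)))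
      where
      go : ∀ x y → x ≡ x + y - y
      go = solve-∀
      go′ : ∀ x e j v → x + e * v - + 2 * j * v ≡ x + (e - + 2 * j) * v
      go′ = solve-∀
      weight-of-b : + 2 * + deg b * v b ≡ + 2 * + j * v b
      weight-of-b with deg b ℕ.≟ j
      ... | yes refl = refl
      ... | no ne = trans (cong (+ 2 * + deg b *_) (gr b bm ne)) (trans (ℤₚ.*-zeroʳ (+ 2 * + deg b)) (sym (trans (cong (+ 2 * + j *_) (gr b bm ne)) (ℤₚ.*-zeroʳ (+ 2 * + j)))))

    -- The single commutators in degrees j, ..., j + s have coefficients e - 2j, e - 2j - 2, ...;
    -- the coefficient here is the sum of this arithmetic progression.
    power-commutator : ∀ s j v → Graded j v → ∀ b → b ∣ₘ m →
      Lo m (E^ (suc s) v) b ≡ E^ (suc s) (Lo m v) b + (+ suc s) * (+ e - + 2 * + j - + s) * E^ s v b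
    power-commutator zero j v gr b bm = trans (graded-commutator j v gr b bm) (+-right (E (Lo m v) b) (cong (_* v b) (go (+ e - + 2 * + j))))
      where
      go : ∀ c → c ≡ + 1 * (c - + 0)
      go = solve-∀
    power-commutator (suc s) j v gr b bm = begin
      Lo m (E (E^ (suc s) v)) b
        ≡⟨ graded-commutator (suc s ℕ.+ j) (E^ (suc s) v) (E^-graded (suc s) j v gr) b bm ⟩
      E (Lo m (E^ (suc s) v)) b + (+ e - + 2 * + (suc s ℕ.+ j)) * X
        ≡⟨ cong (λ t → t + (+ e - + 2 * + (suc s ℕ.+ j)) * X) (E-cong-on box-closed (power-commutator s j v gr) b bm) ⟩
      E (λ b → E^ (suc s) (Lo m v) b + C * E^ s v b) b + (+ e - + 2 * + (suc s ℕ.+ j)) * X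
        ≡⟨ cong₂ (λ t u → t + (+ e - + 2 * u) * X) (trans (E-+ (E^ (suc s) (Lo m v)) (λ b → C * E^ s v b) b) (+-right Y (E-scale C (E^ s v) b))) (ℤₚ.pos-+ (suc s) j) ⟩
      Y + C * X + (+ e - + 2 * (+ suc s + + j)) * X
        ≡⟨ arrange Y X (+ e) (+ j) (+ s) ⟩
      Y + (+ suc (suc s)) * (+ e - + 2 * + j - + suc s) * X ∎
      where
      open ≡-Reasoning
      X Y C : ℤ
      X = E^ (suc s) v b
      Y = E^ (suc (suc s)) (Lo m v) b
      C = (+ suc s) * (+ e - + 2 * + j - + s)
      arrange : ∀ y x e j s → y + (+ 1 + s) * (e - + 2 * j - s) * x + (e - + 2 * (+ 1 + s + j)) * x ≡ y + (+ 2 + s) * (e - + 2 * j - (+ 1 + s)) * x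
      arrange = solve-∀

    coefficient≢0 : ∀ s j → 2 ℕ.* j ℕ.+ suc s ≤ e → (+ suc s) * (+ e - + 2 * + j - + s) ≢ + 0
    coefficient≢0 s j l eq with ℤₚ.i*j≡0⇒i≡0∨j≡0 (+ suc s) eq
    ... | inj₂ z = ℕₚ.<-irrefl (sym (ℤₚ.+-injective (trans (go (+ e) (+ j) (+ s)) (trans (cong (λ t → + 2 * + j + + s + t) z) (trans (ℤₚ.+-identityʳ (+ 2 * + j + + s)) (cong (λ t → t + + s) (sym (ℤₚ.pos-* 2 j)))))))) 
                          (subst (_≤ e) (ℕₚ.+-suc (2 ℕ.* j) s) l)
      where
      go : ∀ e j s → e ≡ + 2 * j + s + (e - + 2 * j - s)
      go = solve-∀

    -- If E^(s+1) kills `v`, then E^(s+2) kills `Lo m v`, which is therefore zero by the case of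
    -- degree j - 1; the power commutator then says that a nonzero multiple of E^s v vanishes. The
    -- recursion shared with `Lo-vanishes` is lexicographic: either `s` falls at fixed `j`, or `j`
    -- falls while `s` grows.
    lefschetz-injective : ∀ j s v → Graded j v → 2 ℕ.* j ℕ.+ s ≤ e → (∀ b → b ∣ₘ m → E^ s v b ≡ + 0) → ∀ b → b ∣ₘ m → v b ≡ + 0
    Lo-vanishes : ∀ j s v → Graded j v → 2 ℕ.* j ℕ.+ suc s ≤ e → (∀ b → b ∣ₘ m → E^ (suc s) v b ≡ + 0) → ∀ b → b ∣ₘ m → Lo m v b ≡ + 0

    lefschetz-injective j zero    v gr l ker = ker
    lefschetz-injective j (suc s) v gr l ker = lefschetz-injective j s v gr (ℕₚ.≤-trans (ℕₚ.+-monoʳ-≤ (2 ℕ.* j) (ℕₚ.n≤1+n s)) l) (λ b bm →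
      cancel (coefficient≢0 s j l) (trans (sym (ℤₚ.+-identityˡ _)) (trans (cong (λ t → t + (+ suc s) * (+ e - + 2 * + j - + s) * E^ s v b) (sym
        (trans (E^-cong-on box-closed (suc s) (Lo-vanishes j s v gr l ker) b bm) (E^-zero (suc s) b))))
        (trans (sym (power-commutator s j v gr b bm)) (trans (Lo-cong-on m ker b bm) (Lo-zero m b))))))

    Lo-vanishes zero    s v gr l ker b bm = Lo-homogeneous m v b (λ b′ l e → gr b′ l (λ e′ → ℕₚ.1+n≢0 (trans (sym e) e′))) bm
    Lo-vanishes (suc j) s v gr l ker = lefschetz-injective j (suc (suc s)) (Lo m v) (Lo-graded j v gr)
      (ℕₚ.≤-trans (ℕₚ.≤-reflexive (nat j s)) (ℕₚ.≤-trans (ℕₚ.n≤1+n _) (subst (_≤ e) (nat′ j s) l))) (λ b bm →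
      trans (E-cong-on box-closed {g = λ b → - C * E^ s v b} (λ b bm → isolate (E^ (suc s) (Lo m v) b) C (E^ s v b)
          (trans (sym (power-commutator s (suc j) v gr b bm)) (trans (Lo-cong-on m ker b bm) (Lo-zero m b)))) b bm)
        (trans (E-scale (- C) (E^ s v) b) (trans (cong (- C *_) (ker b bm)) (ℤₚ.*-zeroʳ (- C)))))
      where
      C : ℤ
      C = (+ suc s) * (+ e - + 2 * + suc j - + s)
      nat : ∀ j s → 2 ℕ.* j ℕ.+ suc (suc s) ≡ 2 ℕ.* j ℕ.+ s ℕ.+ 2
      nat = ℕSolver.solve-∀
      nat′ : ∀ j s → 2 ℕ.* suc j ℕ.+ suc s ≡ suc (2 ℕ.* j ℕ.+ s ℕ.+ 2)
      nat′ = ℕSolver.solve-∀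
      isolate : ∀ x c y → x + c * y ≡ + 0 → x ≡ - c * y
      isolate x c y eq = trans (go x c y) (trans (cong (λ t → t + - c * y) eq) (ℤₚ.+-identityˡ (- c * y)))
        where
        go : ∀ x c y → x ≡ x + c * y + - c * y
        go = solve-∀

  _⊝_ : ∀ {r} → Vec ℕ r → Vec ℕ r → Vec ℕ r
  []      ⊝ []      = []
  (k ∷ m) ⊝ (x ∷ b) = k ∸ x ∷ m ⊝ b

  ⊝-divides : ∀ {r} (m b : Vec ℕ r) → (m ⊝ b) ∣ₘ m
  ⊝-divides []      []      = []
  ⊝-divides (k ∷ m) (x ∷ b) = ℕₚ.m∸n≤m k x ∷ ⊝-divides m b

  ⊝-involutive : ∀ {r} (m b : Vec ℕ r) → b ∣ₘ m → m ⊝ (m ⊝ b) ≡ b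
  ⊝-involutive []      []      []       = refl
  ⊝-involutive (k ∷ m) (x ∷ b) (l ∷ bm) = cong₂ _∷_ (ℕₚ.m∸[m∸n]≡n l) (⊝-involutive m b bm)

  deg-⊝ : ∀ {r} (m b : Vec ℕ r) → b ∣ₘ m → deg b ℕ.+ deg (m ⊝ b) ≡ deg m
  deg-⊝ []      []      []       = refl
  deg-⊝ (k ∷ m) (x ∷ b) (l ∷ bm) = trans (nat x (deg b) (k ∸ x) (deg (m ⊝ b))) (cong₂ ℕ._+_ (ℕₚ.m+[n∸m]≡n l) (deg-⊝ m b bm))
    where
    nat : ∀ a b c d → a ℕ.+ b ℕ.+ (c ℕ.+ d) ≡ a ℕ.+ c ℕ.+ (b ℕ.+ d)
    nat = ℕSolver.solve-∀

  -- Poincaré duality of the box: complementation in `m` reverses divisibility. The condition on the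
  -- support disposes of the neighbours that `D` reads outside the box.
  flip-E : ∀ {r} (m : Vec ℕ r) φ → (∀ b → ¬ (b ∣ₘ m) → φ b ≡ + 0) → ∀ b → b ∣ₘ m → E (λ b → φ (m ⊝ b)) b ≡ D φ (m ⊝ b)
  flip-E []      φ supp []          []       = refl
  flip-E (k ∷ m) φ supp (zero ∷ b)  (l ∷ bm) = cong₂ _+_ (sym (supp (suc k ∷ m ⊝ b) (λ { (l ∷ _) → ℕₚ.<-irrefl refl l })))
    (flip-E m (λ b′ → φ (k ∷ b′)) (λ b′ ¬d → supp (k ∷ b′) (λ { (_ ∷ d) → ¬d d })) b bm)
  flip-E (k ∷ m) φ supp (suc x ∷ b) (l ∷ bm) = cong₂ _+_ (cong (λ t → φ (t ∷ m ⊝ b)) (ℕₚ.+-∸-assoc 1 l))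
    (flip-E m (λ b′ → φ (k ∸ suc x ∷ b′)) (λ b′ ¬d → supp (k ∸ suc x ∷ b′) (λ { (_ ∷ d) → ¬d d })) b bm)

  flip-E^ : ∀ {r} s (m : Vec ℕ r) φ → (∀ b → ¬ (b ∣ₘ m) → φ b ≡ + 0) → ∀ b → b ∣ₘ m → E^ s (λ b → φ (m ⊝ b)) b ≡ D^ s φ (m ⊝ b)
  flip-E^ zero    m φ supp b bm = refl
  flip-E^ (suc s) m φ supp b bm = trans (E-suc s (λ b → φ (m ⊝ b)) b) (trans (E^-cong-on {P = _∣ₘ m} ∣ₘ-trans s (flip-E m φ supp) b bm)
    (flip-E^ s m (D φ) (λ b ¬d → D-above φ b (λ c bc → supp c (λ d → ¬d (∣ₘ-trans bc d)))) b bm))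

  D-homogeneous : ∀ {r} (f : Fn r) b → (∀ b′ → deg b′ ≡ suc (deg b) → f b′ ≡ + 0) → D f b ≡ + 0
  D-homogeneous f []      v = refl
  D-homogeneous f (x ∷ b) v = cong₂ _+_ (v (suc x ∷ b) refl)
    (D-homogeneous (λ b′ → f (x ∷ b′)) b (λ b′ e → v (x ∷ b′) (trans (cong (x ℕ.+_) e) (ℕₚ.+-suc x (deg b)))))

  D^-homogeneous : ∀ {r} s (f : Fn r) j → (∀ b → deg b ≢ j ℕ.+ s → f b ≡ + 0) → ∀ b → deg b ≢ j → D^ s f b ≡ + 0
  D^-homogeneous zero    f j v b ne = v b (λ e → ne (trans e (ℕₚ.+-identityʳ j)))
  D^-homogeneous (suc s) f j v b ne = D^-homogeneous s (D f) j (λ b ne → D-homogeneous f b (λ b′ e → v b′ (λ e′ →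
    ne (ℕₚ.suc-injective (trans (sym e) (trans e′ (ℕₚ.+-suc j s))))))) b ne

  deg-mono : ∀ {r} {a b : Vec ℕ r} → a ∣ₘ b → deg a ≤ deg b
  deg-mono []       = z≤n
  deg-mono (l ∷ ls) = ℕₚ.+-mono-≤ l (deg-mono ls)

  module _ {r} (gs : Gens r) (m : Vec ℕ r) (to : ∀ b → Standard gs b → b ∣ₘ m) (from : ∀ b → b ∣ₘ m → Standard gs b) where
    open Box m

    lefschetz-box : ∀ s j → PrimalInjective gs s j ⊎ DualInjective gs s j
    lefschetz-box s j with ℕₚ.≤-total (2 ℕ.* j ℕ.+ s) e
    ... | inj₁ l = inj₁ primal
      where
      primal : PrimalInjective gs s j
      primal f supp ker b with PW.decidable ℕ._≤?_ b m
      ... | no ¬bm = supp b (λ p → ¬bm (to b (proj₁ p)))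
      ... | yes bm = lefschetz-injective j s f (λ b _ ne → supp b (λ p → ne (proj₂ p))) l vanish b bm
        where
        vanish : ∀ b → b ∣ₘ m → E^ s f b ≡ + 0
        vanish b bm with deg b ℕ.≟ j ℕ.+ s
        ... | yes eq = ker b (from b bm) eq
        ... | no ne = E^-graded s j f (λ b _ ne → supp b (λ p → ne (proj₂ p))) b bm (λ eq → ne (trans eq (ℕₚ.+-comm s j)))
    ... | inj₂ l = inj₂ dual
      where
      dual : DualInjective gs s j
      dual φ supp ker b with PW.decidable ℕ._≤?_ b m | deg b ℕ.≟ j ℕ.+ s
      ... | no ¬bm | _     = supp b (λ p → ¬bm (to b (proj₁ p)))
      ... | yes bm | no ne = supp b (λ p → ne (proj₂ p))
      ... | yes bm | yes eq = trans (cong φ (sym (⊝-involutive m b bm)))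
          (lefschetz-injective i s (λ b → φ (m ⊝ b)) graded bound vanish (m ⊝ b) (⊝-divides m b))
        where
        -- The complementary degree e - (j + s). Adding the inequality for `j` shows that 2i + s is
        -- at most e, so injectivity applies to the reflected functional.
        i : ℕ
        i = deg (m ⊝ b)
        i+N : j ℕ.+ s ℕ.+ i ≡ e
        i+N = trans (cong (ℕ._+ i) (sym eq)) (deg-⊝ m b bm)
        graded : Graded i (λ b → φ (m ⊝ b))
        graded c cm ne = supp (m ⊝ c) (λ p → ne (ℕₚ.+-cancelˡ-≡ (j ℕ.+ s) (deg c) i (trans (trans (ℕₚ.+-comm (j ℕ.+ s) (deg c)) (trans (cong (deg c ℕ.+_) (sym (proj₂ p))) (deg-⊝ m c cm))) (sym i+N))))
        nat : ∀ i j s → 2 ℕ.* i ℕ.+ s ℕ.+ (2 ℕ.* j ℕ.+ s) ≡ (j ℕ.+ s ℕ.+ i) ℕ.+ (j ℕ.+ s ℕ.+ i)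
        nat = ℕSolver.solve-∀
        bound : 2 ℕ.* i ℕ.+ s ≤ e
        bound = ℕₚ.+-cancelʳ-≤ e (2 ℕ.* i ℕ.+ s) e (ℕₚ.≤-trans (ℕₚ.+-monoʳ-≤ (2 ℕ.* i ℕ.+ s) l) (ℕₚ.≤-reflexive (trans (nat i j s) (cong₂ ℕ._+_ i+N i+N))))
        vanish : ∀ c → c ∣ₘ m → E^ s (λ b → φ (m ⊝ b)) c ≡ + 0
        vanish c cm = trans (flip-E^ s m φ (λ b ¬d → supp b (λ p → ¬d (to b (proj₁ p)))) c cm) final
          where
          final : D^ s φ (m ⊝ c) ≡ + 0
          final with deg (m ⊝ c) ℕ.≟ j
          ... | yes eq = ker (m ⊝ c) (from (m ⊝ c) (⊝-divides m c)) eq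
          ... | no ne = D^-homogeneous s φ j (λ b ne → supp b (λ p → ne (proj₂ p))) (m ⊝ c) ne

-- The one-variable problems behind the two kernels for two boxes.

module GapProblems where
  open import Data.Nat using (_+_)
  open import Data.Integer using (-_)
  open ℕSolver using (solve-∀)
  open ≡ using (refl; sym; trans; cong; cong₂; subst)
  open FiniteDifferences

  -- Linear arithmetic certificates: L ≤ R is a sum of hypotheses, k the slack.
  linear : ∀ {L R} s t k → L ≤ R → s + R + k ≡ t + L → s ≤ t
  linear {L} {R} s t k l eq = ℕₚ.+-cancelʳ-≤ R s t (ℕₚ.≤-trans (ℕₚ.m≤m+n (s + R) k) (ℕₚ.≤-trans (ℕₚ.≤-reflexive eq) (ℕₚ.+-monoʳ-≤ t l)))

  infixr 5 _⊕_
  _⊕_ : ∀ {a b c d} → a ≤ b → c ≤ d → a + c ≤ b + d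
  _⊕_ = ℕₚ.+-mono-≤

  ≡⇒≥ : ∀ {a b : ℕ} → a ≡ b → b ≤ a
  ≡⇒≥ e = ℕₚ.≤-reflexive (sym e)

  ≡⇒≤ : ∀ {a b : ℕ} → a ≡ b → a ≤ b
  ≡⇒≤ = ℕₚ.≤-reflexive

  -- On M + 1 points every function is interpolated in degree at most `M`, so the bound can always
  -- be lowered to that; no point is left for the difference condition in this case.
  min-polOn : ∀ M q f → (∀ y → y + q ≤ M → Δ^ q f y ≡ + 0) → PolOn M (q ⊓ suc M) f
  min-polOn M q f v with ℕₚ.≤-total q (suc M)
  ... | inj₁ l rewrite ℕₚ.m≤n⇒m⊓n≡m l = polOn-difference M q f v
  ... | inj₂ l rewrite ℕₚ.m≥n⇒m⊓n≡n l = polOn-difference M (suc M) f (λ y l′ → contradiction (ℕₚ.≤-trans (ℕₚ.m≤n+m (suc M) y) l′) (ℕₚ.<-irrefl refl))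

  split-≤ : ∀ {m n} → m ≤ n → ∃ λ k → n ≡ m + k
  split-≤ {m} {n} l = n ∸ m , sym (ℕₚ.m+[n∸m]≡n l)

  <∸⇒+< : ∀ i a b → i < a ∸ b → i + b < a
  <∸⇒+< i a       zero    l = subst (_< a) (sym (ℕₚ.+-identityʳ i)) l
  <∸⇒+< i (suc a) (suc b) l = subst (_< suc a) (sym (ℕₚ.+-suc i b)) (s≤s (<∸⇒+< i a b l))

  ∸-balance : ∀ n c → n + (c ∸ n) ≡ c + (n ∸ c)
  ∸-balance zero    c       = sym (trans (cong (λ t → c + t) (ℕₚ.0∸n≡0 c)) (ℕₚ.+-identityʳ c))
  ∸-balance (suc n) zero    = ℕₚ.+-identityʳ (suc n)
  ∸-balance (suc n) (suc c) = cong suc (∸-balance n c)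

  scaled-zero : ∀ d {x} → x ≡ + 0 → (+ suc d) ℤ.* x ≡ + 0
  scaled-zero d refl = ℤₚ.*-zeroʳ (+ suc d)

  -- Surjectivity for two boxes in three variables: there are more vanishing conditions on χ than its degree q
  -- allows, provided the zeros that orthogonality forces between the two runs of zeros of ψ are counted.
  module DualGap (p q n b c B C : ℕ) (ψ : ℕ → ℤ)
    (high  : ∀ y → p + n < y → ψ y ≡ + 0)
    (left  : ∀ y → y + C < p + n → ψ y ≡ + 0)
    (right : ∀ y → B < y → ψ y ≡ + 0)
    (χ-left  : ∀ y → y ≤ n → y + c < n → Δ^ p ψ y ≡ + 0)
    (χ-right : ∀ y → y ≤ n → b < y → Δ^ p ψ y ≡ + 0)
    (χ-poly  : ∀ y → y + q ≤ n → Δ^ q (Δ^ p ψ) y ≡ + 0) where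

    χ : ℕ → ℤ
    χ = Δ^ p ψ

    -- `χ` has `u` forced zeros at the left end of [0, n] and `v` at the right end. `U` and `V`
    -- bound how far the support of ∂ᵖψ reaches beyond [p, p + n] on either side.
    u v U V κ₀ : ℕ
    u = n ∸ c
    v = n ∸ b
    U = C ∸ n
    V = B ∸ n
    κ₀ = q ⊓ suc n

    below : ∀ i → i < u → i ≤ n → χ i ≡ + 0
    below i i<u i≤n = χ-left i i≤n (<∸⇒+< i n c i<u)

    above : ∀ i i′ → i + i′ ≡ n → i < v → χ i′ ≡ + 0
    above i i′ e i<v = χ-right i′ (ℕₚ.m+n≤o⇒n≤o i (≡⇒≤ e)) (arith i i′ n b (<∸⇒+< i n b i<v) e)
      where
      arith : ∀ i i′ n b → i + b < n → i + i′ ≡ n → b < i′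
      arith i i′ n b l e = linear (suc b) i′ 0 (l ⊕ ≡⇒≥ e) (go i i′ n b)
        where
        go : ∀ i i′ n b → suc b + (n + (i + i′)) + 0 ≡ i′ + (suc (i + b) + n)
        go = solve-∀

    χ-zero-easy : κ₀ ≤ u + v → ∀ y → y ≤ n → χ y ≡ + 0
    χ-zero-easy l = polOn-vanish n u v κ₀ χ (min-polOn n q χ χ-poly) (ℕₚ.m⊓n≤n q (suc n)) l below above

    edge-left : ∀ y → y < p → ∂^ p ψ y ≡ + 0 ⊎ p ≤ y + U
    edge-left y y<p with suc (y + C) ℕ.≤? p + n
    ... | yes l = inj₁ (∂^-vanish-low p ψ (suc y) (λ y′ l′ → left y′ (ℕₚ.≤-trans (s≤s (ℕₚ.+-monoˡ-≤ C (ℕₚ.≤-pred l′))) l)) y (ℕₚ.n<1+n y))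
    ... | no ¬l = inj₂ (arith p n y C U (ℕₚ.≮⇒≥ ¬l) (ℕₚ.m≤n+m∸n C n))
      where
      arith : ∀ p n y C U → p + n ≤ y + C → C ≤ n + U → p ≤ y + U
      arith p n y C U h h′ = linear p (y + U) 0 (h ⊕ h′) (go p n y C U)
        where
        go : ∀ p n y C U → p + (y + C + (n + U)) + 0 ≡ y + U + (p + n + C)
        go = solve-∀

    edge-right : ∀ y → p + n < y → ∂^ p ψ y ≡ + 0 ⊎ y ≤ p + n + V
    edge-right y _ with suc (B + p) ℕ.≤? y
    ... | yes l = inj₁ (∂^-vanish-high p ψ (suc B) right y l)
    ... | no ¬l = inj₂ (arith p n y B V (ℕₚ.≮⇒≥ ¬l) (ℕₚ.m≤n+m∸n B n))
      where
      arith : ∀ p n y B V → y ≤ B + p → B ≤ n + V → y ≤ p + n + V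
      arith p n y B V h h′ = linear y (p + n + V) 0 (h ⊕ h′) (go p n y B V)
        where
        go : ∀ p n y B V → y + (B + p + (n + V)) + 0 ≡ p + n + V + (y + B)
        go = solve-∀

    -- Dividing out the forced zeros leaves a factor θ of degree below `κ`. The test polynomial
    -- needs `U + V` roots to silence the overhang, besides θ itself; the second inequality is what
    -- keeps its degree below `p`.
    χ-zero-gap : u + v ≤ κ₀ → κ₀ + (U + V) ≤ p + (u + v) → ∀ y → y ≤ n → χ y ≡ + 0
    χ-zero-gap l₀ l y y≤n = use (min-polOn n q χ χ-poly)
      where
      κ : ℕ
      κ = κ₀ ∸ (u + v)
      κ-eq : u + v + κ ≡ κ₀
      κ-eq = ℕₚ.m+[n∸m]≡n l₀
      bound : ∀ U V κ p u v κ₀ → κ₀ + (U + V) ≤ p + (u + v) → u + v + κ ≡ κ₀ → U + (V + κ) ≤ p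
      bound U V κ p u v κ₀ h e = linear (U + (V + κ)) p 0 (h ⊕ ≡⇒≤ e) (go U V κ p u v κ₀)
        where
        go : ∀ U V κ p u v κ₀ → U + (V + κ) + (p + (u + v) + κ₀) + 0 ≡ p + (κ₀ + (U + V) + (u + v + κ))
        go = solve-∀
      use : PolOn n κ₀ χ → χ y ≡ + 0
      use (d , P , pol , eq) = conclude (divide-both n u v κ P (subst (λ k → Pol k P) (trans (sym κ-eq) (ℕₚ.+-assoc u v κ)) pol)
          (ℕₚ.≤-trans l₀ (ℕₚ.m⊓n≤n q (suc n)))
          (λ i i<u → trans (sym (eq i (ℕₚ.≤-trans (ℕₚ.<⇒≤ i<u) (ℕₚ.m∸n≤m n c)))) (scaled-zero d (below i i<u (ℕₚ.≤-trans (ℕₚ.<⇒≤ i<u) (ℕₚ.m∸n≤m n c)))))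
          (λ i i′ e i<v → trans (sym (eq i′ (ℕₚ.m+n≤o⇒n≤o i (≡⇒≤ e)))) (scaled-zero d (above i i′ e i<v))))
        where
        conclude : (Σ (ℤ → ℤ) λ θ → Pol κ θ × (∀ y → P y ≡ ff u y ℤ.* ff v (+ n ℤ.- y) ℤ.* θ y)) → χ y ≡ + 0
        conclude (θ , polθ , fac) = cancel {+ suc d} suc≢0 (trans (factored y y≤n)
            (gap-lemma p (p + n) ψ U V κ θ′ w d high edge-left edge-right (pol-affine (- (+ p)) (+ 1) polθ)
              (bound U V κ p u v κ₀ l κ-eq) (λ Y _ _ → nonNeg-* (ff-nonNeg u (Y ∸ p)) (ff-nonNeg v (n ∸ (Y ∸ p)))) at-Y (p + y) (ℕₚ.m≤m+n p y) (ℕₚ.+-monoʳ-≤ p y≤n)))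
          where
          w : ℕ → ℤ
          w Y = ff u (+ (Y ∸ p)) ℤ.* ff v (+ (n ∸ (Y ∸ p)))
          θ′ : ℤ → ℤ
          θ′ Y = θ (- (+ p) ℤ.+ + 1 ℤ.* Y)
          shift : ∀ p y → y ≡ - p ℤ.+ + 1 ℤ.* (p ℤ.+ y)
          shift = ℤSolver.solve-∀
          factored : ∀ y → y ≤ n → (+ suc d) ℤ.* χ y ≡ w (p + y) ℤ.* θ′ (+ (p + y))
          factored y y≤n = trans (eq y y≤n) (trans (fac (+ y)) (cong₂ ℤ._*_
            (cong₂ ℤ._*_ (cong (λ t → ff u (+ t)) (sym (ℕₚ.m+n∸m≡n p y))) (cong (ff v) (trans (minus y≤n) (cong (λ t → + (n ∸ t)) (sym (ℕₚ.m+n∸m≡n p y))))))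
            (cong θ (trans (shift (+ p) (+ y)) (cong (λ t → - (+ p) ℤ.+ + 1 ℤ.* t) (sym (ℤₚ.pos-+ p y)))))))
          at-Y : ∀ Y → p ≤ Y → Y ≤ p + n → (+ suc d) ℤ.* ∂^ p ψ Y ≡ w Y ℤ.* θ′ (+ Y)
          at-Y Y p≤Y Y≤ with split-≤ p≤Y
          ... | t , refl = trans (cong ((+ suc d) ℤ.*_) (∂^-Δ^ p ψ t)) (factored t (ℕₚ.+-cancelˡ-≤ p t n Y≤))

    -- Once its p-th difference vanishes, `ψ` is a polynomial of degree below `p`, and the bound on
    -- `B + C` gives it `p` zeros at the two ends of [0, p + n].
    ψ-zero : B + C ≤ n + n + p → (∀ y → y ≤ n → χ y ≡ + 0) → ∀ y → y ≤ p + n → ψ y ≡ + 0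
    ψ-zero l χ0 = polOn-vanish (p + n) (p + n ∸ C) (p + n ∸ B) p ψ
      (polOn-difference (p + n) p ψ (λ y l → χ0 y (ℕₚ.+-cancelˡ-≤ p y n (subst (_≤ p + n) (ℕₚ.+-comm y p) l))))
      (ℕₚ.m≤n⇒m≤1+n (ℕₚ.m≤m+n p n))
      (arith p n B C _ _ l (ℕₚ.m≤n+m∸n (p + n) C) (ℕₚ.m≤n+m∸n (p + n) B))
      (λ i l _ → left i (<∸⇒+< i (p + n) C l))
      (λ i i′ e l → right i′ (arith′ i i′ (p + n) B (<∸⇒+< i (p + n) B l) e))
      where
      arith : ∀ p n B C μ ν → B + C ≤ n + n + p → p + n ≤ C + μ → p + n ≤ B + ν → p ≤ μ + ν
      arith p n B C μ ν h h′ h″ = linear p (μ + ν) 0 (h ⊕ h′ ⊕ h″) (go p n B C μ ν)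
        where
        go : ∀ p n B C μ ν → p + (n + n + p + (C + μ + (B + ν))) + 0 ≡ μ + ν + (B + C + (p + n + (p + n)))
        go = solve-∀
      arith′ : ∀ i i′ N B → i + B < N → i + i′ ≡ N → B < i′
      arith′ i i′ N B l e = linear (suc B) i′ 0 (l ⊕ ≡⇒≥ e) (go i i′ N B)
        where
        go : ∀ i i′ N B → suc B + (N + (i + i′)) + 0 ≡ i′ + (suc (i + B) + N)
        go = solve-∀

  -- shifted f i m is f (i − m), with value 0 at negative arguments.
  shifted : (ℕ → ℤ) → ℕ → ℕ → ℤ
  shifted f i       zero    = f i
  shifted f zero    (suc m) = + 0
  shifted f (suc i) (suc m) = shifted f i m

  shifted-< : ∀ f i m → i < m → shifted f i m ≡ + 0
  shifted-< f zero    (suc m) l       = refl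
  shifted-< f (suc i) (suc m) (s≤s l) = shifted-< f i m l

  shifted-+ : ∀ f k i m → shifted f (k + i) (k + m) ≡ shifted f i m
  shifted-+ f zero    i m = refl
  shifted-+ f (suc k) i m = shifted-+ f k i m

  shifted-at : ∀ f y m → shifted f (m + y) m ≡ f y
  shifted-at f y zero    = refl
  shifted-at f y (suc m) = shifted-at f y m

  shifted-∂ : ∀ f i m → shifted (∂ f) (suc i) m ≡ shifted f (suc i) m ℤ.- shifted f i m
  shifted-∂ f i       zero          = refl
  shifted-∂ f zero    (suc zero)    = refl
  shifted-∂ f zero    (suc (suc m)) = refl
  shifted-∂ f (suc i) (suc m)       = shifted-∂ f i m

  Δ^-shifted : ∀ s f n m t → Δ^ s (λ t → shifted f (t + n) m) t ≡ shifted (∂^ s f) (s + (t + n)) m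
  Δ^-shifted zero    f n m t = refl
  Δ^-shifted (suc s) f n m t = trans (cong₂ ℤ._-_ (trans (Δ^-shifted s f n m (suc t)) (cong (λ i → shifted (∂^ s f) i m) (ℕₚ.+-suc s (t + n)))) (Δ^-shifted s f n m t))
    (sym (shifted-∂ (∂^ s f) (s + (t + n)) m))

  shifted-cases : ∀ f i m {P : ℤ → Set} → P (+ 0) → (∀ y → i ≡ m + y → P (f y)) → P (shifted f i m)
  shifted-cases f i m {P} z h with ℕₚ.<-≤-connex i m
  ... | inj₁ l = subst P (sym (shifted-< f i m l)) z
  ... | inj₂ l with split-≤ l
  ...   | y , refl = subst P (sym (shifted-at f y m)) (h y refl)

  -- Injectivity for two boxes in three variables: the same problem with the roles of p and q exchanged, k and its
  -- q-th difference g taking the places of ψ and χ.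
  module PrimalGap (p β γ n b c N : ℕ) (size : n + N ≡ b + (β + γ + c)) (G H : ℕ → ℤ)
    (G-high  : ∀ y → n < y → G y ≡ + 0)
    (G-right : ∀ y → β + b < y → G y ≡ + 0)
    (G-left  : ∀ y → y + (γ + c) < n → G y ≡ + 0)
    (G-poly  : ∀ y → y ≤ β + b → p + n ≤ y + (γ + c) → ∂^ p G y ≡ + 0)
    (H-high  : ∀ y → n < β + γ + y → H y ≡ + 0)
    (H-right : ∀ y → b < y → H y ≡ + 0)
    (H-left  : ∀ y → y + (β + γ + c) < n → H y ≡ + 0)
    (G-H     : ∀ y → y ≤ b → n ≤ y + c → G y ≡ ∂^ (β + γ) H y) where

    q : ℕ
    q = β + γ

    -- The shifts move the leftmost positions allowed by `G-left` and `H-left` to 0. By `size` both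
    -- windows become [0, N], and the relation between `G` and `H` becomes Δ^q k t = g (γ + t).
    g k : ℕ → ℤ
    g t = shifted G (t + n) (γ + c)
    k t = shifted H (t + n) (q + c)

    -- The same numbers as in `DualGap` with their roles exchanged: `U` and `V` now count forced
    -- zeros of `g`, while `u` and `v` bound the overhang of ∂^q k.
    u v U V κ₀ κ₁ : ℕ
    u = n ∸ c
    v = n ∸ b
    U = (γ + c) ∸ n
    V = (β + b) ∸ n
    κ₀ = q ⊓ suc n
    κ₁ = p ⊓ suc N

    g-poly : ∀ t → t + p ≤ N → Δ^ p g t ≡ + 0
    g-poly t l = trans (Δ^-shifted p G n (γ + c) t) (shifted-cases (∂^ p G) (p + (t + n)) (γ + c) {_≡ + 0} refl
      (λ y e → G-poly y (arith₁ p t n γ c y β b N l e size) (arith₂ p t n (γ + c) y e)))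
      where
      arith₁ : ∀ p t n γ c y β b N → t + p ≤ N → p + (t + n) ≡ γ + c + y → n + N ≡ b + (β + γ + c) → y ≤ β + b
      arith₁ p t n γ c y β b N l e s = linear y (β + b) 0 (l ⊕ ≡⇒≥ e ⊕ ≡⇒≤ s) (go p t n γ c y β b N)
        where
        go : ∀ p t n γ c y β b N → y + (N + (p + (t + n) + (b + (β + γ + c)))) + 0 ≡ β + b + (t + p + (γ + c + y + (n + N)))
        go = solve-∀
      arith₂ : ∀ p t n m y → p + (t + n) ≡ m + y → p + n ≤ y + m
      arith₂ p t n m y e = linear (p + n) (y + m) t (≡⇒≤ e) (go p t n m y)
        where
        go : ∀ p t n m y → p + n + (m + y) + t ≡ y + m + (p + (t + n))
        go = solve-∀

    g-left : ∀ i → i < U → g i ≡ + 0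
    g-left i l = shifted-< G (i + n) (γ + c) (<∸⇒+< i (γ + c) n l)

    g-right : ∀ i i′ → i + i′ ≡ N → i < V → g i′ ≡ + 0
    g-right i i′ e l = shifted-cases G (i′ + n) (γ + c) {_≡ + 0} refl (λ y e′ → G-high y (arith i i′ N n γ c β b y e (<∸⇒+< i (β + b) n l) e′ size))
      where
      arith : ∀ i i′ N n γ c β b y → i + i′ ≡ N → i + n < β + b → i′ + n ≡ γ + c + y → n + N ≡ b + (β + γ + c) → n < y
      arith i i′ N n γ c β b y e l e′ s = linear (suc n) y 0 (≡⇒≥ e ⊕ l ⊕ ≡⇒≤ e′ ⊕ ≡⇒≥ s) (go i i′ N n γ c β b y)
        where
        go : ∀ i i′ N n γ c β b y → suc n + (i + i′ + (β + b + (γ + c + y + (n + N)))) + 0 ≡ y + (N + (suc (i + n) + (i′ + n + (b + (β + γ + c)))))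
        go = solve-∀

    g-zero-easy : κ₁ ≤ U + V → ∀ t → t ≤ N → g t ≡ + 0
    g-zero-easy l = polOn-vanish N U V κ₁ g (min-polOn N p g g-poly) (ℕₚ.m⊓n≤n p (suc N)) l (λ i l _ → g-left i l) g-right

    k-high : ∀ t → N < t → k t ≡ + 0
    k-high t l = shifted-cases H (t + n) (q + c) {_≡ + 0} refl (λ y e → H-right y (arith t n β γ c y b N l e size))
      where
      arith : ∀ t n β γ c y b N → N < t → t + n ≡ β + γ + c + y → n + N ≡ b + (β + γ + c) → b < y
      arith t n β γ c y b N l e s = linear (suc b) y 0 (l ⊕ ≡⇒≤ e ⊕ ≡⇒≥ s) (go t n β γ c y b N)
        where
        go : ∀ t n β γ c y b N → suc b + (t + (β + γ + c + y + (n + N))) + 0 ≡ y + (suc N + (t + n + (b + (β + γ + c))))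
        go = solve-∀

    k-beyond-c : ∀ t → suc c ≤ t → k t ≡ + 0
    k-beyond-c t l = shifted-cases H (t + n) (q + c) {_≡ + 0} refl (λ y e → H-high y (arith t n q c y l e))
      where
      arith : ∀ t n q c y → c < t → t + n ≡ q + c + y → n < q + y
      arith t n q c y l e = linear (suc n) (q + y) 0 (l ⊕ ≡⇒≤ e) (go t n q c y)
        where
        go : ∀ t n q c y → suc n + (t + (q + c + y)) + 0 ≡ q + y + (suc c + (t + n))
        go = solve-∀

    k-low : ∀ t → t + n < q + c → k t ≡ + 0
    k-low t l = shifted-< H (t + n) (q + c) l

    k-difference : ∀ t → q + t ≤ N → Δ^ q k t ≡ g (γ + t)
    k-difference t l = trans (Δ^-shifted q H n (q + c) t) (trans (shifted-+ (∂^ q H) q (t + n) c)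
      (trans agree (sym (trans (cong (λ i → shifted G i (γ + c)) (ℕₚ.+-assoc γ t n)) (shifted-+ G γ (t + n) c)))))
      where
      arith₁ : ∀ t n β γ c y b N → β + γ + t ≤ N → t + n ≡ c + y → n + N ≡ b + (β + γ + c) → y ≤ b
      arith₁ t n β γ c y b N l e s = linear y b 0 (l ⊕ ≡⇒≥ e ⊕ ≡⇒≤ s) (go t n β γ c y b N)
        where
        go : ∀ t n β γ c y b N → y + (N + (t + n + (b + (β + γ + c)))) + 0 ≡ b + (β + γ + t + (c + y + (n + N)))
        go = solve-∀
      agree : shifted (∂^ q H) (t + n) c ≡ shifted G (t + n) c
      agree with ℕₚ.<-≤-connex (t + n) c
      ... | inj₁ l′ = trans (shifted-< (∂^ q H) (t + n) c l′) (sym (shifted-< G (t + n) c l′))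
      ... | inj₂ l′ = go (split-≤ l′)
        where
        go : (∃ λ y → t + n ≡ c + y) → shifted (∂^ q H) (t + n) c ≡ shifted G (t + n) c
        go (y , e) = trans (cong (λ i → shifted (∂^ q H) i c) e) (trans (shifted-at (∂^ q H) y c)
          (trans (sym (G-H y (arith₁ t n β γ c y b N l e size) (ℕₚ.≤-trans (ℕₚ.m≤n+m n t) (ℕₚ.≤-trans (≡⇒≤ e) (≡⇒≤ (ℕₚ.+-comm c y))))))
          (sym (trans (cong (λ i → shifted G i c) e) (shifted-at G y c)))))

    edge-left : ∀ t → t < q → ∂^ q k t ≡ + 0 ⊎ q ≤ t + u
    edge-left t _ with suc (t + n) ℕ.≤? q + c
    ... | yes l = inj₁ (∂^-vanish-low q k (suc t) (λ t′ l′ → k-low t′ (ℕₚ.≤-trans (s≤s (ℕₚ.+-monoˡ-≤ n (ℕₚ.≤-pred l′))) l)) t (ℕₚ.n<1+n t))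
    ... | no ¬l = inj₂ (arith t n q c u (ℕₚ.≮⇒≥ ¬l) (ℕₚ.m≤n+m∸n n c))
      where
      arith : ∀ t n q c u → q + c ≤ t + n → n ≤ c + u → q ≤ t + u
      arith t n q c u h h′ = linear q (t + u) 0 (h ⊕ h′) (go t n q c u)
        where
        go : ∀ t n q c u → q + (t + n + (c + u)) + 0 ≡ t + u + (q + c + n)
        go = solve-∀

    edge-right : ∀ t → N < t → ∂^ q k t ≡ + 0 ⊎ t ≤ N + v
    edge-right t _ with suc (c + q) ℕ.≤? t
    ... | yes l = inj₁ (∂^-vanish-high q k (suc c) k-beyond-c t l)
    ... | no ¬l = inj₂ (arith t n β γ c v b N (ℕₚ.≮⇒≥ ¬l) (ℕₚ.m≤n+m∸n n b) size)
      where
      arith : ∀ t n β γ c v b N → t ≤ c + (β + γ) → n ≤ b + v → n + N ≡ b + (β + γ + c) → t ≤ N + v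
      arith t n β γ c v b N h h′ s = linear t (N + v) 0 (h ⊕ h′ ⊕ ≡⇒≥ s) (go t n β γ c v b N)
        where
        go : ∀ t n β γ c v b N → t + (c + (β + γ) + (b + v + (n + N))) + 0 ≡ N + v + (t + (n + (b + (β + γ + c))))
        go = solve-∀

    -- Here orthogonality reaches only [q, N], which covers just a part of the window of `g`, and it
    -- gives a root of θ only where `w` is nonzero. By `room` there are `κ` such points, enough for
    -- a polynomial of degree below `κ`.
    g-zero-gap : U + V ≤ κ₁ → p + (u + v) < κ₀ + (U + V) → ∀ t → t ≤ N → g t ≡ + 0
    g-zero-gap l₁ l t t≤N = use (min-polOn N p g g-poly)
      where
      κ : ℕ
      κ = κ₁ ∸ (U + V)
      κ-eq : U + V + κ ≡ κ₁
      κ-eq = ℕₚ.m+[n∸m]≡n l₁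
      small : κ + (u + v) < κ₀
      small = arith κ u v κ₀ κ₁ p U V l κ-eq (ℕₚ.m⊓n≤m p (suc N))
        where
        arith : ∀ κ u v κ₀ κ₁ p U V → p + (u + v) < κ₀ + (U + V) → U + V + κ ≡ κ₁ → κ₁ ≤ p → κ + (u + v) < κ₀
        arith κ u v κ₀ κ₁ p U V h e h′ = linear (suc (κ + (u + v))) κ₀ 0 (h ⊕ ≡⇒≤ e ⊕ h′) (go κ u v κ₀ κ₁ p U V)
          where
          go : ∀ κ u v κ₀ κ₁ p U V → suc (κ + (u + v)) + (κ₀ + (U + V) + (κ₁ + p)) + 0 ≡ κ₀ + (suc (p + (u + v)) + (U + V + κ + κ₁))
          go = solve-∀
      fits : u + (v + κ) ≤ q
      fits = arith u v κ q (ℕₚ.≤-trans small (ℕₚ.m⊓n≤m q (suc n)))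
        where
        arith : ∀ u v κ q → κ + (u + v) < q → u + (v + κ) ≤ q
        arith u v κ q h = linear (u + (v + κ)) q 1 h (go u v κ q)
          where
          go : ∀ u v κ q → u + (v + κ) + q + 1 ≡ q + suc (κ + (u + v))
          go = solve-∀
      room : ∀ i → i < κ → q + (c ∸ n) + (b ∸ n) + i ≤ N
      room i i<κ = arith i κ u v n N β γ b c (c ∸ n) (b ∸ n) i<κ (ℕₚ.≤-trans small (ℕₚ.m⊓n≤n q (suc n))) (∸-balance n c) (∸-balance n b) size
        where
        arith : ∀ i κ u v n N β γ b c v′ u′ → i < κ → κ + (u + v) < suc n → n + v′ ≡ c + u → n + u′ ≡ b + v → n + N ≡ b + (β + γ + c) → β + γ + v′ + u′ + i ≤ N
        arith i κ u v n N β γ b c v′ u′ h h′ e e′ s = linear (β + γ + v′ + u′ + i) N 1 (h ⊕ h′ ⊕ ≡⇒≤ e ⊕ ≡⇒≤ e′ ⊕ ≡⇒≥ s) (go i κ u v n N β γ b c v′ u′)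
          where
          go : ∀ i κ u v n N β γ b c v′ u′ → β + γ + v′ + u′ + i + (κ + (suc n + (c + u + (b + v + (n + N))))) + 1
            ≡ N + (suc i + (suc (κ + (u + v)) + (n + v′ + (n + u′ + (b + (β + γ + c))))))
          go = solve-∀
      use : PolOn N κ₁ g → g t ≡ + 0
      use (d , P , pol , eq) = conclude (divide-both N U V κ P (subst (λ k → Pol k P) (trans (sym κ-eq) (ℕₚ.+-assoc U V κ)) pol)
          (ℕₚ.≤-trans l₁ (ℕₚ.m⊓n≤n p (suc N)))
          (λ i i<U → trans (sym (eq i (inside i i<U))) (scaled-zero d (g-left i i<U)))
          (λ i i′ e i<V → trans (sym (eq i′ (ℕₚ.m+n≤o⇒n≤o i (≡⇒≤ e)))) (scaled-zero d (g-right i i′ e i<V))))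
        where
        inside : ∀ i → i < U → i ≤ N
        inside i i<U = ℕₚ.≤-pred (ℕₚ.≤-trans i<U (ℕₚ.≤-trans (ℕₚ.m≤m+n U V) (ℕₚ.≤-trans l₁ (ℕₚ.m⊓n≤n p (suc N)))))
        conclude : (Σ (ℤ → ℤ) λ θ → Pol κ θ × (∀ y → P y ≡ ff U y ℤ.* ff V (+ N ℤ.- y) ℤ.* θ y)) → g t ≡ + 0
        conclude (θ , polθ , fac) = cancel {+ suc d} suc≢0 (trans (eq t t≤N) (trans (fac (+ t))
            (trans (cong (ff U (+ t) ℤ.* ff V (+ N ℤ.- + t) ℤ.*_) (θ-zero (+ t))) (ℤₚ.*-zeroʳ (ff U (+ t) ℤ.* ff V (+ N ℤ.- + t))))))
          where
          w : ℕ → ℤ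
          w Y = ff U (+ (γ + (Y ∸ q))) ℤ.* ff V (+ (N ∸ (γ + (Y ∸ q))))
          θ′ : ℤ → ℤ
          θ′ Y = θ ((+ γ ℤ.- + q) ℤ.+ + 1 ℤ.* Y)
          shift : ∀ γ q t → γ ℤ.+ t ≡ (γ ℤ.- q) ℤ.+ + 1 ℤ.* (q ℤ.+ t)
          shift = ℤSolver.solve-∀
          w-at : ∀ t → γ + t ≤ N → ff U (+ (γ + t)) ℤ.* ff V (+ N ℤ.- + (γ + t)) ≡ w (q + t)
          w-at t l = cong₂ ℤ._*_ (cong (λ x → ff U (+ (γ + x))) (sym (ℕₚ.m+n∸m≡n q t))) (cong (ff V) (trans (minus l) (cong (λ x → + (N ∸ (γ + x))) (sym (ℕₚ.m+n∸m≡n q t)))))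
          θ-at : ∀ t → θ (+ (γ + t)) ≡ θ′ (+ (q + t))
          θ-at t = cong θ (trans (ℤₚ.pos-+ γ t) (trans (shift (+ γ) (+ q) (+ t)) (cong (λ x → (+ γ ℤ.- + q) ℤ.+ + 1 ℤ.* x) (sym (ℤₚ.pos-+ q t)))))
          γ+t≤N : ∀ t → q + t ≤ N → γ + t ≤ N
          γ+t≤N t l = ℕₚ.≤-trans (ℕₚ.+-monoˡ-≤ t (ℕₚ.m≤n+m γ β)) l
          at-Y : ∀ Y → q ≤ Y → Y ≤ N → (+ suc d) ℤ.* ∂^ q k Y ≡ w Y ℤ.* θ′ (+ Y)
          at-Y Y q≤Y Y≤N = go (split-≤ q≤Y)
            where
            go : (∃ λ t → Y ≡ q + t) → (+ suc d) ℤ.* ∂^ q k Y ≡ w Y ℤ.* θ′ (+ Y)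
            go (t , e) = subst (λ Y → (+ suc d) ℤ.* ∂^ q k Y ≡ w Y ℤ.* θ′ (+ Y)) (sym e)
              (trans (cong ((+ suc d) ℤ.*_) (trans (∂^-Δ^ q k t) (k-difference t q+t≤N)))
              (trans (eq (γ + t) (γ+t≤N t q+t≤N)) (trans (fac (+ (γ + t))) (cong₂ ℤ._*_ (w-at t (γ+t≤N t q+t≤N)) (θ-at t)))))
              where
              q+t≤N : q + t ≤ N
              q+t≤N = subst (_≤ N) e Y≤N
          wθ-zero : ∀ t → q + t ≤ N → w (q + t) ℤ.* θ′ (+ (q + t)) ≡ + 0
          wθ-zero t l = gap-lemma q N k u v κ θ′ w d k-high edge-left edge-right (pol-affine (+ γ ℤ.- + q) (+ 1) polθ) fits
            (λ Y _ _ → nonNeg-* (ff-nonNeg U (γ + (Y ∸ q))) (ff-nonNeg V (N ∸ (γ + (Y ∸ q))))) at-Y (q + t) (ℕₚ.m≤m+n q t) l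
          -- From γ + s₀ on the factor `ff U` is nonzero, because (γ + c) ∸ n is at most γ + (c ∸
          -- n).
          s₀ : ℕ
          s₀ = c ∸ n
          root : ∀ i → i < κ → θ (+ (γ + (s₀ + i))) ≡ + 0
          root i i<κ = trans (θ-at (s₀ + i)) (cancel w≢0 (wθ-zero (s₀ + i) q+t≤N))
            where
            arith₁ : ∀ q s b′ i N → q + s + b′ + i ≤ N → q + (s + i) ≤ N
            arith₁ q s b′ i N h = linear (q + (s + i)) N b′ h (go q s b′ i N)
              where
              go : ∀ q s b′ i N → q + (s + i) + N + b′ ≡ N + (q + s + b′ + i)
              go = solve-∀
            q+t≤N : q + (s₀ + i) ≤ N
            q+t≤N = arith₁ q s₀ (b ∸ n) i N (room i i<κ)
            U≤ : U ≤ γ + (s₀ + i)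
            U≤ = ℕₚ.≤-trans (ℕₚ.m≤n+o⇒m∸n≤o (γ + c) n (arith n γ c s₀ (ℕₚ.m≤n+m∸n c n))) (ℕₚ.+-monoʳ-≤ γ (ℕₚ.m≤m+n s₀ i))
              where
              arith : ∀ n γ c s → c ≤ n + s → γ + c ≤ n + (γ + s)
              arith n γ c s h = linear (γ + c) (n + (γ + s)) 0 h (go n γ c s)
                where
                go : ∀ n γ c s → γ + c + (n + s) + 0 ≡ n + (γ + s) + c
                go = solve-∀
            V≤ : V ≤ N ∸ (γ + (s₀ + i))
            V≤ = ℕₚ.m+n≤o⇒m≤o∸n V (arith V β γ s₀ (b ∸ n) i N (ℕₚ.m≤n+o⇒m∸n≤o (β + b) n (arith′ n β b (b ∸ n) (ℕₚ.m≤n+m∸n b n))) (room i i<κ))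
              where
              arith′ : ∀ n γ c s → c ≤ n + s → γ + c ≤ n + (γ + s)
              arith′ n γ c s h = linear (γ + c) (n + (γ + s)) 0 h (go n γ c s)
                where
                go : ∀ n γ c s → γ + c + (n + s) + 0 ≡ n + (γ + s) + c
                go = solve-∀
              arith : ∀ V β γ s b′ i N → V ≤ β + b′ → β + γ + s + b′ + i ≤ N → V + (γ + (s + i)) ≤ N
              arith V β γ s b′ i N h h′ = linear (V + (γ + (s + i))) N 0 (h ⊕ h′) (go V β γ s b′ i N)
                where
                go : ∀ V β γ s b′ i N → V + (γ + (s + i)) + (β + b′ + N) + 0 ≡ N + (V + (β + γ + s + b′ + i))
                go = solve-∀
            w≢0 : w (q + (s₀ + i)) ≢ + 0
            w≢0 z with ℤₚ.i*j≡0⇒i≡0∨j≡0 (ff U (+ (γ + (q + (s₀ + i) ∸ q)))) z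
            ... | inj₁ z₁ = ff-≢0 U (γ + (s₀ + i)) U≤ (trans (cong (λ x → ff U (+ (γ + x))) (sym (ℕₚ.m+n∸m≡n q (s₀ + i)))) z₁)
            ... | inj₂ z₂ = ff-≢0 V (N ∸ (γ + (s₀ + i))) V≤ (trans (cong (λ x → ff V (+ (N ∸ (γ + x)))) (sym (ℕₚ.m+n∸m≡n q (s₀ + i)))) z₂)
          o : ℤ
          o = + (γ + s₀)
          recentre : ∀ o y → y ≡ o ℤ.+ + 1 ℤ.* (y ℤ.- o)
          recentre = ℤSolver.solve-∀
          θ-zero : ∀ y → θ y ≡ + 0
          θ-zero y = trans (cong θ (recentre o y)) (pol-vanish κ κ 0 κ (λ y → θ (o ℤ.+ + 1 ℤ.* y)) (pol-affine o (+ 1) polθ) (ℕₚ.n≤1+n κ) (ℕₚ.m≤m+n κ 0)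
            (λ i i<κ → trans (cong θ (trans (cong (λ x → o ℤ.+ x) (ℤₚ.*-identityˡ (+ i))) (trans (sym (ℤₚ.pos-+ (γ + s₀) i)) (cong +_ (ℕₚ.+-assoc γ s₀ i))))) (root i i<κ))
            (λ i i′ e ()) (y ℤ.- o))

    G-zero : (∀ t → t ≤ N → g t ≡ + 0) → ∀ y → G y ≡ + 0
    G-zero g0 y with ℕₚ.<-≤-connex (β + b) y | ℕₚ.<-≤-connex (y + (γ + c)) n
    ... | inj₁ l | _      = G-right y l
    ... | inj₂ _ | inj₁ l = G-left y l
    ... | inj₂ l | inj₂ l′ = go (split-≤ l′)
      where
      arith : ∀ y γ c n t β b N → y + (γ + c) ≡ n + t → y ≤ β + b → n + N ≡ b + (β + γ + c) → t ≤ N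
      arith y γ c n t β b N e h s = linear t N 0 (≡⇒≥ e ⊕ h ⊕ ≡⇒≥ s) (go′ y γ c n t β b N)
        where
        go′ : ∀ y γ c n t β b N → t + (y + (γ + c) + (β + b + (n + N))) + 0 ≡ N + (n + t + (y + (b + (β + γ + c))))
        go′ = solve-∀
      go : (∃ λ t → y + (γ + c) ≡ n + t) → G y ≡ + 0
      go (t , e) = trans (sym (shifted-at G y (γ + c))) (trans (cong (λ i → shifted G i (γ + c)) (trans (ℕₚ.+-comm (γ + c) y) (trans e (ℕₚ.+-comm n t))))
        (g0 t (arith y γ c n t β b N e l size)))

    k-zero : n + n ≤ b + (β + γ + c) → (∀ t → t ≤ N → g t ≡ + 0) → ∀ t → t ≤ N → k t ≡ + 0
    k-zero l g0 = polOn-vanish N (q + c ∸ n) (q + b ∸ n) (q ⊓ suc N) k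
      (min-polOn N q k (λ t l → trans (k-difference t (subst (_≤ N) (ℕₚ.+-comm t q) l))
        (g0 (γ + t) (ℕₚ.≤-trans (ℕₚ.+-monoˡ-≤ t (ℕₚ.m≤n+m γ β)) (subst (_≤ N) (ℕₚ.+-comm t q) l)))))
      (ℕₚ.m⊓n≤n q (suc N))
      (ℕₚ.≤-trans (ℕₚ.m⊓n≤m q (suc N)) (arith β γ n b c _ _ l (ℕₚ.m≤n+m∸n (q + c) n) (ℕₚ.m≤n+m∸n (q + b) n)))
      (λ i l _ → k-low i (<∸⇒+< i (q + c) n l))
      (λ i i′ e l → k-beyond-c i′ (arith′ i i′ N n β γ b c (<∸⇒+< i (q + b) n l) e size))
      where
      arith : ∀ β γ n b c x y → n + n ≤ b + (β + γ + c) → β + γ + c ≤ n + x → β + γ + b ≤ n + y → β + γ ≤ x + y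
      arith β γ n b c x y h h′ h″ = linear (β + γ) (x + y) 0 (h ⊕ h′ ⊕ h″) (go β γ n b c x y)
        where
        go : ∀ β γ n b c x y → β + γ + (b + (β + γ + c) + (n + x + (n + y))) + 0 ≡ x + y + (n + n + (β + γ + c + (β + γ + b)))
        go = solve-∀
      arith′ : ∀ i i′ N n β γ b c → i + n < β + γ + b → i + i′ ≡ N → n + N ≡ b + (β + γ + c) → c < i′
      arith′ i i′ N n β γ b c h e s = linear (suc c) i′ 0 (h ⊕ ≡⇒≥ e ⊕ ≡⇒≥ s) (go i i′ N n β γ b c)
        where
        go : ∀ i i′ N n β γ b c → suc c + (β + γ + b + (i + i′ + (n + N))) + 0 ≡ i′ + (suc (i + n) + (N + (b + (β + γ + c))))
        go = solve-∀

    H-zero : (∀ t → t ≤ N → k t ≡ + 0) → ∀ y → H y ≡ + 0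
    H-zero k0 y with ℕₚ.<-≤-connex b y | ℕₚ.<-≤-connex (y + (q + c)) n
    ... | inj₁ l | _      = H-right y l
    ... | inj₂ _ | inj₁ l = H-left y l
    ... | inj₂ l | inj₂ l′ = go (split-≤ l′)
      where
      arith : ∀ y q c n t b N → y + (q + c) ≡ n + t → y ≤ b → n + N ≡ b + (q + c) → t ≤ N
      arith y q c n t b N e h s = linear t N 0 (≡⇒≥ e ⊕ h ⊕ ≡⇒≥ s) (go′ y q c n t b N)
        where
        go′ : ∀ y q c n t b N → t + (y + (q + c) + (b + (n + N))) + 0 ≡ N + (n + t + (y + (b + (q + c))))
        go′ = solve-∀
      go : (∃ λ t → y + (q + c) ≡ n + t) → H y ≡ + 0
      go (t , e) = trans (sym (shifted-at H y (q + c))) (trans (cong (λ i → shifted H i (q + c)) (trans (ℕₚ.+-comm (q + c) y) (trans e (ℕₚ.+-comm n t))))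
        (k0 t (arith y q c n t b N e l size)))

-- Three variables and type two: unions of two boxes.

module ThreeVariables where
  open import Data.Nat using (_+_)
  open import Data.Integer using (-_)
  open ℕSolver using (solve-∀)
  open ≡ using (refl; sym; trans; cong; cong₂; subst)
  open IntegerOperators using (prev)
  open FieldTransfer using (PrimalInjective; DualInjective)
  open FiniteDifferences
  open TwoVariables using (sgn; sgn-cancel; D^-kills-all)
  open GapProblems

  -- Curried functions make a permutation of the variables a mere reordering of arguments, as
  -- `swap-xy` and `swap-xz` exploit.
  Fn³ : Set
  Fn³ = ℕ → ℕ → ℕ → ℤ

  E³ D³ : Fn³ → Fn³
  E³ f x y z = prev (λ t → f t y z) x ℤ.+ (prev (λ t → f x t z) y ℤ.+ prev (λ t → f x y t) z)
  D³ f x y z = f (suc x) y z ℤ.+ (f x (suc y) z ℤ.+ f x y (suc z))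

  Region : Set₁
  Region = ℕ → ℕ → ℕ → Set

  -- The kernel equation in `Dual³` is required at every exponent of degree `j`, not only in the
  -- region; `D^-kills-all` provides it in this form.
  Primal³ Dual³ Lefschetz³ : Region → ℕ → Set
  Primal³ S j = ∀ f → (∀ x y z → ¬ (S x y z × x + y + z ≡ j) → f x y z ≡ + 0) →
    (∀ x y z → S x y z → x + y + z ≡ suc j → E³ f x y z ≡ + 0) → ∀ x y z → f x y z ≡ + 0
  Dual³ S j = ∀ φ → (∀ x y z → ¬ (S x y z × x + y + z ≡ suc j) → φ x y z ≡ + 0) →
    (∀ x y z → x + y + z ≡ j → D³ φ x y z ≡ + 0) → ∀ x y z → φ x y z ≡ + 0
  Lefschetz³ S j = Primal³ S j ⊎ Dual³ S j

  Box : ℕ → ℕ → ℕ → Region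
  Box a b c x y z = x ≤ a × y ≤ b × z ≤ c

  sgn²-cancel : ∀ m n {x} → sgn m ℤ.* sgn n ℤ.* x ≡ + 0 → x ≡ + 0
  sgn²-cancel m n {x} e = sgn-cancel n (sgn-cancel m (trans (sym (ℤₚ.*-assoc (sgn m) (sgn n) x)) e))

  sgn²-zero : ∀ m n {x} → x ≡ + 0 → sgn m ℤ.* sgn n ℤ.* x ≡ + 0
  sgn²-zero m n refl = ℤₚ.*-zeroʳ (sgn m ℤ.* sgn n)

  irr : ∀ {m n} → m < n → n ≤ m → ∀ {A : Set} → A
  irr l l′ = contradiction (ℕₚ.≤-trans l l′) (ℕₚ.<-irrefl refl)

  ∸-≤ : ∀ {m k} y → y ≤ m → m ∸ y ≤ k → m ≤ y + k
  ∸-≤ y l l′ = ℕₚ.≤-trans (ℕₚ.≤-reflexive (sym (ℕₚ.m+[n∸m]≡n l))) (ℕₚ.+-monoʳ-≤ y l′)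

  swap₁₂ : ∀ x y z → x + y + z ≡ y + x + z
  swap₁₂ = solve-∀

  swap₁₃ : ∀ x y z → x + y + z ≡ z + y + x
  swap₁₃ = solve-∀

  module Slices (S : Region) (j : ℕ) where

    module DualSlices (φ : Fn³) (supp : ∀ x y z → ¬ (S x y z × x + y + z ≡ suc j) → φ x y z ≡ + 0)
      (ker : ∀ x y z → x + y + z ≡ j → D³ φ x y z ≡ + 0) where

      ψ : ℕ → ℤ
      ψ y = sgn (suc j ∸ y) ℤ.* φ 0 y (suc j ∸ y)

      -- The kernel equation expresses slice x + 1 by slice `x`; after the signs this is a forward
      -- difference, so the slice x = 0 determines `φ`.
      ψ-slice : ∀ x y z → x + y + z ≡ suc j → sgn x ℤ.* sgn z ℤ.* φ x y z ≡ Δ^ x ψ y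
      ψ-slice zero y z e = trans (cong (ℤ._* φ 0 y z) (ℤₚ.*-identityˡ (sgn z)))
        (cong (λ t → sgn t ℤ.* φ 0 y t) (sym (trans (cong (_∸ y) (sym e)) (ℕₚ.m+n∸m≡n y z))))
      ψ-slice (suc x) y z e = trans (cong (- sgn x ℤ.* sgn z ℤ.*_) (isolate (φ (suc x) y z) (φ x (suc y) z) (φ x y (suc z)) (ker x y z (ℕₚ.suc-injective e))))
        (trans (go (sgn x) (sgn z) (φ x (suc y) z) (φ x y (suc z)))
        (cong₂ ℤ._-_ (ψ-slice x (suc y) z (trans (cong (_+ z) (ℕₚ.+-suc x y)) e)) (ψ-slice x y (suc z) (trans (ℕₚ.+-suc (x + y) z) e))))
        where
        isolate : ∀ a b c → a ℤ.+ (b ℤ.+ c) ≡ + 0 → a ≡ - (b ℤ.+ c)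
        isolate a b c e = trans (go a (b ℤ.+ c)) (trans (cong (ℤ._- (b ℤ.+ c)) e) (ℤₚ.+-identityˡ _))
          where
          go : ∀ a d → a ≡ a ℤ.+ d ℤ.- d
          go = ℤSolver.solve-∀
        go : ∀ s t u v → (- s ℤ.* t) ℤ.* (- (u ℤ.+ v)) ≡ s ℤ.* t ℤ.* u ℤ.- s ℤ.* (- t) ℤ.* v
        go = ℤSolver.solve-∀

      ψ-slice-zero : ∀ x y → x + y ≤ suc j → ¬ S x y (suc j ∸ (x + y)) → Δ^ x ψ y ≡ + 0
      ψ-slice-zero x y l ¬s = trans (sym (ψ-slice x y (suc j ∸ (x + y)) (ℕₚ.m+[n∸m]≡n l))) (sgn²-zero x (suc j ∸ (x + y)) (supp x y _ (λ p → ¬s (proj₁ p))))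

      φ-zero : (∀ y → y ≤ suc j → ψ y ≡ + 0) → ∀ x y z → φ x y z ≡ + 0
      φ-zero ψ0 x y z with x + y + z ℕ.≟ suc j
      ... | no ne = supp x y z (λ p → ne (proj₂ p))
      ... | yes e = sgn²-cancel x z (trans (ψ-slice x y z e) (Δ^-vanish x ψ (suc j) ψ0 y
                      (ℕₚ.≤-trans (ℕₚ.≤-reflexive (ℕₚ.+-comm y x)) (ℕₚ.≤-trans (ℕₚ.m≤m+n (x + y) z) (ℕₚ.≤-reflexive e)))))

    module PrimalSlices (f : Fn³) (supp : ∀ x y z → ¬ (S x y z × x + y + z ≡ j) → f x y z ≡ + 0)
      (ker : ∀ x y z → S x y z → x + y + z ≡ suc j → E³ f x y z ≡ + 0) where

      F : ℕ → ℕ → ℤ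
      F x y with x + y ℕ.≤? j
      ... | yes _ = sgn x ℤ.* sgn y ℤ.* f x y (j ∸ (x + y))
      ... | no  _ = + 0

      F-high : ∀ x y → j < x + y → F x y ≡ + 0
      F-high x y l with x + y ℕ.≤? j
      ... | yes l′ = irr l l′
      ... | no  _  = refl

      F-at : ∀ x y z → x + y + z ≡ j → F x y ≡ sgn x ℤ.* sgn y ℤ.* f x y z
      F-at x y z e with x + y ℕ.≤? j
      ... | yes _ = cong (λ t → sgn x ℤ.* sgn y ℤ.* f x y t) (trans (cong (_∸ (x + y)) (sym e)) (ℕₚ.m+n∸m≡n (x + y) z))
      ... | no ¬l = contradiction (ℕₚ.m+n≤o⇒m≤o (x + y) (ℕₚ.≤-reflexive e)) ¬l

      F-support : ∀ x y → (x + y ≤ j → ¬ S x y (j ∸ (x + y))) → F x y ≡ + 0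
      F-support x y ¬s with x + y ℕ.≤? j
      ... | yes l = sgn²-zero x y (supp x y _ (λ p → ¬s l (proj₁ p)))
      ... | no  _ = refl

      prev-zero : ∀ g y → (∀ y′ → suc y′ ≡ y → g y′ ≡ + 0) → prev g y ≡ + 0
      prev-zero g zero    v = refl
      prev-zero g (suc y) v = v y refl

      ∂F : ∀ x y z → x + y + z ≡ suc j → ∂ (F x) y ≡ sgn x ℤ.* sgn y ℤ.* (prev (λ t → f x t z) y ℤ.+ prev (λ t → f x y t) z)
      ∂F x y z e = trans (cong₂ (λ s t → s ℤ.+ - t) (second z e) (first y e)) (go (sgn x ℤ.* sgn y) (prev (λ t → f x t z) y) (prev (λ t → f x y t) z))
        where
        go : ∀ s a b → s ℤ.* b ℤ.+ - (- (s ℤ.* a)) ≡ s ℤ.* (a ℤ.+ b)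
        go = ℤSolver.solve-∀
        second : ∀ z → x + y + z ≡ suc j → F x y ≡ sgn x ℤ.* sgn y ℤ.* prev (λ t → f x y t) z
        second zero    e = trans (F-high x y (ℕₚ.≤-reflexive (trans (sym e) (ℕₚ.+-identityʳ (x + y))))) (sym (ℤₚ.*-zeroʳ (sgn x ℤ.* sgn y)))
        second (suc z) e = F-at x y z (ℕₚ.suc-injective (trans (sym (ℕₚ.+-suc (x + y) z)) e))
        neg : ∀ s t u → s ℤ.* t ℤ.* u ≡ - (s ℤ.* (- t) ℤ.* u)
        neg = ℤSolver.solve-∀
        first : ∀ y → x + y + z ≡ suc j → prev (F x) y ≡ - (sgn x ℤ.* sgn y ℤ.* prev (λ t → f x t z) y)
        first zero    e = sym (cong -_ (ℤₚ.*-zeroʳ (sgn x ℤ.* + 1)))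
        first (suc y) e = trans (F-at x y z (ℕₚ.suc-injective (trans (cong (_+ z) (sym (ℕₚ.+-suc x y))) e))) (neg (sgn x) (sgn y) (f x y z))

      ∂F-high : ∀ x y → suc j < x + y → ∂ (F x) y ≡ + 0
      ∂F-high x y l = cong₂ ℤ._-_ (F-high x y (ℕₚ.<-trans (ℕₚ.n<1+n j) l))
        (prev-zero (F x) y (λ { y′ refl → F-high x y′ (ℕₚ.≤-pred (subst (suc (suc j) ≤_) (ℕₚ.+-suc x y′) l)) }))

      -- The kernel equation at (x + 1, y, z) expresses slice `x` by slice x + 1. Elements are thus
      -- determined from the top slice downwards, as long as the equation is taken at a point of the
      -- region.
      step : ∀ x y → (x + y ≤ j → S (suc x) y (j ∸ (x + y))) → F x y ≡ ∂ (F (suc x)) y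
      step x y s with ℕₚ.<-≤-connex j (x + y)
      ... | inj₁ l = trans (F-high x y l) (sym (∂F-high (suc x) y (s≤s l)))
      ... | inj₂ l = trans (F-at x y z e) (trans (arrange (sgn x) (sgn y) _ _ (ker (suc x) y z (s l) (cong suc e))) (sym (∂F (suc x) y z (cong suc e))))
        where
        z : ℕ
        z = j ∸ (x + y)
        e : x + y + z ≡ j
        e = ℕₚ.m+[n∸m]≡n l
        arrange : ∀ s t a b → a ℤ.+ b ≡ + 0 → s ℤ.* t ℤ.* a ≡ - s ℤ.* t ℤ.* b
        arrange s t a b eq = trans (go s t a b) (trans (cong (λ w → s ℤ.* t ℤ.* w ℤ.+ - s ℤ.* t ℤ.* b) eq) (go′ s t b))
          where
          go : ∀ s t a b → s ℤ.* t ℤ.* a ≡ s ℤ.* t ℤ.* (a ℤ.+ b) ℤ.+ - s ℤ.* t ℤ.* b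
          go = ℤSolver.solve-∀
          go′ : ∀ s t b → s ℤ.* t ℤ.* + 0 ℤ.+ - s ℤ.* t ℤ.* b ≡ - s ℤ.* t ℤ.* b
          go′ = ℤSolver.solve-∀

      base : ∀ y → (y ≤ suc j → S 0 y (suc j ∸ y)) → ∂ (F 0) y ≡ + 0
      base y s with ℕₚ.<-≤-connex (suc j) y
      ... | inj₁ l = ∂F-high 0 y l
      ... | inj₂ l = trans (∂F 0 y (suc j ∸ y) (ℕₚ.m+[n∸m]≡n l)) (sgn²-zero 0 y (trans (sym (ℤₚ.+-identityˡ _)) (ker 0 y (suc j ∸ y) (s l) (ℕₚ.m+[n∸m]≡n l))))

      chain : ∀ a′ b′ c′ → (∀ x y z → Box a′ b′ c′ x y z → S x y z) → ∀ i x → x + i ≡ a′ → ∀ y → y ≤ b′ → j ≤ x + y + c′ → F x y ≡ ∂^ i (F a′) y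
      chain a′ b′ c′ inS zero    x e y l l′ = cong (λ t → F t y) (trans (sym (ℕₚ.+-identityʳ x)) e)
      chain a′ b′ c′ inS (suc i) x e y l l′ = trans (step x y (λ _ → inS (suc x) y _ (x<a′ , l , ℕₚ.m≤n+o⇒m∸n≤o j (x + y) l′)))
        (cong₂ ℤ._-_ (chain a′ b′ c′ inS i (suc x) e′ y l (ℕₚ.m≤n⇒m≤1+n l′)) (prevs y l l′))
        where
        e′ : suc x + i ≡ a′
        e′ = trans (sym (ℕₚ.+-suc x i)) e
        x<a′ : suc x ≤ a′
        x<a′ = ℕₚ.m+n≤o⇒m≤o (suc x) (ℕₚ.≤-reflexive e′)
        prevs : ∀ y → y ≤ b′ → j ≤ x + y + c′ → prev (F (suc x)) y ≡ prev (∂^ i (F a′)) y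
        prevs zero    l l′ = refl
        prevs (suc y) l l′ = chain a′ b′ c′ inS i (suc x) e′ y (ℕₚ.<⇒≤ l) (subst (λ t → j ≤ t + c′) (ℕₚ.+-suc x y) l′)

      -- There is no slice below x = 0, so one further step down turns the relation between slices
      -- into an equation for the top slice alone.
      chain-end : ∀ a′ b′ c′ → (∀ x y z → Box a′ b′ c′ x y z → S x y z) → ∀ y → y ≤ b′ → suc j ≤ y + c′ → ∂^ (suc a′) (F a′) y ≡ + 0
      chain-end a′ b′ c′ inS y l l′ = trans (sym (cong₂ ℤ._-_ (chain a′ b′ c′ inS a′ 0 refl y l (ℕₚ.<⇒≤ l′)) (prevs y l l′)))
        (base y (λ _ → inS 0 y _ (z≤n , l , ℕₚ.m≤n+o⇒m∸n≤o (suc j) y l′)))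
        where
        prevs : ∀ y → y ≤ b′ → suc j ≤ y + c′ → prev (F 0) y ≡ prev (∂^ a′ (F a′)) y
        prevs zero    l l′ = refl
        prevs (suc y) l l′ = chain a′ b′ c′ inS a′ 0 refl y (ℕₚ.<⇒≤ l) (ℕₚ.≤-pred l′)

  module TwoBoxes (a β γ b c : ℕ) where

    -- The second box exceeds the first by `β` and `γ` in y and z; equality of degrees then makes
    -- the first longer by `q` in x. The slices 0, ..., a that both boxes meet are `p` in number.
    q p : ℕ
    q = β + γ
    p = suc a

    S : Region
    S x y z = Box (q + a) b c x y z ⊎ Box a (β + b) (γ + c) x y z

    in₁ : ∀ x y z → Box (q + a) b c x y z → S x y z
    in₁ x y z = inj₁

    in₂ : ∀ x y z → Box a (β + b) (γ + c) x y z → S x y z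
    in₂ x y z = inj₂

    S-y : ∀ {x y z} → S x y z → y ≤ β + b
    S-y (inj₁ (_ , l , _)) = ℕₚ.≤-trans l (ℕₚ.m≤n+m b β)
    S-y (inj₂ (_ , l , _)) = l

    S-z : ∀ {x y z} → S x y z → z ≤ γ + c
    S-z (inj₁ (_ , _ , l)) = ℕₚ.≤-trans l (ℕₚ.m≤n+m c γ)
    S-z (inj₂ (_ , _ , l)) = l

    S-large-x : ∀ {x y z} → a < x → S x y z → x ≤ q + a × y ≤ b × z ≤ c
    S-large-x l (inj₁ s)            = s
    S-large-x l (inj₂ (l′ , _ , _)) = contradiction (ℕₚ.≤-trans l l′) (ℕₚ.<-irrefl refl)

    -- Within the second box all slices are differences of slice `a`, within the first all are
    -- differences of slice `q + a`; beyond x = a only the first box is left.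
    slices-vanish : ∀ j (f : Fn³) (supp : ∀ x y z → ¬ (S x y z × x + y + z ≡ j) → f x y z ≡ + 0)
      (ker : ∀ x y z → S x y z → x + y + z ≡ suc j → E³ f x y z ≡ + 0) →
      (∀ y → Slices.PrimalSlices.F S j f supp ker a y ≡ + 0) → (∀ y → Slices.PrimalSlices.F S j f supp ker (q + a) y ≡ + 0) →
      ∀ x y z → f x y z ≡ + 0
    slices-vanish j f supp ker G0 H0 x y z with x + y + z ℕ.≟ j
    ... | no ne = supp x y z (λ p → ne (proj₂ p))
    ... | yes e = decide (ℕₚ.<-≤-connex b y) (ℕₚ.<-≤-connex c z) (ℕₚ.<-≤-connex (β + b) y) (ℕₚ.<-≤-connex (γ + c) z) (ℕₚ.<-≤-connex a x) (ℕₚ.<-≤-connex (q + a) x)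
      where
      open Slices.PrimalSlices S j f supp ker
      out : ¬ S x y z → f x y z ≡ + 0
      out ¬s = supp x y z (λ p → ¬s (proj₁ p))
      window : ∀ c′ → z ≤ c′ → j ≤ x + y + c′
      window c′ l = ℕₚ.≤-trans (ℕₚ.≤-reflexive (sym e)) (ℕₚ.+-monoʳ-≤ (x + y) l)
      small : x ≤ a → y ≤ β + b → z ≤ γ + c → f x y z ≡ + 0
      small lx ly lz = sgn²-cancel x y (trans (sym (F-at x y z e)) (trans (chain a (β + b) (γ + c) in₂ (a ∸ x) x (ℕₚ.m+[n∸m]≡n lx) y ly (window _ lz)) (∂^-zero (a ∸ x) (F a) G0 y)))
      large : x ≤ q + a → y ≤ b → z ≤ c → f x y z ≡ + 0
      large lx ly lz = sgn²-cancel x y (trans (sym (F-at x y z e)) (trans (chain (q + a) b c in₁ (q + a ∸ x) x (ℕₚ.m+[n∸m]≡n lx) y ly (window _ lz)) (∂^-zero (q + a ∸ x) (F (q + a)) H0 y)))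
      decide : b < y ⊎ y ≤ b → c < z ⊎ z ≤ c → β + b < y ⊎ y ≤ β + b → γ + c < z ⊎ z ≤ γ + c → a < x ⊎ x ≤ a → q + a < x ⊎ x ≤ q + a → f x y z ≡ + 0
      decide _ _ (inj₁ l) _ _ _ = out (λ s → irr l (S-y s))
      decide _ _ _ (inj₁ l) _ _ = out (λ s → irr l (S-z s))
      decide _ _ (inj₂ ly) (inj₂ lz) (inj₂ lx) _ = small lx ly lz
      decide (inj₁ l) _ _ _ (inj₁ la) _ = out (λ s → irr l (proj₁ (proj₂ (S-large-x la s))))
      decide _ (inj₁ l) _ _ (inj₁ la) _ = out (λ s → irr l (proj₂ (proj₂ (S-large-x la s))))
      decide _ _ _ _ (inj₁ la) (inj₁ l) = out (λ s → irr l (proj₁ (S-large-x la s)))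
      decide (inj₂ ly) (inj₂ lz) _ _ (inj₁ _) (inj₂ lx) = large lx ly lz

    low-degree : ∀ j → j < a → Primal³ S j
    low-degree j j<a f supp ker = slices-vanish j f supp ker
      (λ y → F-high a y (ℕₚ.≤-trans j<a (ℕₚ.m≤m+n a y)))
      (λ y → F-high (q + a) y (ℕₚ.≤-trans j<a (ℕₚ.≤-trans (ℕₚ.m≤n+m a q) (ℕₚ.m≤m+n (q + a) y))))
      where open Slices.PrimalSlices S j f supp ker

    module Degree (n : ℕ) where

      j : ℕ
      j = a + n

      u v U V κ₀ : ℕ
      u = n ∸ c
      v = n ∸ b
      U = (γ + c) ∸ n
      V = (β + b) ∸ n
      κ₀ = q ⊓ suc n

      dual : (β + b) + (γ + c) ≤ n + n + p → (κ₀ ≤ u + v ⊎ (u + v ≤ κ₀ × κ₀ + (U + V) ≤ p + (u + v))) → Dual³ S j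
      dual l cond φ supp ker = φ-zero (ψ-zero l (λ y y≤n → χ0 cond y y≤n))
        where
        open Slices.DualSlices S j φ supp ker
        ψ-support : ∀ y → (y + 0 ≤ p + n → ¬ S 0 y (p + n ∸ y)) → ψ y ≡ + 0
        ψ-support y ¬s with ℕₚ.<-≤-connex (p + n) y
        ... | inj₁ l = trans (cong (sgn (p + n ∸ y) ℤ.*_) (supp 0 y (p + n ∸ y) (λ s → irr l (ℕₚ.m+n≤o⇒m≤o y (ℕₚ.≤-reflexive (proj₂ s)))))) (ℤₚ.*-zeroʳ (sgn (p + n ∸ y)))
        ... | inj₂ l = ψ-slice-zero 0 y l (¬s (ℕₚ.≤-trans (ℕₚ.≤-reflexive (ℕₚ.+-identityʳ y)) l))
        inner : ∀ x y → suc a ≤ x → x + y ≤ p + n → (b < y ⊎ x + y + c < p + n ⊎ q + a < x) → Δ^ x ψ y ≡ + 0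
        inner x y a<x l bad = ψ-slice-zero x y l (λ s → absurd (S-large-x a<x s) bad)
          where
          absurd : x ≤ q + a × y ≤ b × p + n ∸ (x + y) ≤ c → (b < y ⊎ x + y + c < p + n ⊎ q + a < x) → _
          absurd (_ , ly , _) (inj₁ l′)        = irr l′ ly
          absurd (_ , _ , lz) (inj₂ (inj₁ l′)) = irr l′ (∸-≤ (x + y) l lz)
          absurd (lx , _ , _) (inj₂ (inj₂ l′)) = irr l′ lx
        rearrange : ∀ q p y → q + p + y ≡ p + (y + q)
        rearrange = solve-∀
        open DualGap p q n b c (β + b) (γ + c) ψ
          (λ y l → ψ-support y (λ l′ → irr l (ℕₚ.m+n≤o⇒m≤o y l′)))
          (λ y l → ψ-support y (λ l′ s → irr l (∸-≤ y (ℕₚ.m+n≤o⇒m≤o y l′) (S-z s))))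
          (λ y l → ψ-support y (λ _ s → irr l (S-y s)))
          (λ y y≤n l → inner p y ℕₚ.≤-refl (ℕₚ.+-monoʳ-≤ p y≤n) (inj₂ (inj₁ (ℕₚ.≤-trans (ℕₚ.≤-reflexive (trans (cong suc (ℕₚ.+-assoc p y c)) (sym (ℕₚ.+-suc p (y + c))))) (ℕₚ.+-monoʳ-≤ p l)))))
          (λ y y≤n l → inner p y ℕₚ.≤-refl (ℕₚ.+-monoʳ-≤ p y≤n) (inj₁ l))
          (λ y l → trans (Δ^-+ q p ψ y) (inner (q + p) y (ℕₚ.m≤n+m p q)
            (ℕₚ.≤-trans (ℕₚ.≤-reflexive (rearrange q p y)) (ℕₚ.+-monoʳ-≤ p l)) (inj₂ (inj₂ (ℕₚ.≤-reflexive (sym (ℕₚ.+-suc q a)))))))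
          using (ψ-zero; χ-zero-easy; χ-zero-gap)
        χ0 : (κ₀ ≤ u + v ⊎ (u + v ≤ κ₀ × κ₀ + (U + V) ≤ p + (u + v))) → ∀ y → y ≤ n → Δ^ p ψ y ≡ + 0
        χ0 (inj₁ easy)       = χ-zero-easy easy
        χ0 (inj₂ (l₁ , l₂))  = χ-zero-gap l₁ l₂

      primal : n + n ≤ b + (q + c) → (p ≤ U + V ⊎ p + (u + v) < κ₀ + (U + V)) → Primal³ S j
      primal l cond f supp ker = slices-vanish j f supp ker (G-zero g0) (H-zero (k-zero l g0))
        where
        open Slices.PrimalSlices S j f supp ker
        N : ℕ
        N = b + (q + c) ∸ n
        H-support : ∀ y → (b < y ⊎ y + (q + c) < n) → F (q + a) y ≡ + 0
        H-support y bad = F-support (q + a) y (λ l s → contra bad l s)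
          where
          -- The slice x = q + a meets the second box only if q = 0, and then the two boxes
          -- coincide.
          top : ∀ {y z} → S (q + a) y z → y ≤ b × z ≤ c
          top (inj₁ (_ , ly , lz)) = ly , lz
          top {y} {z} (inj₂ (lx , ly , lz)) = subst (λ t → y ≤ t + b) β≡0 ly , subst (λ t → z ≤ t + c) γ≡0 lz
            where
            q≡0 : q ≡ 0
            q≡0 = ℕₚ.n≤0⇒n≡0 (ℕₚ.+-cancelʳ-≤ a q 0 lx)
            β≡0 : β ≡ 0
            β≡0 = ℕₚ.m+n≡0⇒m≡0 β q≡0
            γ≡0 : γ ≡ 0
            γ≡0 = ℕₚ.m+n≡0⇒n≡0 β q≡0
          contra : (b < y ⊎ y + (q + c) < n) → q + a + y ≤ a + n → ¬ S (q + a) y (a + n ∸ (q + a + y))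
          contra (inj₁ l) _ s = irr l (proj₁ (top s))
          contra (inj₂ l) l′ s = irr l (arith q a y n c (∸-≤ (q + a + y) l′ (proj₂ (top s))))
            where
            arith : ∀ q a y n c → a + n ≤ q + a + y + c → n ≤ y + (q + c)
            arith q a y n c h = linear n (y + (q + c)) 0 h (go q a y n c)
              where
              go : ∀ q a y n c → n + (q + a + y + c) + 0 ≡ y + (q + c) + (a + n)
              go = solve-∀
        rearrange : ∀ a q y → a + (q + y) ≡ q + a + y
        rearrange = solve-∀
        open PrimalGap p β γ n b c N (ℕₚ.m+[n∸m]≡n (ℕₚ.≤-trans (ℕₚ.m≤m+n n n) l)) (F a) (F (q + a))
          (λ y l → F-high a y (ℕₚ.≤-trans (ℕₚ.≤-reflexive (sym (ℕₚ.+-suc a n))) (ℕₚ.+-monoʳ-≤ a l)))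
          (λ y l → F-support a y (λ _ s → irr l (S-y s)))
          (λ y l → F-support a y (λ l′ s → irr l (ℕₚ.+-cancelˡ-≤ a n (y + (γ + c)) (ℕₚ.≤-trans (∸-≤ (a + y) l′ (S-z s)) (ℕₚ.≤-reflexive (ℕₚ.+-assoc a y (γ + c)))))))
          (λ y l l′ → chain-end a (β + b) (γ + c) in₂ y l l′)
          (λ y l → F-high (q + a) y (ℕₚ.≤-trans (ℕₚ.≤-reflexive (sym (ℕₚ.+-suc a n))) (ℕₚ.≤-trans (ℕₚ.+-monoʳ-≤ a l) (ℕₚ.≤-reflexive (rearrange a q y)))))
          (λ y l → H-support y (inj₁ l))
          (λ y l → H-support y (inj₂ l))
          (λ y l l′ → chain (q + a) b c in₁ q a (ℕₚ.+-comm a q) y l (ℕₚ.≤-trans (ℕₚ.+-monoʳ-≤ a l′) (ℕₚ.≤-reflexive (sym (ℕₚ.+-assoc a y c)))))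
          using (G-zero; H-zero; k-zero; g; g-zero-easy; g-zero-gap; κ₁)
        vanish : (p ≤ U + V ⊎ p + (u + v) < κ₀ + (U + V)) → κ₁ ≤ U + V ⊎ U + V ≤ κ₁ → ∀ t → t ≤ N → g t ≡ + 0
        vanish (inj₁ l₁) _         = g-zero-easy (ℕₚ.≤-trans (ℕₚ.m⊓n≤m p (suc N)) l₁)
        vanish (inj₂ _)  (inj₁ l₁) = g-zero-easy l₁
        vanish (inj₂ l₂) (inj₂ l₁) = g-zero-gap l₁ l₂
        g0 : ∀ t → t ≤ N → g t ≡ + 0
        g0 = vanish cond (ℕₚ.≤-total κ₁ (U + V))

      -- If 2n is at least (β + b) + (γ + c), the forced zeros of `χ` suffice; if `U + V` is at
      -- least `p`, those of `g` do. In the remaining range the conditions of the two gap arguments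
      -- are opposite comparisons of `p + (u + v)` with `κ₀ + (U + V)`, so one of them applies.
      lefschetz : Lefschetz³ S j
      lefschetz with ℕₚ.≤-total ((β + b) + (γ + c)) (n + n)
      ... | inj₁ l = inj₂ (dual (ℕₚ.≤-trans l (ℕₚ.m≤m+n (n + n) p)) (inj₁ (ℕₚ.≤-trans (ℕₚ.m⊓n≤m q (suc n)) (arith β γ b c n u v l (ℕₚ.m≤n+m∸n n c) (ℕₚ.m≤n+m∸n n b)))))
        where
        arith : ∀ β γ b c n u v → (β + b) + (γ + c) ≤ n + n → n ≤ c + u → n ≤ b + v → β + γ ≤ u + v
        arith β γ b c n u v h h′ h″ = linear (β + γ) (u + v) 0 (h ⊕ h′ ⊕ h″) (go β γ b c n u v)
          where
          go : ∀ β γ b c n u v → β + γ + (n + n + (c + u + (b + v))) + 0 ≡ u + v + ((β + b) + (γ + c) + (n + n))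
          go = solve-∀
      ... | inj₂ l with ℕₚ.<-≤-connex (U + V) p
      ...   | inj₂ l₁ = inj₁ (primal (ℕₚ.≤-trans l (ℕₚ.≤-reflexive (rearrange β γ b c))) (inj₁ l₁))
        where
        rearrange : ∀ β γ b c → (β + b) + (γ + c) ≡ b + (β + γ + c)
        rearrange = solve-∀
      ...   | inj₁ l₁ with ℕₚ.<-≤-connex (p + (u + v)) (κ₀ + (U + V))
      ...     | inj₁ l₂ = inj₁ (primal (ℕₚ.≤-trans l (ℕₚ.≤-reflexive (rearrange β γ b c))) (inj₂ l₂))
        where
        rearrange : ∀ β γ b c → (β + b) + (γ + c) ≡ b + (β + γ + c)
        rearrange = solve-∀
      ...     | inj₂ l₂ = inj₂ (dual (arith β γ b c n U V p l₁ (ℕₚ.m≤n+m∸n (γ + c) n) (ℕₚ.m≤n+m∸n (β + b) n)) (split (ℕₚ.≤-total κ₀ (u + v))))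
        where
        arith : ∀ β γ b c n U V p → U + V < p → γ + c ≤ n + U → β + b ≤ n + V → (β + b) + (γ + c) ≤ n + n + p
        arith β γ b c n U V p h h′ h″ = linear ((β + b) + (γ + c)) (n + n + p) 1 (h ⊕ h′ ⊕ h″) (go β γ b c n U V p)
          where
          go : ∀ β γ b c n U V p → (β + b) + (γ + c) + (p + (n + U + (n + V))) + 1 ≡ n + n + p + (suc (U + V) + (γ + c + (β + b)))
          go = solve-∀
        split : κ₀ ≤ u + v ⊎ u + v ≤ κ₀ → κ₀ ≤ u + v ⊎ (u + v ≤ κ₀ × κ₀ + (U + V) ≤ p + (u + v))
        split (inj₁ l) = inj₁ l
        split (inj₂ l) = inj₂ (l , l₂)

    two-boxes : ∀ j → Lefschetz³ S j
    two-boxes j with ℕₚ.<-≤-connex j a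
    ... | inj₁ l = inj₁ (low-degree j l)
    ... | inj₂ l with split-≤ l
    ...   | n , refl = Degree.lefschetz n

  Lefschetz³-resp : ∀ {S T : Region} {j} → (∀ {x y z} → S x y z → T x y z) → (∀ {x y z} → T x y z → S x y z) → Lefschetz³ S j → Lefschetz³ T j
  Lefschetz³-resp to from (inj₁ pr) = inj₁ (λ f supp ker → pr f (λ x y z ¬s → supp x y z (λ t → ¬s (from (proj₁ t) , proj₂ t))) (λ x y z s → ker x y z (to s)))
  Lefschetz³-resp to from (inj₂ du) = inj₂ (λ φ supp ker → du φ (λ x y z ¬s → supp x y z (λ t → ¬s (from (proj₁ t) , proj₂ t))) ker)

  swap-xy : ∀ {S : Region} {j} → Lefschetz³ (λ x y z → S y x z) j → Lefschetz³ S j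
  swap-xy {S} {j} (inj₁ pr) = inj₁ λ f supp ker x y z → pr (λ x y z → f y x z)
    (λ x y z ¬s → supp y x z (λ t → ¬s (proj₁ t , trans (swap₁₂ x y z) (proj₂ t))))
    (λ x y z s e → trans (ar (prev (λ t → f y t z) x) (prev (λ t → f t x z) y) _) (ker y x z s (trans (swap₁₂ y x z) e))) y x z
    where
    ar : ∀ u v w → u ℤ.+ (v ℤ.+ w) ≡ v ℤ.+ (u ℤ.+ w)
    ar = ℤSolver.solve-∀
  swap-xy {S} {j} (inj₂ du) = inj₂ λ φ supp ker x y z → du (λ x y z → φ y x z)
    (λ x y z ¬s → supp y x z (λ t → ¬s (proj₁ t , trans (swap₁₂ x y z) (proj₂ t))))
    (λ x y z e → trans (ar (φ y (suc x) z) (φ (suc y) x z) _) (ker y x z (trans (swap₁₂ y x z) e))) y x z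
    where
    ar : ∀ u v w → u ℤ.+ (v ℤ.+ w) ≡ v ℤ.+ (u ℤ.+ w)
    ar = ℤSolver.solve-∀

  swap-xz : ∀ {S : Region} {j} → Lefschetz³ (λ x y z → S z y x) j → Lefschetz³ S j
  swap-xz {S} {j} (inj₁ pr) = inj₁ λ f supp ker x y z → pr (λ x y z → f z y x)
    (λ x y z ¬s → supp z y x (λ t → ¬s (proj₁ t , trans (swap₁₃ x y z) (proj₂ t))))
    (λ x y z s e → trans (ar (prev (λ t → f z y t) x) (prev (λ t → f z t x) y) (prev (λ t → f t y x) z)) (ker z y x s (trans (swap₁₃ z y x) e))) z y x
    where
    ar : ∀ u v w → u ℤ.+ (v ℤ.+ w) ≡ w ℤ.+ (v ℤ.+ u)
    ar = ℤSolver.solve-∀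
  swap-xz {S} {j} (inj₂ du) = inj₂ λ φ supp ker x y z → du (λ x y z → φ z y x)
    (λ x y z ¬s → supp z y x (λ t → ¬s (proj₁ t , trans (swap₁₃ x y z) (proj₂ t))))
    (λ x y z e → trans (ar (φ z y (suc x)) (φ z (suc y) x) (φ (suc z) y x)) (ker z y x (trans (swap₁₃ z y x) e))) z y x
    where
    ar : ∀ u v w → u ℤ.+ (v ℤ.+ w) ≡ w ℤ.+ (v ℤ.+ u)
    ar = ℤSolver.solve-∀

  Two : (a₁ b₁ c₁ a₂ b₂ c₂ : ℕ) → Region
  Two a₁ b₁ c₁ a₂ b₂ c₂ x y z = Box a₁ b₁ c₁ x y z ⊎ Box a₂ b₂ c₂ x y z

  sorted : ∀ a₁ b₁ c₁ a₂ b₂ c₂ → a₁ + b₁ + c₁ ≡ a₂ + b₂ + c₂ → b₁ ≤ b₂ → c₁ ≤ c₂ → ∀ j → Lefschetz³ (Two a₁ b₁ c₁ a₂ b₂ c₂) j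
  sorted a₁ b₁ c₁ a₂ b₂ c₂ e lb lc j = subst (λ t → Lefschetz³ (Two t b₁ c₁ a₂ b₂ c₂) j) (sym a₁-eq)
    (subst₂′ (ℕₚ.m∸n+n≡m lb) (ℕₚ.m∸n+n≡m lc) (TwoBoxes.two-boxes a₂ β γ b₁ c₁ j))
    where
    β γ : ℕ
    β = b₂ ∸ b₁
    γ = c₂ ∸ c₁
    subst₂′ : ∀ {B C} → β + b₁ ≡ B → γ + c₁ ≡ C → Lefschetz³ (TwoBoxes.S a₂ β γ b₁ c₁) j → Lefschetz³ (Two (β + γ + a₂) b₁ c₁ a₂ B C) j
    subst₂′ refl refl l = l
    a₁-eq : a₁ ≡ β + γ + a₂
    a₁-eq = ℕₚ.+-cancelʳ-≡ (b₁ + c₁) a₁ (β + γ + a₂) (trans (sym (ℕₚ.+-assoc a₁ b₁ c₁)) (trans e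
      (trans (cong₂ (λ s t → a₂ + s + t) (sym (ℕₚ.m∸n+n≡m lb)) (sym (ℕₚ.m∸n+n≡m lc))) (go a₂ β b₁ γ c₁))))
      where
      go : ∀ a β b γ c → a + (β + b) + (γ + c) ≡ β + γ + a + (b + c)
      go = solve-∀

  -- Of three comparisons two go in the same direction. Moving these two coordinates to the last
  -- places, and exchanging the boxes if necessary, reaches the normal form of `sorted`.
  two-box-lefschetz : ∀ a₁ b₁ c₁ a₂ b₂ c₂ → a₁ + b₁ + c₁ ≡ a₂ + b₂ + c₂ → ∀ j → Lefschetz³ (Two a₁ b₁ c₁ a₂ b₂ c₂) j
  two-box-lefschetz a₁ b₁ c₁ a₂ b₂ c₂ e j with ℕₚ.≤-total a₁ a₂ | ℕₚ.≤-total b₁ b₂ | ℕₚ.≤-total c₁ c₂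
  ... | _       | inj₁ lb | inj₁ lc = sorted a₁ b₁ c₁ a₂ b₂ c₂ e lb lc j
  ... | _       | inj₂ lb | inj₂ lc = Lefschetz³-resp Sum.swap Sum.swap (sorted a₂ b₂ c₂ a₁ b₁ c₁ (sym e) lb lc j)
  ... | inj₁ la | inj₂ lb | inj₁ lc = swap-xy (Lefschetz³-resp turn turn (sorted b₁ a₁ c₁ b₂ a₂ c₂ (trans (swap₁₂ b₁ a₁ c₁) (trans e (swap₁₂ a₂ b₂ c₂))) la lc j))
    where
    turn : ∀ {a b c a′ b′ c′ x y z} → Two a b c a′ b′ c′ x y z → Two b a c b′ a′ c′ y x z
    turn (inj₁ (p , q , r)) = inj₁ (q , p , r)
    turn (inj₂ (p , q , r)) = inj₂ (q , p , r)
  ... | inj₂ la | inj₁ lb | inj₂ lc = swap-xy (Lefschetz³-resp turn turn (sorted b₂ a₂ c₂ b₁ a₁ c₁ (trans (swap₁₂ b₂ a₂ c₂) (trans (sym e) (swap₁₂ a₁ b₁ c₁))) la lc j))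
    where
    turn : ∀ {a b c a′ b′ c′ x y z} → Two a b c a′ b′ c′ x y z → Two b′ a′ c′ b a c y x z
    turn (inj₁ (p , q , r)) = inj₂ (q , p , r)
    turn (inj₂ (p , q , r)) = inj₁ (q , p , r)
  ... | inj₁ la | inj₁ lb | inj₂ lc = swap-xz (Lefschetz³-resp turn turn (sorted c₁ b₁ a₁ c₂ b₂ a₂ (trans (swap₁₃ c₁ b₁ a₁) (trans e (swap₁₃ a₂ b₂ c₂))) lb la j))
    where
    turn : ∀ {a b c a′ b′ c′ x y z} → Two a b c a′ b′ c′ x y z → Two c b a c′ b′ a′ z y x
    turn (inj₁ (p , q , r)) = inj₁ (r , q , p)
    turn (inj₂ (p , q , r)) = inj₂ (r , q , p)
  ... | inj₂ la | inj₂ lb | inj₁ lc = swap-xz (Lefschetz³-resp turn turn (sorted c₂ b₂ a₂ c₁ b₁ a₁ (trans (swap₁₃ c₂ b₂ a₂) (trans (sym e) (swap₁₃ a₁ b₁ c₁))) lb la j))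
    where
    turn : ∀ {a b c a′ b′ c′ x y z} → Two a b c a′ b′ c′ x y z → Two c′ b′ a′ c b a z y x
    turn (inj₁ (p , q , r)) = inj₂ (r , q , p)
    turn (inj₂ (p , q , r)) = inj₁ (r , q , p)

  module _ (gs : Gens 3) (m m′ : Vec ℕ 3) (same : deg m ≡ deg m′)
    (to : ∀ b → Standard gs b → (b ∣ₘ m) ⊎ (b ∣ₘ m′)) (from : ∀ b → (b ∣ₘ m) ⊎ (b ∣ₘ m′) → Standard gs b) where

    lefschetz₃ : ∀ j → PrimalInjective gs 1 j ⊎ DualInjective gs 1 j
    lefschetz₃ j = build m m′ same to from
      where
      deg₃ : ∀ x y z → deg (x ∷ y ∷ z ∷ []) ≡ x + y + z
      deg₃ = go
        where
        go : ∀ x y z → x + (y + (z + 0)) ≡ x + y + z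
        go = solve-∀
      zero³ : ∀ a b d → a ℤ.+ (b ℤ.+ (d ℤ.+ + 0)) ≡ a ℤ.+ (b ℤ.+ d)
      zero³ = ℤSolver.solve-∀
      build : ∀ m m′ → deg m ≡ deg m′ → (∀ b → Standard gs b → (b ∣ₘ m) ⊎ (b ∣ₘ m′)) → (∀ b → (b ∣ₘ m) ⊎ (b ∣ₘ m′) → Standard gs b) →
        PrimalInjective gs 1 j ⊎ DualInjective gs 1 j
      build (a₁ ∷ b₁ ∷ c₁ ∷ []) (a₂ ∷ b₂ ∷ c₂ ∷ []) same to from = use (two-box-lefschetz a₁ b₁ c₁ a₂ b₂ c₂ (trans (sym (deg₃ a₁ b₁ c₁)) (trans same (deg₃ a₂ b₂ c₂))) j)
        where
        S⇒T : ∀ {x y z} → Standard gs (x ∷ y ∷ z ∷ []) → Two a₁ b₁ c₁ a₂ b₂ c₂ x y z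
        S⇒T s with to _ s
        ... | inj₁ (p ∷ q ∷ r ∷ []) = inj₁ (p , q , r)
        ... | inj₂ (p ∷ q ∷ r ∷ []) = inj₂ (p , q , r)
        T⇒S : ∀ {x y z} → Two a₁ b₁ c₁ a₂ b₂ c₂ x y z → Standard gs (x ∷ y ∷ z ∷ [])
        T⇒S (inj₁ (p , q , r)) = from _ (inj₁ (p ∷ q ∷ r ∷ []))
        T⇒S (inj₂ (p , q , r)) = from _ (inj₂ (p ∷ q ∷ r ∷ []))
        use : Lefschetz³ (Two a₁ b₁ c₁ a₂ b₂ c₂) j → PrimalInjective gs 1 j ⊎ DualInjective gs 1 j
        use (inj₁ pr) = inj₁ λ f supp ker → λ { (x ∷ y ∷ z ∷ []) → pr (λ x y z → f (x ∷ y ∷ z ∷ []))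
          (λ x y z ¬t → supp _ (λ s → ¬t (S⇒T (proj₁ s) , trans (sym (deg₃ x y z)) (proj₂ s))))
          (λ x y z t e → trans (sym (zero³ (prev (λ t → f (t ∷ y ∷ z ∷ [])) x) (prev (λ t → f (x ∷ t ∷ z ∷ [])) y) (prev (λ t → f (x ∷ y ∷ t ∷ [])) z)))
            (ker (x ∷ y ∷ z ∷ []) (T⇒S t) (trans (deg₃ x y z) (trans e (ℕₚ.+-comm 1 j))))) x y z }
        use (inj₂ du) = inj₂ λ φ supp ker → λ { (x ∷ y ∷ z ∷ []) → du (λ x y z → φ (x ∷ y ∷ z ∷ []))
          (λ x y z ¬t → supp _ (λ s → ¬t (S⇒T (proj₁ s) , trans (sym (deg₃ x y z)) (trans (proj₂ s) (ℕₚ.+-comm j 1)))))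
          (λ x y z e → trans (sym (zero³ (φ (suc x ∷ y ∷ z ∷ [])) (φ (x ∷ suc y ∷ z ∷ [])) (φ (x ∷ y ∷ suc z ∷ []))))
            (D^-kills-all gs 1 j φ supp ker (x ∷ y ∷ z ∷ []) (trans (deg₃ x y z) e))) x y z }

-- Socles of monomial algebras, and algebras prescribed by their socle.

module LevelAlgebras where
  open import Data.Fin.Properties using () renaming (any? to anyFin?)
  open Vecₚ using ([]≔-idempotent; []≔-lookup; lookup∘update; ≡-dec)
  open Anyₚ using (lookup-index)
  open IntegerOperators using (δ; δ-refl; δ-≢; ∣ₘ-refl; ∣ₘ-trans)
  open Enumerations
  open FieldTransfer using (module OverField)
  open CompleteIntersections using (deg-mono)

  bump : ∀ {r} → Fin r → Vec ℕ r → Vec ℕ r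
  bump i b = b [ i ]≔ suc (lookup b i)

  bump-above : ∀ {r} (i : Fin r) b → b ∣ₘ bump i b
  bump-above zero    (x ∷ b) = ℕₚ.n≤1+n x ∷ ∣ₘ-refl
  bump-above (suc i) (x ∷ b) = ℕₚ.≤-refl ∷ bump-above i b

  deg-bump : ∀ {r} (i : Fin r) b → deg (bump i b) ≡ suc (deg b)
  deg-bump zero    (x ∷ b) = ≡.refl
  deg-bump (suc i) (x ∷ b) = ≡.trans (≡.cong (x ℕ.+_) (deg-bump i b)) (ℕₚ.+-suc x (deg b))

  bump-lower : ∀ {r} (i : Fin r) b → bump i b [ i ]≔ lookup b i ≡ b
  bump-lower i b = ≡.trans ([]≔-idempotent b i) ([]≔-lookup b i)

  bump-raise : ∀ {r} (i : Fin r) b n → lookup b i ≡ suc n → bump i (b [ i ]≔ n) ≡ b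
  bump-raise i b n e = ≡.trans ([]≔-idempotent b i) (≡.trans (≡.cong (λ t → b [ i ]≔ suc t) (lookup∘update i b n)) (≡.trans (≡.cong (b [ i ]≔_) (≡.sym e)) ([]≔-lookup b i)))

  proper-divisor : ∀ {r} (b m : Vec ℕ r) → b ∣ₘ m → b ≢ m → ∃ λ i → bump i b ∣ₘ m
  proper-divisor []      []      []       b≢m = contradiction ≡.refl b≢m
  proper-divisor (x ∷ b) (k ∷ m) (l ∷ bm) b≢m with ℕₚ.m≤n⇒m<n∨m≡n l
  ... | inj₁ x<k = zero , x<k ∷ bm
  ... | inj₂ ≡.refl with proper-divisor b m bm (λ e → b≢m (≡.cong (x ∷_) e))
  ...   | i , l′ = suc i , ℕₚ.≤-refl ∷ l′

  Maximal : ∀ {r} → Gens r → Vec ℕ r → Set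
  Maximal gs m = Standard gs m × (∀ i → ¬ Standard gs (bump i m))

  -- `k` is fuel: each step raises the degree by one, and a standard monomial has degree below `D`.
  climb : ∀ {r} (gs : Gens r) D → (∀ b → D ≤ deg b → b ∈I gs) → ∀ k b → Standard gs b → D ≤ deg b ℕ.+ k → ∃ λ m → b ∣ₘ m × Maximal gs m
  climb gs D art zero    b std l = contradiction (art b (≡.subst (D ≤_) (ℕₚ.+-identityʳ (deg b)) l)) std
  climb gs D art (suc k) b std l with anyFin? (λ i → standard? gs (bump i b))
  ... | no  ¬up = b , ∣ₘ-refl , std , λ i s → ¬up (i , s)
  ... | yes (i , s) with climb gs D art k (bump i b) s (≡.subst (D ≤_) (≡.trans (ℕₚ.+-suc (deg b) k) (≡.cong (ℕ._+ k) (≡.sym (deg-bump i b)))) l)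
  ...   | m , bm , mx = m , ∣ₘ-trans (bump-above i b) bm , mx

  zeros : ∀ r → Vec ℕ r
  zeros r = Vec.replicate r 0

  deg-zeros : ∀ r → deg (zeros r) ≡ 0
  deg-zeros zero    = ≡.refl
  deg-zeros (suc r) = deg-zeros r

  standard-zeros : ∀ {r} (gs : Gens r) → NoLinearForms gs → Standard gs (zeros r)
  standard-zeros {r} gs nlf z∈I with find z∈I
  ... | g , g∈ , g∣z = contradiction (ℕₚ.≤-trans (All.lookup nlf g∈) (ℕₚ.≤-trans (deg-mono g∣z) (ℕₚ.≤-reflexive (deg-zeros r)))) λ ()

  module Socle {c ℓ} (K : Field c ℓ) {r} (gs : Gens r) where
    open Field K hiding (zero)
    open Algebra K gs
    open OverField K using (ι; ι-1; sumFin-cong)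
    open import Algebra.Solver.Ring.NaturalCoefficients.Default commutativeSemiring using (solve; _:=_; _:+_; _:*_)

    δᴷ : Vec ℕ r → Elt
    δᴷ m b = ι (δ m b)

    δᴷ-refl : ∀ m → δᴷ m m ≈ 1#
    δᴷ-refl m = trans (reflexive (≡.cong ι (δ-refl m))) ι-1

    δᴷ-≢ : ∀ m b → m ≢ b → δᴷ m b ≈ 0#
    δᴷ-≢ m b ne = reflexive (≡.cong ι (δ-≢ m b ne))

    maximal⇒socle : ∀ m → Maximal gs m → InSocle (δᴷ m)
    maximal⇒socle m (std , mx) i b stdb with lookup b i in eq
    ... | zero  = refl
    ... | suc n = δᴷ-≢ m (b [ i ]≔ n) (λ { ≡.refl → mx i (≡.subst (Standard gs) (≡.sym (bump-raise i b n eq)) stdb) })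

    maximal-degree : ∀ e → (∀ f → InSocle f → InDeg e f) → ∀ m → Maximal gs m → deg m ≡ e
    maximal-degree e lev m mx = decidable-stable (deg m ℕ.≟ e) (λ ne →
      1≉0 (trans (sym (δᴷ-refl m)) (lev (δᴷ m) (maximal⇒socle m mx) m (proj₁ mx) ne)))

    -- For distinct maximal monomials both δ-functions would be multiples of the same vector, and
    -- the vanishing 2 × 2 determinant would read 1 = 0. Arguing by contradiction is legitimate
    -- because equality of exponents is decidable.
    one-dimensional : SocleDim 1 → ∀ m m′ → Maximal gs m → Maximal gs m′ → m ≡ m′
    one-dimensional (v , _ , _ , span) m m′ mx mx′ = decidable-stable (≡-dec ℕ._≟_ m m′) (λ ne → contra ne (span (δᴷ m) (maximal⇒socle m mx)) (span (δᴷ m′) (maximal⇒socle m′ mx′)))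
      where
      contra : m ≢ m′ → (Σ (Fin 1 → Carrier) λ a → δᴷ m ≈A lin a v) → (Σ (Fin 1 → Carrier) λ a → δᴷ m′ ≈A lin a v) → ⊥
      contra ne (a , ea) (a′ , ea′) = 1≉0 (trans (sym (*-identityʳ 1#)) (trans (*-cong (trans (sym (δᴷ-refl m)) (ea m (proj₁ mx))) (trans (sym (δᴷ-refl m′)) (ea′ m′ (proj₁ mx′))))
          (trans (exchange (a zero) (a′ zero) (v zero m) (v zero m′))
          (trans (*-congˡ (trans (sym (ea m′ (proj₁ mx′))) (δᴷ-≢ m m′ ne))) (zeroʳ _)))))
        where
        exchange : ∀ p q x y → (p * x + 0#) * (q * y + 0#) ≈ (q * x) * (p * y + 0#)
        exchange p q x y = trans (*-cong (+-identityʳ _) (+-identityʳ _)) (trans (go p q x y) (*-congˡ (sym (+-identityʳ _))))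
          where
          go : ∀ p q x y → (p * x) * (q * y) ≈ (q * x) * (p * y)
          go = solve 4 (λ p q x y → ((p :* x) :* (q :* y)) := ((q :* x) :* (p :* y))) refl

    -- Otherwise the 3 × 3 identity matrix is the product of a 3 × 2 and a 2 × 3 matrix, whose determinant vanishes.
    two-dimensional : SocleDim 2 → ∀ m₀ m₁ m₂ → Maximal gs m₀ → Maximal gs m₁ → Maximal gs m₂ → m₀ ≢ m₁ → m₀ ≡ m₂ ⊎ m₁ ≡ m₂
    two-dimensional (v , _ , _ , span) m₀ m₁ m₂ x₀ x₁ x₂ ne₀₁ with ≡-dec ℕ._≟_ m₀ m₂ | ≡-dec ℕ._≟_ m₁ m₂
    ... | yes e   | _       = inj₁ e
    ... | _       | yes e   = inj₂ e
    ... | no ne₀₂ | no ne₁₂ = contradiction (contra (expand m₀ x₀) (expand m₁ x₁) (expand m₂ x₂)) 1≉0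
      where
      expand : ∀ m → Maximal gs m → Σ (Fin 2 → Carrier) λ a → ∀ b → Standard gs b → δᴷ m b ≈ a zero * v zero b + a (suc zero) * v (suc zero) b
      expand m mx with span (δᴷ m) (maximal⇒socle m mx)
      ... | a , e = a , λ b s → trans (e b s) (+-congˡ (+-identityʳ _))
      even odd : (a b c d e f g h i : Carrier) → Carrier
      even a b c d e f g h i = a * (e * i) + (b * (f * g) + c * (d * h))
      odd  a b c d e f g h i = a * (f * h) + (b * (d * i) + c * (e * g))
      even≈odd : ∀ a b a′ b′ a″ b″ x y x′ y′ x″ y″ →
        even (a * x + b * y) (a * x′ + b * y′) (a * x″ + b * y″) (a′ * x + b′ * y) (a′ * x′ + b′ * y′) (a′ * x″ + b′ * y″) (a″ * x + b″ * y) (a″ * x′ + b″ * y′) (a″ * x″ + b″ * y″)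
        ≈ odd (a * x + b * y) (a * x′ + b * y′) (a * x″ + b * y″) (a′ * x + b′ * y) (a′ * x′ + b′ * y′) (a′ * x″ + b′ * y″) (a″ * x + b″ * y) (a″ * x′ + b″ * y′) (a″ * x″ + b″ * y″)
      even≈odd = solve 12 (λ a b a′ b′ a″ b″ x y x′ y′ x″ y″ → let
          p = (a :* x) :+ (b :* y) ; q = (a :* x′) :+ (b :* y′) ; r = (a :* x″) :+ (b :* y″)
          s = (a′ :* x) :+ (b′ :* y) ; t = (a′ :* x′) :+ (b′ :* y′) ; u = (a′ :* x″) :+ (b′ :* y″)
          v = (a″ :* x) :+ (b″ :* y) ; w = (a″ :* x′) :+ (b″ :* y′) ; z = (a″ :* x″) :+ (b″ :* y″)
        in ((p :* (t :* z)) :+ ((q :* (u :* v)) :+ (r :* (s :* w)))) := ((p :* (u :* w)) :+ ((q :* (s :* z)) :+ (r :* (t :* v))))) refl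
      Expansion : Vec ℕ r → Set _
      Expansion m = Σ (Fin 2 → Carrier) λ a → ∀ b → Standard gs b → δᴷ m b ≈ a zero * v zero b + a (suc zero) * v (suc zero) b
      contra : Expansion m₀ → Expansion m₁ → Expansion m₂ → 1# ≈ 0#
      contra (a , ea) (b , eb) (c , ec) = begin
        1#
          ≈⟨ trans (*-identityˡ _) (*-identityˡ _) ⟨
        1# * (1# * 1#)
          ≈⟨ +-identityʳ _ ⟨
        1# * (1# * 1#) + 0#
          ≈⟨ +-cong (*-cong (trans (sym (δᴷ-refl m₀)) (ea m₀ (proj₁ x₀))) (*-cong (trans (sym (δᴷ-refl m₁)) (eb m₁ (proj₁ x₁))) (trans (sym (δᴷ-refl m₂)) (ec m₂ (proj₁ x₂)))))
               (trans (sym (+-identityʳ 0#)) (+-cong (sym (trans (*-congʳ (off₀ m₁ x₁ ne₀₁)) (zeroˡ _))) (sym (trans (*-congʳ (off₀ m₂ x₂ ne₀₂)) (zeroˡ _))))) ⟩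
        even _ _ _ _ _ _ _ _ _
          ≈⟨ even≈odd (a zero) (a (suc zero)) (b zero) (b (suc zero)) (c zero) (c (suc zero)) (v zero m₀) (v (suc zero) m₀) (v zero m₁) (v (suc zero) m₁) (v zero m₂) (v (suc zero) m₂) ⟩
        odd _ _ _ _ _ _ _ _ _
          ≈⟨ +-cong (trans (*-congˡ (trans (*-congʳ (trans (sym (eb m₂ (proj₁ x₂))) (δᴷ-≢ m₁ m₂ ne₁₂))) (zeroˡ _))) (zeroʳ _))
               (+-cong (trans (*-congʳ (off₀ m₁ x₁ ne₀₁)) (zeroˡ _)) (trans (*-congʳ (off₀ m₂ x₂ ne₀₂)) (zeroˡ _))) ⟩
        0# + (0# + 0#)
          ≈⟨ trans (+-identityˡ _) (+-identityˡ _) ⟩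
        0# ∎
        where
        open import Relation.Binary.Reasoning.Setoid setoid
        off₀ : ∀ m → Maximal gs m → m₀ ≢ m → a zero * v zero m + a (suc zero) * v (suc zero) m ≈ 0#
        off₀ m mx ne = trans (sym (ea m (proj₁ mx))) (δᴷ-≢ m₀ m ne)

  module Shape {c ℓ} (K : Field c ℓ) {r} (gs : Gens r) where
    open Algebra K gs using (SocleDim; InSocle; InDeg)
    open Socle K gs

    type-one : MonomialArtinianLevel K r 1 gs → Σ (Vec ℕ r) λ m → (∀ b → Standard gs b → b ∣ₘ m) × (∀ b → b ∣ₘ m → Standard gs b)
    type-one (nlf , (D , art) , dim , _) with climb gs D art D (zeros r) (standard-zeros gs nlf) (ℕₚ.m≤n+m D _)
    ... | m , _ , mx = m , to , λ b bm → standard-downClosed gs bm (proj₁ mx)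
      where
      to : ∀ b → Standard gs b → b ∣ₘ m
      to b std with climb gs D art D b std (ℕₚ.m≤n+m D _)
      ... | m′ , bm′ , mx′ = ≡.subst (b ∣ₘ_) (one-dimensional dim m′ m mx′ mx) bm′

    type-two : MonomialArtinianLevel K r 2 gs → Σ (Vec ℕ r) λ m → Σ (Vec ℕ r) λ m′ → deg m ≡ deg m′ ×
      (∀ b → Standard gs b → (b ∣ₘ m) ⊎ (b ∣ₘ m′)) × (∀ b → (b ∣ₘ m) ⊎ (b ∣ₘ m′) → Standard gs b)
    type-two (nlf , (D , art) , dim , e , lev) with climb gs D art D (zeros r) (standard-zeros gs nlf) (ℕₚ.m≤n+m D _)
    ... | m , _ , mx with Any.any? (λ b → standard? gs b ×-dec ¬? (b ∣ₘ? m)) (cube r D)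
    -- Every standard monomial divides `m`, and the two boxes coincide. Searching `cube r D` decides
    -- this, since standard monomials have degree below `D`.
    ...   | no none = m , m , ≡.refl , (λ b std → inj₁ (decidable-stable (b ∣ₘ? m) (λ ¬bm → none (lose (∈-cube (entries≤deg b (ℕₚ.<⇒≤ (ℕₚ.≰⇒> (λ l → std (art b l)))))) (std , ¬bm))))) ,
              λ { b (inj₁ bm) → standard-downClosed gs bm (proj₁ mx) ; b (inj₂ bm) → standard-downClosed gs bm (proj₁ mx) }
    ...   | yes some with find some
    ...     | b₀ , _ , std₀ , ¬b₀m with climb gs D art D b₀ std₀ (ℕₚ.m≤n+m D _)
    ...       | m′ , b₀m′ , mx′ = m , m′ , ≡.trans (maximal-degree e lev m mx) (≡.sym (maximal-degree e lev m′ mx′)) , to ,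
                  λ { b (inj₁ bm) → standard-downClosed gs bm (proj₁ mx) ; b (inj₂ bm) → standard-downClosed gs bm (proj₁ mx′) }
      where
      to : ∀ b → Standard gs b → (b ∣ₘ m) ⊎ (b ∣ₘ m′)
      to b std with climb gs D art D b std (ℕₚ.m≤n+m D _)
      ... | m″ , bm″ , mx″ with two-dimensional dim m m′ m″ mx mx′ mx″ (λ { ≡.refl → ¬b₀m b₀m′ })
      ...   | inj₁ ≡.refl = inj₁ bm″
      ...   | inj₂ ≡.refl = inj₂ bm″

  cap : ∀ {r} → ℕ → Vec ℕ r → Vec ℕ r
  cap M []      = []
  cap M (x ∷ b) = x ⊓ M ∷ cap M b

  cap-divides : ∀ {r} M (b : Vec ℕ r) → cap M b ∣ₘ b
  cap-divides M []      = []
  cap-divides M (x ∷ b) = ℕₚ.m⊓n≤m x M ∷ cap-divides M b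

  cap-bounded : ∀ {r} M (b : Vec ℕ r) → VAll.All (_≤ M) (cap M b)
  cap-bounded M []      = VAll.[]
  cap-bounded M (x ∷ b) = ℕₚ.m⊓n≤n x M VAll.∷ cap-bounded M b

  -- An entry cut down to `M` still exceeds every entry of `m`. Hence the non-divisors with entries
  -- at most `M` already generate the ideal of all non-divisors.
  cap-reflects : ∀ {r} M (b m : Vec ℕ r) → deg m < M → cap M b ∣ₘ m → b ∣ₘ m
  cap-reflects M []      []      _ []        = []
  cap-reflects M (x ∷ b) (k ∷ m) d (l ∷ ls) = head (ℕₚ.≤-total x M) ∷ cap-reflects M b m (ℕₚ.≤-trans (s≤s (ℕₚ.m≤n+m (deg m) k)) d) ls
    where
    head : x ≤ M ⊎ M ≤ x → x ≤ k
    head (inj₁ x≤M) = ≡.subst (_≤ k) (ℕₚ.m≤n⇒m⊓n≡m x≤M) l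
    head (inj₂ M≤x) = contradiction (ℕₚ.≤-trans (s≤s (ℕₚ.m≤m+n k (deg m))) (ℕₚ.≤-trans d (≡.subst (_≤ k) (ℕₚ.m≥n⇒m⊓n≡n M≤x) l))) (ℕₚ.<-irrefl ≡.refl)

  deg-zero-divides : ∀ {r} (g m : Vec ℕ r) → deg g ≡ 0 → g ∣ₘ m
  deg-zero-divides []         []      _ = []
  deg-zero-divides (zero ∷ g) (k ∷ m) e = z≤n ∷ deg-zero-divides g m e

  deg-one-divides : ∀ {r} (g : Vec ℕ r) → deg g < 2 → (∀ m → g ∣ₘ m) ⊎ (∃ λ i → ∀ m → 1 ≤ lookup m i → g ∣ₘ m)
  deg-one-divides []               l = inj₁ λ { [] → [] }
  deg-one-divides (zero ∷ g)       l with deg-one-divides g l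
  ... | inj₁ h       = inj₁ λ { (k ∷ m) → z≤n ∷ h m }
  ... | inj₂ (i , h) = inj₂ (suc i , λ { (k ∷ m) p → z≤n ∷ h m p })
  deg-one-divides (suc zero ∷ g)   (s≤s (s≤s l)) = inj₂ (zero , λ { (k ∷ m) p → p ∷ deg-zero-divides g m (ℕₚ.n≤0⇒n≡0 l) })
  deg-one-divides (suc (suc x) ∷ g) (s≤s (s≤s ()))

  -- A monomial inverse system: the standard monomials are to be the divisors of the listed ones.
  -- `pure` and `distinct` keep the listed monomials from dividing one another, `pure` makes the
  -- algebra level, and `covers` keeps the variables out of the ideal.
  record SocleData (r d : ℕ) : Set where
    field
      monomials : List (Vec ℕ r)
      count     : length monomials ≡ d
      degree    : ℕ
      pure      : All (λ m → deg m ≡ degree) monomials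
      distinct  : Unique monomials
      covers    : ∀ i → Any (λ m → 1 ≤ lookup m i) monomials
      nonempty  : ∃ λ m → m ∈ monomials

    Divides : Vec ℕ r → Set
    Divides b = Any (b ∣ₘ_) monomials

    divides? : ∀ b → Dec (Divides b)
    divides? b = Any.any? (b ∣ₘ?_) monomials

    gens : Gens r
    gens = filter (λ b → ¬? (divides? b)) (cube r (suc degree))

    divides⇒standard : ∀ b → Divides b → Standard gens b
    divides⇒standard b bm b∈I with find b∈I
    ... | g , g∈ , g∣b = proj₂ (∈-filter⁻ (λ b → ¬? (divides? b)) {xs = cube r (suc degree)} g∈) (Any.map (∣ₘ-trans g∣b) bm)

    standard⇒divides : ∀ b → Standard gens b → Divides b
    standard⇒divides b std = decidable-stable (divides? b) (λ ¬bm → std (lose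
      (∈-filter⁺ (λ b → ¬? (divides? b)) (∈-cube (cap-bounded (suc degree) b)) (λ capped → ¬bm (uncap capped))) (cap-divides (suc degree) b)))
      where
      uncap : Divides (cap (suc degree) b) → Divides b
      uncap capped with find capped
      ... | m , m∈ , l = lose m∈ (cap-reflects (suc degree) b m (s≤s (ℕₚ.≤-reflexive (All.lookup pure m∈))) l)

    noLinearForms : NoLinearForms gens
    noLinearForms = All.tabulate λ {g} g∈ → ℕₚ.≮⇒≥ λ small → proj₂ (∈-filter⁻ (λ b → ¬? (divides? b)) {xs = cube r (suc degree)} g∈) (found g (deg-one-divides g small))
      where
      found : ∀ g → (∀ m → g ∣ₘ m) ⊎ (∃ λ i → ∀ m → 1 ≤ lookup m i → g ∣ₘ m) → Divides g
      found g (inj₁ h)       = lose (proj₂ nonempty) (h (proj₁ nonempty))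
      found g (inj₂ (i , h)) = Any.map (λ {m} → h m) (covers i)

    artinian : Artinian gens
    artinian = suc degree , λ b l → decidable-stable (Any.any? (_∣ₘ? b) gens) (λ std → tooLarge b l (standard⇒divides b std))
      where
      tooLarge : ∀ b → suc degree ≤ deg b → ¬ Divides b
      tooLarge b l bm with find bm
      ... | m , m∈ , d = ℕₚ.<-irrefl ≡.refl (ℕₚ.≤-trans l (ℕₚ.≤-trans (deg-mono d) (ℕₚ.≤-reflexive (All.lookup pure m∈))))

    maximal : ∀ {m} → m ∈ monomials → Maximal gens m
    maximal {m} m∈ = divides⇒standard m (lose m∈ ∣ₘ-refl) , λ i std → above i (standard⇒divides (bump i m) std)
      where
      above : ∀ i → ¬ Divides (bump i m)
      above i bm with find bm
      ... | m′ , m′∈ , l = ℕₚ.<-irrefl ≡.refl (ℕₚ.≤-trans (ℕₚ.≤-reflexive (≡.trans (≡.cong suc (≡.sym (All.lookup pure m∈))) (≡.sym (deg-bump i m))))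
                             (ℕₚ.≤-trans (deg-mono l) (ℕₚ.≤-reflexive (All.lookup pure m′∈))))

    module _ {c ℓ} (K : Field c ℓ) where
      open Field K hiding (zero)
      open Algebra K gens
      open Socle K gens
      open OverField K using (sumFin-cong)

      -- Such a `b` is a proper divisor of a listed monomial, so its product with some xᵢ is still
      -- standard; the coefficient of xᵢ f there is the one of `f` at `b`.
      socle-vanishes : ∀ f → InSocle f → ∀ b → Standard gens b → ¬ (b ∈ monomials) → f b ≈ 0#
      socle-vanishes f soc b std b∉ with find (standard⇒divides b std)
      ... | m , m∈ , bm with proper-divisor b m bm (λ { ≡.refl → b∉ m∈ })
      ...   | i , up = trans (sym at-bump) (soc i (bump i b) (divides⇒standard _ (lose m∈ up)))
        where
        at-bump : mulVar i f (bump i b) ≈ f b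
        at-bump with lookup (bump i b) i in eq
        ... | zero  = contradiction (≡.trans (≡.sym eq) (lookup∘update i b (suc (lookup b i)))) λ ()
        ... | suc n = reflexive (≡.cong f (≡.trans (≡.cong (bump i b [ i ]≔_) (ℕₚ.suc-injective (≡.trans (≡.sym eq) (lookup∘update i b (suc (lookup b i)))))) (bump-lower i b)))

      sumFin-zero : ∀ n (t : Fin n → Carrier) → (∀ i → t i ≈ 0#) → sumFin K n t ≈ 0#
      sumFin-zero zero    t z = refl
      sumFin-zero (suc n) t z = trans (+-cong (z zero) (sumFin-zero n _ (λ i → z (suc i)))) (+-identityʳ 0#)

      sumFin-single : ∀ n (t : Fin n → Carrier) k → (∀ i → i ≢ k → t i ≈ 0#) → sumFin K n t ≈ t k
      sumFin-single (suc n) t zero    z = trans (+-congˡ (sumFin-zero n _ (λ i → z (suc i) (λ ())))) (+-identityʳ _)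
      sumFin-single (suc n) t (suc k) z = trans (+-cong (z zero (λ ())) (sumFin-single n _ k (λ i ne → z (suc i) (λ { ≡.refl → ne ≡.refl })))) (+-identityˡ _)

      basis : Fin (length monomials) → Elt
      basis k = δᴷ (List.lookup monomials k)

      lin-at : ∀ a k → lin a basis (List.lookup monomials k) ≈ a k
      lin-at a k = trans (sumFin-single (length monomials) (λ i → a i * basis i (List.lookup monomials k)) k (λ i ne → trans (*-congˡ (δᴷ-≢ (List.lookup monomials i) (List.lookup monomials k) (λ e → ne (lookup-injective distinct i k e)))) (zeroʳ _)))
        (trans (*-congˡ (δᴷ-refl (List.lookup monomials k))) (*-identityʳ _))

      socleDim : SocleDim (length monomials)
      socleDim = basis , (λ k → maximal⇒socle _ (maximal (∈-lookup k))) ,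
        (λ a z k → trans (sym (lin-at a k)) (z _ (proj₁ (maximal (∈-lookup k))))) ,
        λ f soc → (λ k → f (List.lookup monomials k)) , λ b std → spans f soc b std (Any.any? (≡-dec ℕ._≟_ b) monomials)
        where
        spans : ∀ f → InSocle f → ∀ b → Standard gens b → Dec (b ∈ monomials) → f b ≈ lin (λ k → f (List.lookup monomials k)) basis b
        spans f soc b std (yes b∈) = trans (reflexive (≡.cong f (lookup-index b∈))) (trans (sym (lin-at _ (Any.index b∈)))
          (reflexive (≡.cong (lin (λ k → f (List.lookup monomials k)) basis) (≡.sym (lookup-index b∈)))))
        spans f soc b std (no b∉) = trans (socle-vanishes f soc b std b∉) (sym (sumFin-zero (length monomials) (λ k → f (List.lookup monomials k) * basis k b) (λ k →
          trans (*-congˡ (δᴷ-≢ (List.lookup monomials k) b (λ { ≡.refl → b∉ (∈-lookup k) }))) (zeroʳ _))))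

      isLevelAlgebra : MonomialArtinianLevel K r d gens
      isLevelAlgebra = noLinearForms , artinian , ≡.subst SocleDim count socleDim , degree ,
        λ f soc b std ne → socle-vanishes f soc b std (λ b∈ → ne (All.lookup pure b∈))

-- Failure of maximal rank for every linear form, from witnesses for the sum of the variables.

module Obstructions where
  open IntegerOperators using (Fn; E; D; E^; D^; prev; δ; δ-refl; δ-≢; D-suc; ∣ₘ-refl; ∣ₘ-trans)
  open Enumerations using (standard?; standard-downClosed; entries≤deg; _∣ₘ?_)
  open FieldTransfer using (module OverField)
  open CompleteIntersections using (_⊝_)
  open TwoVariables using (D^-above)
  open LevelAlgebras using (bump)

  -- Witnesses that maximal rank fails for L = x₁ + ⋯ + xᵣ only; not-maxRank below extends the failure to every L.
  record Obstruction {r} (P : Vec ℕ r → Set) (s j : ℕ) : Set where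
    field
      kernel            : Fn r
      kernel-degree     : ∀ b → deg b ≢ j → kernel b ≡ + 0
      kernel-killed     : ∀ b → P b → E^ s kernel b ≡ + 0
      kernel-at         : Vec ℕ r
      kernel-at-P       : P kernel-at
      kernel≢0          : kernel kernel-at ≢ + 0
      functional        : Fn r
      functional-supp   : ∀ b → ¬ P b → functional b ≡ + 0
      functional-degree : ∀ b → deg b ≢ j ℕ.+ s → functional b ≡ + 0
      functional-killed : ∀ b → P b → D^ s functional b ≡ + 0
      functional-at     : Vec ℕ r
      functional≢0      : functional functional-at ≢ + 0

  constant : ∀ r → ℕ → Vec ℕ r
  constant r M = Vec.replicate r M

  ⊝-bump : ∀ {r} (M b : Vec ℕ r) i → bump i b ∣ₘ M → M ⊝ b ≡ bump i (M ⊝ bump i b)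
  ⊝-bump (k ∷ M) (x ∷ b) zero    (l ∷ ls) = ≡.cong (_∷ M ⊝ b) (ℕₚ.+-∸-assoc 1 l)
  ⊝-bump (k ∷ M) (x ∷ b) (suc i) (l ∷ ls) = ≡.cong (k ∸ x ∷_) (⊝-bump M b i ls)

  bounded⇒divides : ∀ {r} M (b : Vec ℕ r) → VAll.All (_≤ M) b → b ∣ₘ constant r M
  bounded⇒divides M []      VAll.[]       = []
  bounded⇒divides M (x ∷ b) (l VAll.∷ ls) = l ∷ bounded⇒divides M b ls

  module Pencil {c ℓ} (K : Field c ℓ) where
    open Field K hiding (zero)
    open OverField K
    open import Relation.Binary.Reasoning.Setoid setoid
    open import Algebra.Solver.Ring.NaturalCoefficients.Default commutativeSemiring using (solve; _:=_; _:+_; _:*_)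

    Eᴸ-zero : ∀ {r} L (b : Vec ℕ r) → Eᴸ L (λ _ → 0#) b ≈ 0#
    Eᴸ-zero L []          = refl
    Eᴸ-zero L (zero ∷ b)  = trans (+-cong (zeroʳ _) (Eᴸ-zero _ b)) (+-identityʳ 0#)
    Eᴸ-zero L (suc x ∷ b) = trans (+-cong (zeroʳ _) (Eᴸ-zero _ b)) (+-identityʳ 0#)

    Dᴸ : ∀ {r} → (Fin r → Carrier) → Fnᴷ r → Fnᴷ r
    Dᴸ L f []      = 0#
    Dᴸ L f (x ∷ b) = L zero * f (suc x ∷ b) + Dᴸ (λ i → L (suc i)) (λ b′ → f (x ∷ b′)) b

    Dᴸ^ : ∀ {r} → (Fin r → Carrier) → ℕ → Fnᴷ r → Fnᴷ r
    Dᴸ^ L zero    f = f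
    Dᴸ^ L (suc s) f = Dᴸ^ L s (Dᴸ L f)

    Dᴸ-cong : ∀ {r} L {f g : Fnᴷ r} → (∀ b → f b ≈ g b) → ∀ b → Dᴸ L f b ≈ Dᴸ L g b
    Dᴸ-cong L eq []      = refl
    Dᴸ-cong L eq (x ∷ b) = +-cong (*-congˡ (eq (suc x ∷ b))) (Dᴸ-cong _ (λ b′ → eq (x ∷ b′)) b)

    Dᴸ^-cong : ∀ {r} L s {f g : Fnᴷ r} → (∀ b → f b ≈ g b) → ∀ b → Dᴸ^ L s f b ≈ Dᴸ^ L s g b
    Dᴸ^-cong L zero    eq = eq
    Dᴸ^-cong L (suc s) eq = Dᴸ^-cong L s (Dᴸ-cong L eq)

    Dᴸ-zero : ∀ {r} L (b : Vec ℕ r) → Dᴸ L (λ _ → 0#) b ≈ 0#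
    Dᴸ-zero L []      = refl
    Dᴸ-zero L (x ∷ b) = trans (+-cong (zeroʳ _) (Dᴸ-zero _ b)) (+-identityʳ 0#)

    -- Polynomials in one variable t over K, as coefficient sequences; mulLin l is multiplication by l + t.
    mulLin : Carrier → (ℕ → Carrier) → ℕ → Carrier
    mulLin l p k = l * p k + prevᴷ p k

    mulLin-cong : ∀ l {p q} → (∀ k → p k ≈ q k) → ∀ k → mulLin l p k ≈ mulLin l q k
    mulLin-cong l eq zero    = +-congʳ (*-congˡ (eq 0))
    mulLin-cong l eq (suc k) = +-cong (*-congˡ (eq (suc k))) (eq k)

    mulLin-comm : ∀ a b p k → mulLin a (mulLin b p) k ≈ mulLin b (mulLin a p) k
    mulLin-comm a b p zero = +-congʳ (trans (*-congˡ (+-identityʳ _)) (trans (swap a b (p 0)) (*-congˡ (sym (+-identityʳ _)))))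
      where
      swap : ∀ a b x → a * (b * x) ≈ b * (a * x)
      swap = solve 3 (λ a b x → (a :* (b :* x)) := (b :* (a :* x))) refl
    mulLin-comm a b p (suc k) = go a b (p (suc k)) (p k) (prevᴷ p k)
      where
      go : ∀ a b x y z → a * (b * x + y) + (b * y + z) ≈ b * (a * x + y) + (a * y + z)
      go = solve 5 (λ a b x y z → ((a :* ((b :* x) :+ y)) :+ ((b :* y) :+ z)) := ((b :* ((a :* x) :+ y)) :+ ((a :* y) :+ z))) refl

    mulLin^ : ℕ → Carrier → (ℕ → Carrier) → ℕ → Carrier
    mulLin^ zero    l p = p
    mulLin^ (suc x) l p = mulLin l (mulLin^ x l p)

    one : ℕ → Carrier
    one zero    = 1#
    one (suc k) = 0#

    -- pw L b is the polynomial ∏ᵢ (Lᵢ + t)^bᵢ.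
    pw : ∀ {r} → (Fin r → Carrier) → Vec ℕ r → ℕ → Carrier
    pw L []      = one
    pw L (x ∷ b) = mulLin^ x (L zero) (pw (λ i → L (suc i)) b)

    Step : ∀ {r} → (Fin r → Carrier) → (Vec ℕ r → ℕ → Carrier) → Set ℓ
    Step L Q = ∀ i b k → Q (bump i b) k ≈ mulLin (L i) (Q b) k

    step-mulLin^ : ∀ {r} L (Q : Vec ℕ r → ℕ → Carrier) a x → Step L Q → Step L (λ b → mulLin^ x a (Q b))
    step-mulLin^ L Q a zero    st i b k = st i b k
    step-mulLin^ L Q a (suc x) st i b k = trans (mulLin-cong a (step-mulLin^ L Q a x st i b) k) (mulLin-comm a (L i) _ k)

    step-pw : ∀ {r} L → Step {r} L (pw L)
    step-pw L zero    (x ∷ b) k = refl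
    step-pw L (suc i) (x ∷ b) k = step-mulLin^ (λ i → L (suc i)) (pw (λ i → L (suc i))) (L zero) x (step-pw (λ i → L (suc i))) i b k

    Monic : ℕ → (ℕ → Carrier) → Set ℓ
    Monic n p = (p n ≈ 1#) × (∀ k → n < k → p k ≈ 0#)

    monic-mulLin : ∀ n l p → Monic n p → Monic (suc n) (mulLin l p)
    monic-mulLin n l p (top , high) = trans (+-cong (trans (*-congˡ (high (suc n) (ℕₚ.n<1+n n))) (zeroʳ l)) top) (+-identityˡ 1#) ,
      λ { (suc k) (s≤s n<k) → trans (+-cong (trans (*-congˡ (high (suc k) (ℕₚ.m≤n⇒m≤1+n n<k))) (zeroʳ l)) (high k n<k)) (+-identityʳ 0#) }

    -- Read at the power `deg b` of t, a rescaled witness shows its original value at `b`, whatever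
    -- the coefficients of `L` are.
    monic-pw : ∀ {r} L (b : Vec ℕ r) → Monic (deg b) (pw L b)
    monic-pw L []      = refl , λ { (suc k) _ → refl }
    monic-pw L (x ∷ b) = go x
      where
      go : ∀ x → Monic (x ℕ.+ deg b) (mulLin^ x (L zero) (pw (λ i → L (suc i)) b))
      go zero    = monic-pw _ b
      go (suc x) = monic-mulLin _ (L zero) _ (go x)

    interleave : ∀ u v w x → (u + v) + (w + x) ≈ (u + w) + (v + x)
    interleave = solve 4 (λ u v w x → ((u :+ v) :+ (w :+ x)) := ((u :+ w) :+ (v :+ x))) refl

    prev-zero : ∀ (a : ℤ) → a ≡ + 0 → ∀ x → ι a * x ≈ 0#
    prev-zero a ≡.refl x = zeroˡ x

    scaled-mulLin : ∀ l a (p : ℕ → Carrier) k → l * (a * p k) + 1# * prevᴷ (λ k → a * p k) k ≈ a * mulLin l p k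
    scaled-mulLin l a p zero = trans (+-cong (go l a (p 0)) (zeroʳ 1#)) (trans (+-identityʳ _) (*-congˡ (sym (+-identityʳ _))))
      where
      go : ∀ l a x → l * (a * x) ≈ a * (l * x)
      go = solve 3 (λ l a x → (l :* (a :* x)) := (a :* (l :* x))) refl
    scaled-mulLin l a p (suc k) = trans (+-congˡ (*-identityˡ _)) (go l a (p (suc k)) (p k))
      where
      go : ∀ l a x y → l * (a * x) + a * y ≈ a * (l * x + y)
      go = solve 4 (λ l a x y → ((l :* (a :* x)) :+ (a :* y)) := (a :* ((l :* x) :+ y))) refl

    -- Rescaling the variables turns a kernel element for x₁ + ⋯ + xᵣ into one for Σ (Lᵢ + t) xᵢ, here coefficientwise in t.
    E-pencil : ∀ {r} L (Q : Vec ℕ r → ℕ → Carrier) → Step L Q → ∀ (c : Fn r) k b →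
      Eᴸ L (λ b → ι (c b) * Q b k) b + Eᴸ ones (λ b → prevᴷ (λ k → ι (c b) * Q b k) k) b ≈ ι (E c b) * Q b k
    E-pencil L Q st c k [] = trans (+-identityʳ 0#) (sym (zeroˡ _))
    E-pencil L Q st c k (x ∷ b) = begin
        (L zero * prevᴷ (λ y → ι (c (y ∷ b)) * Q (y ∷ b) k) x + _) + (1# * prevᴷ (λ y → prevᴷ (λ k → ι (c (y ∷ b)) * Q (y ∷ b) k) k) x + _)
          ≈⟨ interleave _ _ _ _ ⟩
        (L zero * prevᴷ (λ y → ι (c (y ∷ b)) * Q (y ∷ b) k) x + 1# * prevᴷ (λ y → prevᴷ (λ k → ι (c (y ∷ b)) * Q (y ∷ b) k) k) x) + (_ + _)
          ≈⟨ +-cong (head x) (E-pencil (λ i → L (suc i)) (λ b → Q (x ∷ b)) (λ i b → st (suc i) (x ∷ b)) (λ b → c (x ∷ b)) k b) ⟩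
        ι (prev (λ y → c (y ∷ b)) x) * Q (x ∷ b) k + ι (E (λ b → c (x ∷ b)) b) * Q (x ∷ b) k
          ≈⟨ distribʳ _ _ _ ⟨
        (ι (prev (λ y → c (y ∷ b)) x) + ι (E (λ b → c (x ∷ b)) b)) * Q (x ∷ b) k
          ≈⟨ *-congʳ (ι-+ (prev (λ y → c (y ∷ b)) x) (E (λ b → c (x ∷ b)) b)) ⟨
        ι (E c (x ∷ b)) * Q (x ∷ b) k ∎
      where
      head : ∀ x → L zero * prevᴷ (λ y → ι (c (y ∷ b)) * Q (y ∷ b) k) x + 1# * prevᴷ (λ y → prevᴷ (λ k → ι (c (y ∷ b)) * Q (y ∷ b) k) k) x
        ≈ ι (prev (λ y → c (y ∷ b)) x) * Q (x ∷ b) k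
      head zero    = trans (+-cong (zeroʳ _) (zeroʳ _)) (trans (+-identityʳ 0#) (sym (zeroˡ _)))
      head (suc y) = trans (scaled-mulLin (L zero) (ι (c (y ∷ b))) (Q (y ∷ b)) k) (*-congˡ (sym (st zero (y ∷ b) k)))

    -- A functional rescales by the inverse factors. After multiplication by the product of all (Lᵢ
    -- + t)^Mᵢ these become the polynomials `pw L (M ⊝ b)`, for `b` dividing `M`.
    CoStep : ∀ {r} → Vec ℕ r → (Fin r → Carrier) → (Vec ℕ r → ℕ → Carrier) → Set ℓ
    CoStep M L Q = ∀ i b k → bump i b ∣ₘ M → Q b k ≈ mulLin (L i) (Q (bump i b)) k

    D-pencil : ∀ {r} M L (Q : Vec ℕ r → ℕ → Carrier) → CoStep M L Q → ∀ (c : Fn r) → (∀ b → ¬ (b ∣ₘ M) → c b ≡ + 0) → ∀ k b → b ∣ₘ M →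
      Dᴸ L (λ b → ι (c b) * Q b k) b + Dᴸ ones (λ b → prevᴷ (λ k → ι (c b) * Q b k) k) b ≈ ι (D c b) * Q b k
    D-pencil [] L Q st c supp k [] [] = trans (+-identityʳ 0#) (sym (zeroˡ _))
    D-pencil (m ∷ M) L Q st c supp k (x ∷ b) (xm ∷ bM) = begin
        (L zero * (ι (c (suc x ∷ b)) * Q (suc x ∷ b) k) + _) + (1# * prevᴷ (λ k → ι (c (suc x ∷ b)) * Q (suc x ∷ b) k) k + _)
          ≈⟨ interleave _ _ _ _ ⟩
        (L zero * (ι (c (suc x ∷ b)) * Q (suc x ∷ b) k) + 1# * prevᴷ (λ k → ι (c (suc x ∷ b)) * Q (suc x ∷ b) k) k) + (_ + _)
          ≈⟨ +-cong head (D-pencil M (λ i → L (suc i)) (λ b → Q (x ∷ b)) (λ i b k l → st (suc i) (x ∷ b) k (xm ∷ l)) (λ b → c (x ∷ b)) (λ b ¬l → supp (x ∷ b) (λ { (_ ∷ l) → ¬l l })) k b bM) ⟩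
        ι (c (suc x ∷ b)) * Q (x ∷ b) k + ι (D (λ b → c (x ∷ b)) b) * Q (x ∷ b) k
          ≈⟨ distribʳ _ _ _ ⟨
        (ι (c (suc x ∷ b)) + ι (D (λ b → c (x ∷ b)) b)) * Q (x ∷ b) k
          ≈⟨ *-congʳ (ι-+ (c (suc x ∷ b)) (D (λ b → c (x ∷ b)) b)) ⟨
        ι (D c (x ∷ b)) * Q (x ∷ b) k ∎
      where
      head : L zero * (ι (c (suc x ∷ b)) * Q (suc x ∷ b) k) + 1# * prevᴷ (λ k → ι (c (suc x ∷ b)) * Q (suc x ∷ b) k) k ≈ ι (c (suc x ∷ b)) * Q (x ∷ b) k
      head with suc x ℕ.≤? m
      ... | yes l = trans (scaled-mulLin (L zero) (ι (c (suc x ∷ b))) (Q (suc x ∷ b)) k) (*-congˡ (sym (st zero (x ∷ b) k (l ∷ bM))))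
      ... | no ¬l = trans (scaled-mulLin (L zero) (ι (c (suc x ∷ b))) (Q (suc x ∷ b)) k) (trans (vanish _) (sym (vanish _)))
        where
        vanish : ∀ y → ι (c (suc x ∷ b)) * y ≈ 0#
        vanish y = prev-zero (c (suc x ∷ b)) (supp (suc x ∷ b) (λ { (l ∷ _) → ¬l l })) y

    Dᴸ-above : ∀ {r} L (f : Fnᴷ r) b → (∀ b′ → b ∣ₘ b′ → f b′ ≈ 0#) → Dᴸ L f b ≈ 0#
    Dᴸ-above L f []      z = refl
    Dᴸ-above L f (x ∷ b) z = trans (+-cong (trans (*-congˡ (z (suc x ∷ b) (ℕₚ.n≤1+n x ∷ ∣ₘ-refl))) (zeroʳ _)) (Dᴸ-above _ (λ b′ → f (x ∷ b′)) b (λ b′ l → z (x ∷ b′) (ℕₚ.≤-refl ∷ l)))) (+-identityʳ 0#)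

    sumBelow : ℕ → (ℕ → Carrier) → Carrier
    sumBelow zero    t = 0#
    sumBelow (suc M) t = sumBelow M t + t M

    sumBelow-cong : ∀ M {t t′} → (∀ x → t x ≈ t′ x) → sumBelow M t ≈ sumBelow M t′
    sumBelow-cong zero    eq = refl
    sumBelow-cong (suc M) eq = +-cong (sumBelow-cong M eq) (eq M)

    sumBelow-+ : ∀ M t t′ → sumBelow M (λ x → t x + t′ x) ≈ sumBelow M t + sumBelow M t′
    sumBelow-+ zero    t t′ = sym (+-identityʳ 0#)
    sumBelow-+ (suc M) t t′ = trans (+-congʳ (sumBelow-+ M t t′)) (interleave _ _ _ _)

    sumBelow-scale : ∀ M l t → sumBelow M (λ x → l * t x) ≈ l * sumBelow M t
    sumBelow-scale zero    l t = sym (zeroʳ l)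
    sumBelow-scale (suc M) l t = trans (+-congʳ (sumBelow-scale M l t)) (sym (distribˡ l _ _))

    sumBelow-zero : ∀ M t → (∀ x → x < M → t x ≈ 0#) → sumBelow M t ≈ 0#
    sumBelow-zero zero    t z = refl
    sumBelow-zero (suc M) t z = trans (+-cong (sumBelow-zero M t (λ x l → z x (ℕₚ.m≤n⇒m≤1+n l))) (z M (ℕₚ.n<1+n M))) (+-identityʳ 0#)

    sumBelow-single : ∀ M t y → y < M → (∀ x → x ≢ y → t x ≈ 0#) → sumBelow M t ≈ t y
    sumBelow-single (suc M) t y l z with y ℕ.≟ M
    ... | yes ≡.refl = trans (+-congʳ (sumBelow-zero M t (λ x x<M → z x (ℕₚ.<⇒≢ x<M)))) (+-identityˡ _)
    ... | no ne      = trans (+-cong (sumBelow-single M t y (ℕₚ.≤∧≢⇒< (ℕₚ.≤-pred l) ne) z) (z M (λ e → ne (≡.sym e)))) (+-identityʳ _)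

    sumBelow-shift : ∀ M t t′ → t 0 ≈ 0# → (∀ x → t (suc x) ≈ t′ x) → sumBelow (suc M) t ≈ sumBelow M t′
    sumBelow-shift zero    t t′ z eq = trans (+-identityˡ _) z
    sumBelow-shift (suc M) t t′ z eq = +-cong (sumBelow-shift M t t′ z eq) (eq M)

    total : ∀ {r} → ℕ → Fnᴷ r → Carrier
    total {zero}  M h = h []
    total {suc r} M h = sumBelow M (λ x → total M (λ b → h (x ∷ b)))

    total-cong : ∀ {r} M {h h′ : Fnᴷ r} → (∀ b → h b ≈ h′ b) → total M h ≈ total M h′
    total-cong {zero}  M eq = eq []
    total-cong {suc r} M eq = sumBelow-cong M (λ x → total-cong M (λ b → eq (x ∷ b)))

    total-+ : ∀ {r} M (h h′ : Fnᴷ r) → total M (λ b → h b + h′ b) ≈ total M h + total M h′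
    total-+ {zero}  M h h′ = refl
    total-+ {suc r} M h h′ = trans (sumBelow-cong M (λ x → total-+ M (λ b → h (x ∷ b)) (λ b → h′ (x ∷ b)))) (sumBelow-+ M _ _)

    total-scale : ∀ {r} M l (h : Fnᴷ r) → total M (λ b → l * h b) ≈ l * total M h
    total-scale {zero}  M l h = refl
    total-scale {suc r} M l h = trans (sumBelow-cong M (λ x → total-scale M l (λ b → h (x ∷ b)))) (sumBelow-scale M l _)

    total-zero : ∀ {r} M (h : Fnᴷ r) → (∀ b → h b ≈ 0#) → total M h ≈ 0#
    total-zero {zero}  M h z = z []
    total-zero {suc r} M h z = sumBelow-zero M _ (λ x _ → total-zero M _ (λ b → z (x ∷ b)))

    total-single : ∀ {r} M (h : Fnᴷ r) b → VAll.All (_< M) b → (∀ b′ → b′ ≢ b → h b′ ≈ 0#) → total M h ≈ h b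
    total-single M h []      VAll.[]       z = refl
    total-single M h (x ∷ b) (l VAll.∷ ls) z = trans (sumBelow-single M _ x l (λ y y≢x → total-zero M _ (λ b′ → z (y ∷ b′) (λ { ≡.refl → y≢x ≡.refl }))))
      (total-single M (λ b′ → h (x ∷ b′)) b ls (λ b′ ne → z (x ∷ b′) (λ { ≡.refl → ne ≡.refl })))

    Bounded : ∀ {r} → ℕ → Fnᴷ r → Set ℓ
    Bounded M φ = ∀ b → ¬ VAll.All (_< M) b → φ b ≈ 0#

    -- Summation by parts over the cube [0, M)^r, one variable at a time; `Bounded` removes the
    -- boundary terms.
    adjoint : ∀ {r} M L (φ g : Fnᴷ r) → Bounded M φ → total M (λ b → φ b * Eᴸ L g b) ≈ total M (λ b → Dᴸ L φ b * g b)
    adjoint {zero}  M L φ g bd = trans (zeroʳ _) (sym (zeroˡ _))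
    adjoint {suc r} M L φ g bd = begin
      sumBelow M (λ x → total M (λ b → φ (x ∷ b) * (L zero * prevᴷ (λ y → g (y ∷ b)) x + Eᴸ L′ (λ b′ → g (x ∷ b′)) b)))
        ≈⟨ sumBelow-cong M (λ x → trans (total-cong M (λ b → expand (φ (x ∷ b)) (L zero) _ _)) (trans (total-+ M (λ b → L zero * (φ (x ∷ b) * prevᴷ (λ y → g (y ∷ b)) x)) (λ b → φ (x ∷ b) * Eᴸ L′ (λ b′ → g (x ∷ b′)) b)) (+-cong (total-scale M (L zero) (λ b → φ (x ∷ b) * prevᴷ (λ y → g (y ∷ b)) x))
             (adjoint M L′ (λ b → φ (x ∷ b)) (λ b → g (x ∷ b)) (λ b ¬l → bd (x ∷ b) (λ { (_ VAll.∷ ls) → ¬l ls })))))) ⟩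
      sumBelow M (λ x → L zero * A x + B x)
        ≈⟨ trans (sumBelow-+ M _ _) (+-congʳ (sumBelow-scale M (L zero) A)) ⟩
      L zero * sumBelow M A + sumBelow M B
        ≈⟨ +-congʳ (*-congˡ (moved M bd)) ⟩
      L zero * sumBelow M A′ + sumBelow M B
        ≈⟨ trans (sumBelow-+ M _ _) (+-congʳ (sumBelow-scale M (L zero) A′)) ⟨
      sumBelow M (λ x → L zero * A′ x + B x)
        ≈⟨ sumBelow-cong M (λ x → trans (total-cong M (λ b → expand′ (L zero) (φ (suc x ∷ b)) _ (g (x ∷ b)))) (trans (total-+ M (λ b → L zero * (φ (suc x ∷ b) * g (x ∷ b))) (λ b → Dᴸ L′ (λ b′ → φ (x ∷ b′)) b * g (x ∷ b))) (+-congʳ (total-scale M (L zero) (λ b → φ (suc x ∷ b) * g (x ∷ b)))))) ⟨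
      sumBelow M (λ x → total M (λ b → (L zero * φ (suc x ∷ b) + Dᴸ L′ (λ b′ → φ (x ∷ b′)) b) * g (x ∷ b))) ∎
      where
      L′ : Fin r → Carrier
      L′ i = L (suc i)
      A A′ B : ℕ → Carrier
      A  x = total M (λ b → φ (x ∷ b) * prevᴷ (λ y → g (y ∷ b)) x)
      A′ x = total M (λ b → φ (suc x ∷ b) * g (x ∷ b))
      B  x = total M (λ b → Dᴸ L′ (λ b′ → φ (x ∷ b′)) b * g (x ∷ b))
      expand : ∀ f l x y → f * (l * x + y) ≈ l * (f * x) + f * y
      expand = solve 4 (λ f l x y → (f :* ((l :* x) :+ y)) := ((l :* (f :* x)) :+ (f :* y))) refl
      expand′ : ∀ l f d x → (l * f + d) * x ≈ l * (f * x) + d * x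
      expand′ = solve 4 (λ l f d x → (((l :* f) :+ d) :* x) := ((l :* (f :* x)) :+ (d :* x))) refl
      moved : ∀ N → Bounded N φ → sumBelow N A ≈ sumBelow N A′
      moved zero    bd = refl
      moved (suc N) bd = trans (sumBelow-shift N A A′ (total-zero M (λ b → φ (zero ∷ b) * 0#) (λ b → zeroʳ _)) (λ x → refl))
        (trans (sym (+-identityʳ _)) (+-congˡ (sym (total-zero M (λ b → φ (suc N ∷ b) * g (N ∷ b)) (λ b → trans (*-congʳ (bd (suc N ∷ b) (λ { (l VAll.∷ _) → ℕₚ.<-irrefl ≡.refl l }))) (zeroˡ _))))))

    Dᴸ-bounded : ∀ {r} M L (φ : Fnᴷ r) → Bounded M φ → Bounded M (Dᴸ L φ)
    Dᴸ-bounded M L φ bd b ¬l = Dᴸ-above L φ b (λ b′ bb′ → bd b′ (λ l → ¬l (below bb′ l)))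
      where
      below : ∀ {r} {b b′ : Vec ℕ r} → b ∣ₘ b′ → VAll.All (_< M) b′ → VAll.All (_< M) b
      below []       VAll.[]       = VAll.[]
      below (x ∷ xs) (l VAll.∷ ls) = ℕₚ.≤-trans (s≤s x) l VAll.∷ below xs ls

    adjoint^ : ∀ {r} M L s (φ g : Fnᴷ r) → Bounded M φ → total M (λ b → φ b * Eᴸ^ L s g b) ≈ total M (λ b → Dᴸ^ L s φ b * g b)
    adjoint^ M L zero    φ g bd = refl
    adjoint^ M L (suc s) φ g bd = trans (adjoint M L φ (Eᴸ^ L s g) bd) (adjoint^ M L s (Dᴸ L φ) g (Dᴸ-bounded M L φ bd))

    module _ (char0 : CharZero K) {r} (gs : Gens r) {s j} (ob : Obstruction (Standard gs) s j) (L : Fin r → Carrier) where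
      open Algebra K gs
      open Obstruction ob
      private
        Std : Vec ℕ r → Set
        Std = Standard gs

      G : ℕ → ℕ → Fnᴷ r
      G i k b = ι (E^ i kernel b) * pw L b k

      VanishBelow : ℕ → ℕ → Set ℓ
      VanishBelow i k = ∀ k′ → k′ < k → ∀ b → Std b → G i k′ b ≈ 0#

      previous-vanishes : ∀ i k → VanishBelow i k → ∀ b → Std b → prevᴷ (λ k → G i k b) k ≈ 0#
      previous-vanishes i zero    z b std = refl
      previous-vanishes i (suc k) z b std = z k (ℕₚ.n<1+n k) b std

      Eᴸ-vanish : ∀ L f → (∀ b → Std b → f b ≈ 0#) → ∀ b → Std b → Eᴸ L f b ≈ 0#
      Eᴸ-vanish L f z b std = trans (Eᴸ-cong-on {P = Std} L (standard-downClosed gs) z b std) (Eᴸ-zero L b)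

      vanish-below : ∀ k → VanishBelow 0 k → ∀ i → VanishBelow i k
      vanish-below k z zero    = z
      vanish-below k z (suc i) k′ k′<k b std = trans (sym (E-pencil L (pw L) (step-pw L) (E^ i kernel) k′ b))
        (trans (+-cong (Eᴸ-vanish L (G i k′) (λ b std → vanish-below k z i k′ k′<k b std) b std)
          (Eᴸ-vanish ones _ (previous-vanishes i k′ (λ k″ l → vanish-below k z i k″ (ℕₚ.<-trans l k′<k))) b std)) (+-identityʳ 0#))

      -- The lowest coefficient in t is killed by Lˢ itself; were Lˢ injective, all coefficients would vanish.
      lowest-order : ∀ k → VanishBelow 0 k → ∀ i b → Std b → Eᴸ^ L i (G 0 k) b ≈ G i k b
      lowest-order k z zero    b std = refl
      lowest-order k z (suc i) b std = begin
        Eᴸ L (Eᴸ^ L i (G 0 k)) b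
          ≈⟨ Eᴸ-cong-on {P = Std} L (standard-downClosed gs) (lowest-order k z i) b std ⟩
        Eᴸ L (G i k) b
          ≈⟨ +-identityʳ _ ⟨
        Eᴸ L (G i k) b + 0#
          ≈⟨ +-congˡ (Eᴸ-vanish ones _ (previous-vanishes i k (vanish-below k z i)) b std) ⟨
        Eᴸ L (G i k) b + Eᴸ ones (λ b → prevᴷ (λ k → G i k b) k) b
          ≈⟨ E-pencil L (pw L) (step-pw L) (E^ i kernel) k b ⟩
        G (suc i) k b ∎

      not-injective : ¬ Injective L s j
      not-injective inj = ι-≢0 char0 (kernel kernel-at) kernel≢0 (trans (sym (*-identityʳ _)) (trans (*-congˡ (sym (proj₁ (monic-pw L kernel-at))))
          (all-vanish (deg kernel-at) kernel-at kernel-at-P)))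
        where
        all-vanish : ∀ k b → Std b → G 0 k b ≈ 0#
        all-vanish = <-rec (λ k → ∀ b → Std b → G 0 k b ≈ 0#) (λ k rec → inj (G 0 k)
          (λ b std ne → prev-zero (kernel b) (kernel-degree b ne) _)
          (λ b std → trans (mulLPow≈Eᴸ^ gs L s (G 0 k) b) (trans (lowest-order k (λ k′ l → rec l) s b std) (prev-zero (E^ s kernel b) (kernel-killed b std) _))))

      N : ℕ
      N = j ℕ.+ s

      -- Every monomial of degree `N` divides this one, so it bounds the support of `functional`.
      M : Vec ℕ r
      M = constant r N

      Q : Vec ℕ r → ℕ → Carrier
      Q b = pw L (M ⊝ b)

      coStep : CoStep M L Q
      coStep i b k l = trans (reflexive (≡.cong (λ v → pw L v k) (⊝-bump M b i l))) (step-pw L i (M ⊝ bump i b) k)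

      H : ℕ → ℕ → Fnᴷ r
      H i k b = ι (D^ i functional b) * Q b k

      functional-bounded : ∀ i b → ¬ (b ∣ₘ M) → D^ i functional b ≡ + 0
      functional-bounded i b ¬bM = D^-above i functional b (λ b′ bb′ → functional-degree b′ (λ e →
        ¬bM (∣ₘ-trans bb′ (bounded⇒divides N b′ (entries≤deg b′ (ℕₚ.≤-reflexive e))))))

      pencil : ∀ i k b → Dᴸ L (H i k) b + Dᴸ ones (λ b → prevᴷ (λ k → H i k b) k) b ≈ H (suc i) k b
      pencil i k b with b ∣ₘ? M
      ... | yes bM = trans (D-pencil M L Q coStep (D^ i functional) (functional-bounded i) k b bM)
                       (*-congʳ (reflexive (≡.cong ι (≡.sym (D-suc i functional b)))))
      ... | no ¬bM = trans (+-cong (Dᴸ-above L _ b (λ b′ l → zero-at k b′ l)) (Dᴸ-above ones _ b (λ b′ l → prev-at k b′ l)))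
                       (trans (+-identityʳ 0#) (sym (prev-zero (D^ (suc i) functional b) (functional-bounded (suc i) b ¬bM) _)))
        where
        zero-at : ∀ k b′ → b ∣ₘ b′ → H i k b′ ≈ 0#
        zero-at k b′ l = prev-zero (D^ i functional b′) (functional-bounded i b′ (λ d → ¬bM (∣ₘ-trans l d))) _
        prev-at : ∀ k b′ → b ∣ₘ b′ → prevᴷ (λ k → H i k b′) k ≈ 0#
        prev-at zero    b′ l = refl
        prev-at (suc k) b′ l = zero-at k b′ l

      CoVanishBelow : ℕ → ℕ → Set ℓ
      CoVanishBelow i k = ∀ k′ → k′ < k → ∀ b → H i k′ b ≈ 0#

      co-lowest-step : ∀ i k → CoVanishBelow i k → ∀ b → Dᴸ L (H i k) b ≈ H (suc i) k b
      co-lowest-step i k z b = trans (sym (+-identityʳ _)) (trans (+-congˡ (sym (trans (Dᴸ-cong ones (previous k z) b) (Dᴸ-zero ones b)))) (pencil i k b))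
        where
        previous : ∀ k → CoVanishBelow i k → ∀ b → prevᴷ (λ k → H i k b) k ≈ 0#
        previous zero    z b = refl
        previous (suc k) z b = z k (ℕₚ.n<1+n k) b

      co-vanish-below : ∀ i k → CoVanishBelow i k → CoVanishBelow (suc i) k
      co-vanish-below i k z k′ l b = trans (sym (co-lowest-step i k′ (λ k″ l′ → z k″ (ℕₚ.<-trans l′ l)) b))
        (trans (Dᴸ-cong L (z k′ l) b) (Dᴸ-zero L b))

      co-lowest-order : ∀ t i k → CoVanishBelow i k → ∀ b → Dᴸ^ L t (H i k) b ≈ H (t ℕ.+ i) k b
      co-lowest-order zero    i k z b = refl
      co-lowest-order (suc t) i k z b = trans (Dᴸ^-cong L t (co-lowest-step i k z) b)
        (trans (co-lowest-order t (suc i) k (co-vanish-below i k z) b) (reflexive (≡.cong (λ n → H n k b) (ℕₚ.+-suc t i))))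

      -- Pairing the lowest coefficient of the rescaled functional with a preimage of δ at `b` moves
      -- Lˢ onto the functional, which it kills; so that coefficient is zero at `b`. Strong
      -- induction on the power of t then reaches the leading coefficient, which is not zero.
      not-surjective : ¬ Surjective L s j
      not-surjective surj = ι-≢0 char0 (functional functional-at) functional≢0 (trans (sym (*-identityʳ _)) (trans (*-congˡ (sym (proj₁ (monic-pw L (M ⊝ functional-at)))))
          (all-vanish (deg (M ⊝ functional-at)) functional-at)))
        where
        killed-everywhere : ∀ a → D^ s functional a ≡ + 0
        killed-everywhere a with standard? gs a
        ... | yes std = functional-killed a std
        ... | no ¬std = D^-above s functional a (λ b ab → functional-supp b (λ std → ¬std (standard-downClosed gs ab std)))
        bounded : ∀ k → Bounded (suc N) (H 0 k)
        bounded k b ¬l = prev-zero (functional b) (functional-degree b (λ e → ¬l (VAll.map s≤s (entries≤deg b (ℕₚ.≤-reflexive e))))) _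
        hit : ∀ k → CoVanishBelow 0 k → ∀ b → Std b → deg b ≡ N → (Σ Elt λ f → InDeg j f × (mulLPow L s f ≈A (λ b′ → ι (δ b b′)))) → H 0 k b ≈ 0#
        hit k z b std e (f , _ , eq) = begin
          H 0 k b
            ≈⟨ trans (*-congˡ (trans (reflexive (≡.cong ι (δ-refl b))) ι-1)) (*-identityʳ _) ⟨
          H 0 k b * ι (δ b b)
            ≈⟨ total-single (suc N) (λ b′ → H 0 k b′ * ι (δ b b′)) b (VAll.map s≤s (entries≤deg b (ℕₚ.≤-reflexive e)))
                 (λ b′ ne → trans (*-congˡ (reflexive (≡.cong ι (δ-≢ b b′ (λ e → ne (≡.sym e)))))) (zeroʳ _)) ⟨
          total (suc N) (λ b′ → H 0 k b′ * ι (δ b b′))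
            ≈⟨ total-cong (suc N) agree ⟨
          total (suc N) (λ b′ → H 0 k b′ * Eᴸ^ L s f b′)
            ≈⟨ adjoint^ (suc N) L s (H 0 k) f (bounded k) ⟩
          total (suc N) (λ b′ → Dᴸ^ L s (H 0 k) b′ * f b′)
            ≈⟨ total-zero (suc N) (λ b′ → Dᴸ^ L s (H 0 k) b′ * f b′) (λ a → trans (*-congʳ (trans (co-lowest-order s 0 k z a) (prev-zero (D^ (s ℕ.+ 0) functional a)
                 (≡.trans (≡.cong (λ n → D^ n functional a) (ℕₚ.+-identityʳ s)) (killed-everywhere a)) _))) (zeroˡ _)) ⟩
          0# ∎
          where
          agree : ∀ b′ → H 0 k b′ * Eᴸ^ L s f b′ ≈ H 0 k b′ * ι (δ b b′)
          agree b′ with standard? gs b′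
          ... | yes std′ = *-congˡ (trans (sym (mulLPow≈Eᴸ^ gs L s f b′)) (eq b′ std′))
          ... | no ¬std′ = trans (trans (*-congʳ vanish) (zeroˡ _)) (sym (trans (*-congʳ vanish) (zeroˡ _)))
            where
            vanish : H 0 k b′ ≈ 0#
            vanish = prev-zero (functional b′) (functional-supp b′ ¬std′) _
        all-vanish : ∀ k b → H 0 k b ≈ 0#
        all-vanish = <-rec (λ k → ∀ b → H 0 k b ≈ 0#) (λ k rec b → go k (λ k′ l → rec l) b (standard? gs b) (deg b ℕ.≟ N))
          where
          go : ∀ k → CoVanishBelow 0 k → ∀ b → Dec (Std b) → Dec (deg b ≡ N) → H 0 k b ≈ 0#
          go k z b (no ¬std) _        = prev-zero (functional b) (functional-supp b ¬std) _
          go k z b (yes _)   (no ne)  = prev-zero (functional b) (functional-degree b ne) _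
          go k z b (yes std) (yes e)  = hit k z b std e (surj (λ b′ → ι (δ b b′)) (λ b′ _ ne → reflexive (≡.cong ι (δ-≢ b b′ (λ { ≡.refl → ne e })))))

      not-maxRank : ¬ MaxRank L s j
      not-maxRank (inj₁ inj)  = not-injective inj
      not-maxRank (inj₂ surj) = not-surjective surj

-- Failing algebras of type two.

module Examples where
  open import Data.Integer using (_+_; _*_; -_; _-_)
  open ℤSolver using (solve-∀)
  open ≡ using (refl; sym; trans; cong; cong₂)
  open Vecₚ using (∷-injectiveʳ)
  open Listₚ using (length-map)
  open IntegerOperators
  open Enumerations using (cube; ∈-cube; entries≤deg)
  open FieldTransfer using (E^-homogeneous)
  open CompleteIntersections using (D-homogeneous; D^-homogeneous; deg-mono)
  open TwoVariables using (D-above)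
  open LevelAlgebras using (SocleData)
  open Obstructions using (Obstruction; module Pencil)

  Example : ℕ → ℕ → ℕ → Set
  Example r d s = Σ (SocleData r d) λ sd → ∃ λ j → Obstruction (SocleData.Divides sd) s j

  example-obstructs : ∀ {c ℓ} (K : Field c ℓ) → CharZero K → ∀ {r d s} → Example r d s →
    Σ (Gens r) λ gs → MonomialArtinianLevel K r d gs × ∃ λ j → ∀ L → ¬ Algebra.MaxRank K gs L s j
  example-obstructs K char0 (sd , j , ob) = gens , isLevelAlgebra K , j , λ L → Pencil.not-maxRank K char0 gens standardised L
    where
    open SocleData sd
    open Obstruction ob
    standardised : Obstruction (Standard gens) _ j
    standardised = record
      { kernel = kernel
      ; kernel-degree = kernel-degree
      ; kernel-killed = λ b std → kernel-killed b (standard⇒divides b std)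
      ; kernel-at = kernel-at
      ; kernel-at-P = divides⇒standard kernel-at kernel-at-P
      ; kernel≢0 = kernel≢0
      ; functional = functional
      ; functional-supp = λ b ¬std → functional-supp b (λ d → ¬std (divides⇒standard b d))
      ; functional-degree = functional-degree
      ; functional-killed = λ b std → functional-killed b (standard⇒divides b std)
      ; functional-at = functional-at
      ; functional≢0 = functional≢0
      }

  combination : ∀ {r} → List (Vec ℕ r × ℤ) → Fn r
  combination []            b = + 0
  combination ((m , w) ∷ t) b = w * δ m b + combination t b

  combination-support : ∀ {r p} {Q : Vec ℕ r → Set p} t → All (λ e → Q (proj₁ e)) t → ∀ b → ¬ Q b → combination t b ≡ + 0
  combination-support []            []       b ¬q = refl
  combination-support ((m , w) ∷ t) (q ∷ qs) b ¬q = cong₂ _+_ (trans (cong (w *_) (δ-≢ m b (λ { refl → ¬q q }))) (ℤₚ.*-zeroʳ w)) (combination-support t qs b ¬q)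

  module Base where

    m₁ m₂ : Vec ℕ 3
    m₁ = 1 ∷ 2 ∷ 3 ∷ []
    m₂ = 3 ∷ 2 ∷ 1 ∷ []

    socleData : SocleData 3 2
    socleData = record
      { monomials = m₁ ∷ m₂ ∷ []
      ; count = refl
      ; degree = 6
      ; pure = refl ∷ refl ∷ []
      ; distinct = ((λ ()) ∷ []) ∷ [] ∷ []
      ; covers = λ { zero → here (s≤s z≤n) ; (suc zero) → here (s≤s z≤n) ; (suc (suc zero)) → here (s≤s z≤n) }
      ; nonempty = m₁ , here refl
      }

    open SocleData socleData

    -- x² + z² − 3xy − 3yz + 2xz + 6y² is killed by (x + y + z)³: on the part symmetric under x ↔ z,
    -- the map from degree 2 to degree 5 goes from dimension 4 to dimension 3, on the antisymmetric
    -- part from dimension 2 to dimension 3.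
    kernelTable functionalTable : List (Vec ℕ 3 × ℤ)
    kernelTable = (2 ∷ 0 ∷ 0 ∷ [] , + 1) ∷ (0 ∷ 0 ∷ 2 ∷ [] , + 1) ∷ (1 ∷ 1 ∷ 0 ∷ [] , - (+ 3)) ∷ (0 ∷ 1 ∷ 1 ∷ [] , - (+ 3))
      ∷ (1 ∷ 0 ∷ 1 ∷ [] , + 2) ∷ (0 ∷ 2 ∷ 0 ∷ [] , + 6) ∷ []
    -- The signs alternate along x and z, so the transpose of x + z kills it. What remains of the
    -- cube is y³, whose transpose kills it because the exponent of y is 2 throughout.
    functionalTable = (3 ∷ 2 ∷ 0 ∷ [] , + 1) ∷ (2 ∷ 2 ∷ 1 ∷ [] , - (+ 1)) ∷ (1 ∷ 2 ∷ 2 ∷ [] , + 1) ∷ (0 ∷ 2 ∷ 3 ∷ [] , - (+ 1)) ∷ []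

    check-on-divisors : ∀ (f : Fn 3) → All (λ b → Divides b → f b ≡ + 0) (cube 3 6) → ∀ b → Divides b → f b ≡ + 0
    check-on-divisors f all b d = All.lookup all (∈-cube (entries≤deg b (bound d))) d
      where
      bound : Divides b → deg b ≤ 6
      bound (here l)         = deg-mono l
      bound (there (here l)) = deg-mono l

    kernel-check : All (λ b → Divides b → E^ 3 (combination kernelTable) b ≡ + 0) (cube 3 6)
    kernel-check = toWitness {a? = All.all? (λ b → divides? b →-dec (E^ 3 (combination kernelTable) b ℤ.≟ + 0)) (cube 3 6)} tt

    functional-check : All (λ b → Divides b → D^ 3 (combination functionalTable) b ≡ + 0) (cube 3 6)
    functional-check = toWitness {a? = All.all? (λ b → divides? b →-dec (D^ 3 (combination functionalTable) b ℤ.≟ + 0)) (cube 3 6)} tt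

    obstruction : Obstruction Divides 3 2
    obstruction = record
      { kernel = combination kernelTable
      ; kernel-degree = combination-support kernelTable (refl ∷ refl ∷ refl ∷ refl ∷ refl ∷ refl ∷ [])
      ; kernel-killed = check-on-divisors _ kernel-check
      ; kernel-at = 0 ∷ 2 ∷ 0 ∷ []
      ; kernel-at-P = here (z≤n ∷ s≤s (s≤s z≤n) ∷ z≤n ∷ [])
      ; kernel≢0 = λ ()
      ; functional = combination functionalTable
      ; functional-supp = combination-support functionalTable
          (toWitness {a? = All.all? (λ e → divides? (proj₁ e)) functionalTable} tt)
      ; functional-degree = combination-support functionalTable (refl ∷ refl ∷ refl ∷ refl ∷ [])
      ; functional-killed = check-on-divisors _ functional-check
      ; functional-at = 3 ∷ 2 ∷ 0 ∷ []
      ; functional≢0 = λ ()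
      }

  example₃₂ : Example 3 2 3
  example₃₂ = Base.socleData , 2 , Base.obstruction

  -- The tensor product with k[w]/(w^(k+1)): the socle keeps its dimension and moves up by `k`
  -- degrees.
  prepend : ∀ {r d} k → 1 ≤ k → SocleData r d → SocleData (suc r) d
  prepend k 1≤k sd = record
    { monomials = List.map (k ∷_) monomials
    ; count = trans (length-map (k ∷_) monomials) count
    ; degree = k ℕ.+ degree
    ; pure = Allₚ.map⁺ (All.map (cong (k ℕ.+_)) pure)
    ; distinct = Uniqueₚ.map⁺ ∷-injectiveʳ distinct
    ; covers = λ { zero → lose (∈-map⁺ (k ∷_) (proj₂ nonempty)) 1≤k ; (suc i) → Anyₚ.map⁺ (covers i) }
    ; nonempty = k ∷ proj₁ nonempty , ∈-map⁺ (k ∷_) (proj₂ nonempty)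
    }
    where open SocleData sd

  module _ {r d} (k : ℕ) (1≤k : 1 ≤ k) (sd : SocleData r d) where
    open SocleData

    prepend-divides : ∀ {x b} → x ≤ k → Divides sd b → Divides (prepend k 1≤k sd) (x ∷ b)
    prepend-divides l d = Anyₚ.map⁺ (Any.map (l ∷_) d)

    prepend-head : ∀ {x b} → Divides (prepend k 1≤k sd) (x ∷ b) → x ≤ k
    prepend-head d with find (Anyₚ.map⁻ d)
    ... | _ , _ , l ∷ _ = l

    prepend-tail : ∀ {x b} → Divides (prepend k 1≤k sd) (x ∷ b) → Divides sd b
    prepend-tail d = Any.map (λ { (_ ∷ l) → l }) (Anyₚ.map⁻ d)

  divides-closed : ∀ {r d} (sd : SocleData r d) → DownClosed (SocleData.Divides sd)
  divides-closed sd ab = Any.map (∣ₘ-trans ab)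

  D-off-support : ∀ {r d} (sd : SocleData r d) (φ : Fn r) → (∀ b → ¬ SocleData.Divides sd b → φ b ≡ + 0) → ∀ b → ¬ SocleData.Divides sd b → D φ b ≡ + 0
  D-off-support sd φ supp b ¬d = D-above φ b (λ b′ bb′ → supp b′ (λ d → ¬d (divides-closed sd bb′ d)))

  neg : ∀ {r} (f : Fn r) → Fn r
  neg f b = - (+ 1) * f b

  neg-zero : ∀ {r} (f : Fn r) b → f b ≡ + 0 → neg f b ≡ + 0
  neg-zero f b e = trans (cong (- (+ 1) *_) e) refl

  cancel-neg : ∀ a → a + - (+ 1) * a ≡ + 0
  cancel-neg = solve-∀

  -- An algebra on which L³ fails has, after adjoining a variable w with w³ = 0, a failure of multiplication
  -- by ℓ = L + w: if L³ f = 0, then ℓ kills L²f − wLf + w²f.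
  module AdjoinCube {r d} (sd : SocleData r d) {j} (ob : Obstruction (SocleData.Divides sd) 3 j) where
    open Obstruction ob
    open SocleData sd using (Divides)

    sd′ : SocleData (suc r) d
    sd′ = prepend 2 (s≤s z≤n) sd

    f φ : Fn r
    f = kernel
    φ = functional

    kernel′ functional′ : Fn (suc r)
    kernel′ (0 ∷ b) = E (E f) b
    kernel′ (1 ∷ b) = neg (E f) b
    kernel′ (2 ∷ b) = f b
    kernel′ (suc (suc (suc _)) ∷ b) = + 0
    -- The same recipe reflected by exchanging w^i and w^(2-i), since the transpose of
    -- multiplication by w lowers the exponent.
    functional′ (0 ∷ b) = φ b
    functional′ (1 ∷ b) = neg (D φ) b
    functional′ (2 ∷ b) = D (D φ) b
    functional′ (suc (suc (suc _)) ∷ b) = + 0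

    tail : ∀ {x b} → SocleData.Divides sd′ (x ∷ b) → Divides b
    tail = prepend-tail 2 (s≤s z≤n) sd

    killed : ∀ b → SocleData.Divides sd′ b → E kernel′ b ≡ + 0
    killed (0 ∷ b) p = trans (ℤₚ.+-identityˡ _) (kernel-killed b (tail p))
    killed (1 ∷ b) p = trans (+-right (E (E f) b) (E-scale (- (+ 1)) (E f) b)) (cancel-neg (E (E f) b))
    killed (2 ∷ b) p = trans (ℤₚ.+-comm (neg (E f) b) (E f b)) (cancel-neg (E f b))
    killed (suc (suc (suc _)) ∷ b) p = contradiction (prepend-head 2 (s≤s z≤n) sd p) λ { (s≤s (s≤s ())) }

    co-killed : ∀ b → SocleData.Divides sd′ b → D functional′ b ≡ + 0
    co-killed (0 ∷ b) p = trans (ℤₚ.+-comm (neg (D φ) b) (D φ b)) (cancel-neg (D φ b))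
    co-killed (1 ∷ b) p = trans (+-right (D (D φ) b) (D-scale (- (+ 1)) (D φ) b)) (cancel-neg (D (D φ) b))
    co-killed (2 ∷ b) p = trans (ℤₚ.+-identityˡ _) (functional-killed b (tail p))
    co-killed (suc (suc (suc _)) ∷ b) p = contradiction (prepend-head 2 (s≤s z≤n) sd p) λ { (s≤s (s≤s ())) }

    kernel′-degree : ∀ b → deg b ≢ j ℕ.+ 2 → kernel′ b ≡ + 0
    kernel′-degree (0 ∷ b) ne = E^-homogeneous 2 f j kernel-degree b ne
    kernel′-degree (1 ∷ b) ne = neg-zero (E f) b (E^-homogeneous 1 f j kernel-degree b (λ e → ne (trans (cong suc e) (sym (ℕₚ.+-suc j 1)))))
    kernel′-degree (2 ∷ b) ne = kernel-degree b (λ e → ne (trans (cong (λ t → suc (suc t)) e) (ℕₚ.+-comm 2 j)))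
    kernel′-degree (suc (suc (suc _)) ∷ b) ne = refl

    functional′-degree : ∀ b → deg b ≢ j ℕ.+ 2 ℕ.+ 1 → functional′ b ≡ + 0
    functional′-degree (0 ∷ b) ne = functional-degree b (λ e → ne (trans e (sym (ℕₚ.+-assoc j 2 1))))
    functional′-degree (1 ∷ b) ne = neg-zero (D φ) b (D-homogeneous φ b (λ b′ e → functional-degree b′ (λ e′ → ne (trans (sym e) (trans e′ (sym (ℕₚ.+-assoc j 2 1)))))))
    functional′-degree (2 ∷ b) ne = D^-homogeneous 2 φ (j ℕ.+ 1) (λ b ne → functional-degree b (λ e → ne (trans e (sym (ℕₚ.+-assoc j 1 2))))) b
      (λ e → ne (trans (cong (λ t → suc (suc t)) e) (go j)))
      where
      go : ∀ j → suc (suc (j ℕ.+ 1)) ≡ j ℕ.+ 2 ℕ.+ 1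
      go = ℕSolver.solve-∀
    functional′-degree (suc (suc (suc _)) ∷ b) ne = refl

    functional′-supp : ∀ b → ¬ SocleData.Divides sd′ b → functional′ b ≡ + 0
    functional′-supp (0 ∷ b) ¬d = functional-supp b (λ d → ¬d (prepend-divides 2 (s≤s z≤n) sd z≤n d))
    functional′-supp (1 ∷ b) ¬d = neg-zero (D φ) b (D-off-support sd φ functional-supp b (λ d → ¬d (prepend-divides 2 (s≤s z≤n) sd (s≤s z≤n) d)))
    functional′-supp (2 ∷ b) ¬d = D-off-support sd (D φ) (D-off-support sd φ functional-supp) b (λ d → ¬d (prepend-divides 2 (s≤s z≤n) sd (s≤s (s≤s z≤n)) d))
    functional′-supp (suc (suc (suc _)) ∷ b) ¬d = refl

    example : Example (suc r) d 1
    example = sd′ , j ℕ.+ 2 , record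
      { kernel = kernel′
      ; kernel-degree = kernel′-degree
      ; kernel-killed = killed
      ; kernel-at = 2 ∷ kernel-at
      ; kernel-at-P = prepend-divides 2 (s≤s z≤n) sd ℕₚ.≤-refl kernel-at-P
      ; kernel≢0 = kernel≢0
      ; functional = functional′
      ; functional-supp = functional′-supp
      ; functional-degree = functional′-degree
      ; functional-killed = co-killed
      ; functional-at = 0 ∷ functional-at
      ; functional≢0 = functional≢0
      }

  module PrependPair {r d} (sd : SocleData r d) where
    open SocleData sd using (Divides)

    sd₁ : SocleData (suc r) d
    sd₁ = prepend 1 (s≤s z≤n) sd

    sd″ : SocleData (suc (suc r)) d
    sd″ = prepend 1 (s≤s z≤n) sd₁

    pair-divides : ∀ {x y b} → x ≤ 1 → y ≤ 1 → Divides b → SocleData.Divides sd″ (x ∷ y ∷ b)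
    pair-divides lx ly d = prepend-divides 1 (s≤s z≤n) sd₁ lx (prepend-divides 1 (s≤s z≤n) sd ly d)

    pair-tail : ∀ {x y b} → SocleData.Divides sd″ (x ∷ y ∷ b) → Divides b
    pair-tail p = prepend-tail 1 (s≤s z≤n) sd (prepend-tail 1 (s≤s z≤n) sd₁ p)

    pair-x : ∀ {x y b} → SocleData.Divides sd″ (x ∷ y ∷ b) → x ≤ 1
    pair-x p = prepend-head 1 (s≤s z≤n) sd₁ p

    pair-y : ∀ {x y b} → SocleData.Divides sd″ (x ∷ y ∷ b) → y ≤ 1
    pair-y p = prepend-head 1 (s≤s z≤n) sd (prepend-tail 1 (s≤s z≤n) sd₁ p)

    components : (f₀₀ f₁₀ f₀₁ f₁₁ : Fn r) → Fn (suc (suc r))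
    components f₀₀ f₁₀ f₀₁ f₁₁ (0 ∷ 0 ∷ b) = f₀₀ b
    components f₀₀ f₁₀ f₀₁ f₁₁ (1 ∷ 0 ∷ b) = f₁₀ b
    components f₀₀ f₁₀ f₀₁ f₁₁ (0 ∷ 1 ∷ b) = f₀₁ b
    components f₀₀ f₁₀ f₀₁ f₁₁ (1 ∷ 1 ∷ b) = f₁₁ b
    components f₀₀ f₁₀ f₀₁ f₁₁ _           = + 0

    module _ (f₀₀ f₁₀ f₀₁ f₁₁ : Fn r) where
      private
        F : Fn (suc (suc r))
        F = components f₀₀ f₁₀ f₀₁ f₁₁

      E-components : (∀ b → Divides b → E f₀₀ b ≡ + 0) → (∀ b → Divides b → f₀₀ b + E f₁₀ b ≡ + 0) →
        (∀ b → Divides b → f₀₀ b + E f₀₁ b ≡ + 0) → (∀ b → Divides b → f₀₁ b + (f₁₀ b + E f₁₁ b) ≡ + 0) →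
        ∀ b → SocleData.Divides sd″ b → E F b ≡ + 0
      E-components e₀₀ e₁₀ e₀₁ e₁₁ (0 ∷ 0 ∷ b) p = trans (ℤₚ.+-identityˡ _) (trans (ℤₚ.+-identityˡ _) (e₀₀ b (pair-tail p)))
      E-components e₀₀ e₁₀ e₀₁ e₁₁ (1 ∷ 0 ∷ b) p = trans (+-right (f₀₀ b) (ℤₚ.+-identityˡ (E f₁₀ b))) (e₁₀ b (pair-tail p))
      E-components e₀₀ e₁₀ e₀₁ e₁₁ (0 ∷ 1 ∷ b) p = trans (ℤₚ.+-identityˡ _) (e₀₁ b (pair-tail p))
      E-components e₀₀ e₁₀ e₀₁ e₁₁ (1 ∷ 1 ∷ b) p = e₁₁ b (pair-tail p)
      E-components e₀₀ e₁₀ e₀₁ e₁₁ (suc (suc x) ∷ y ∷ b) p = contradiction (pair-x p) λ { (s≤s ()) }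
      E-components e₀₀ e₁₀ e₀₁ e₁₁ (0 ∷ suc (suc y) ∷ b) p = contradiction (pair-y p) λ { (s≤s ()) }
      E-components e₀₀ e₁₀ e₀₁ e₁₁ (1 ∷ suc (suc y) ∷ b) p = contradiction (pair-y p) λ { (s≤s ()) }

      D-components : (∀ b → Divides b → f₁₀ b + (f₀₁ b + D f₀₀ b) ≡ + 0) → (∀ b → Divides b → f₁₁ b + D f₁₀ b ≡ + 0) →
        (∀ b → Divides b → f₁₁ b + D f₀₁ b ≡ + 0) → (∀ b → Divides b → D f₁₁ b ≡ + 0) →
        ∀ b → SocleData.Divides sd″ b → D F b ≡ + 0
      D-components e₀₀ e₁₀ e₀₁ e₁₁ (0 ∷ 0 ∷ b) p = e₀₀ b (pair-tail p)
      D-components e₀₀ e₁₀ e₀₁ e₁₁ (1 ∷ 0 ∷ b) p = trans (ℤₚ.+-identityˡ _) (e₁₀ b (pair-tail p))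
      D-components e₀₀ e₁₀ e₀₁ e₁₁ (0 ∷ 1 ∷ b) p = trans (+-right (f₁₁ b) (ℤₚ.+-identityˡ (D f₀₁ b))) (e₀₁ b (pair-tail p))
      D-components e₀₀ e₁₀ e₀₁ e₁₁ (1 ∷ 1 ∷ b) p = trans (ℤₚ.+-identityˡ _) (trans (ℤₚ.+-identityˡ _) (e₁₁ b (pair-tail p)))
      D-components e₀₀ e₁₀ e₀₁ e₁₁ (suc (suc x) ∷ y ∷ b) p = contradiction (pair-x p) λ { (s≤s ()) }
      D-components e₀₀ e₁₀ e₀₁ e₁₁ (0 ∷ suc (suc y) ∷ b) p = contradiction (pair-y p) λ { (s≤s ()) }
      D-components e₀₀ e₁₀ e₀₁ e₁₁ (1 ∷ suc (suc y) ∷ b) p = contradiction (pair-y p) λ { (s≤s ()) }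

      components-degree : ∀ N → (∀ b → deg b ≢ N → f₀₀ b ≡ + 0) → (∀ b → suc (deg b) ≢ N → f₁₀ b ≡ + 0) → (∀ b → suc (deg b) ≢ N → f₀₁ b ≡ + 0) →
        (∀ b → suc (suc (deg b)) ≢ N → f₁₁ b ≡ + 0) → ∀ b → deg b ≢ N → F b ≡ + 0
      components-degree N e₀₀ e₁₀ e₀₁ e₁₁ (0 ∷ 0 ∷ b) = e₀₀ b
      components-degree N e₀₀ e₁₀ e₀₁ e₁₁ (1 ∷ 0 ∷ b) = e₁₀ b
      components-degree N e₀₀ e₁₀ e₀₁ e₁₁ (0 ∷ 1 ∷ b) = e₀₁ b
      components-degree N e₀₀ e₁₀ e₀₁ e₁₁ (1 ∷ 1 ∷ b) = e₁₁ b
      components-degree N e₀₀ e₁₀ e₀₁ e₁₁ (suc (suc x) ∷ y ∷ b) _ = refl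
      components-degree N e₀₀ e₁₀ e₀₁ e₁₁ (0 ∷ suc (suc y) ∷ b) _ = refl
      components-degree N e₀₀ e₁₀ e₀₁ e₁₁ (1 ∷ suc (suc y) ∷ b) _ = refl

      components-support : (∀ b → ¬ Divides b → f₀₀ b ≡ + 0) → (∀ b → ¬ Divides b → f₁₀ b ≡ + 0) → (∀ b → ¬ Divides b → f₀₁ b ≡ + 0) →
        (∀ b → ¬ Divides b → f₁₁ b ≡ + 0) → ∀ b → ¬ SocleData.Divides sd″ b → F b ≡ + 0
      components-support e₀₀ e₁₀ e₀₁ e₁₁ (0 ∷ 0 ∷ b) ¬d = e₀₀ b (λ d → ¬d (pair-divides z≤n z≤n d))
      components-support e₀₀ e₁₀ e₀₁ e₁₁ (1 ∷ 0 ∷ b) ¬d = e₁₀ b (λ d → ¬d (pair-divides ℕₚ.≤-refl z≤n d))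
      components-support e₀₀ e₁₀ e₀₁ e₁₁ (0 ∷ 1 ∷ b) ¬d = e₀₁ b (λ d → ¬d (pair-divides z≤n ℕₚ.≤-refl d))
      components-support e₀₀ e₁₀ e₀₁ e₁₁ (1 ∷ 1 ∷ b) ¬d = e₁₁ b (λ d → ¬d (pair-divides ℕₚ.≤-refl ℕₚ.≤-refl d))
      components-support e₀₀ e₁₀ e₀₁ e₁₁ (suc (suc x) ∷ y ∷ b) _ = refl
      components-support e₀₀ e₁₀ e₀₁ e₁₁ (0 ∷ suc (suc y) ∷ b) _ = refl
      components-support e₀₀ e₁₀ e₀₁ e₁₁ (1 ∷ suc (suc y) ∷ b) _ = refl

  double : ∀ {r} → Fn r → Fn r
  double f b = + 2 * f b

  -- The same with two square-zero variables w, w′: here (w + w′)³ = 0.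
  module AdjoinPair³ {r d} (sd : SocleData r d) {j} (ob : Obstruction (SocleData.Divides sd) 3 j) where
    open Obstruction ob
    open PrependPair sd

    f φ : Fn r
    f = kernel
    φ = functional

    cancel-two : ∀ a → - (+ 1) * a + (- (+ 1) * a + + 2 * a) ≡ + 0
    cancel-two = solve-∀

    double-≢0 : ∀ {x} → x ≢ + 0 → + 2 * x ≢ + 0
    double-≢0 {x} ne e with ℤₚ.i*j≡0⇒i≡0∨j≡0 (+ 2) e
    ... | inj₂ z = ne z

    example : Example (suc (suc r)) d 1
    example = sd″ , j ℕ.+ 2 , record
      -- This is L²f - (w + w′)Lf + (w + w′)²f, and (w + w′)² = 2ww′ accounts for `double`.
      { kernel = components (E (E f)) (neg (E f)) (neg (E f)) (double f)
      ; kernel-degree = components-degree _ _ _ _ (j ℕ.+ 2) (E^-homogeneous 2 f j kernel-degree) middle middle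
          (λ b ne → trans (cong (+ 2 *_) (kernel-degree b (λ e → ne (trans (cong (λ t → suc (suc t)) e) (ℕₚ.+-comm 2 j))))) refl)
      ; kernel-killed = E-components _ _ _ _ kernel-killed step step
          (λ b _ → trans (+-right (neg (E f) b) (+-right (neg (E f) b) (E-scale (+ 2) f b))) (cancel-two (E f b)))
      ; kernel-at = 1 ∷ 1 ∷ kernel-at
      ; kernel-at-P = pair-divides ℕₚ.≤-refl ℕₚ.≤-refl kernel-at-P
      ; kernel≢0 = double-≢0 kernel≢0
      ; functional = components (double φ) (neg (D φ)) (neg (D φ)) (D (D φ))
      ; functional-supp = components-support _ _ _ _ (λ b ¬d → trans (cong (+ 2 *_) (functional-supp b ¬d)) refl)
          (λ b ¬d → neg-zero (D φ) b (off b ¬d)) (λ b ¬d → neg-zero (D φ) b (off b ¬d)) (D-off-support sd (D φ) off)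
      ; functional-degree = components-degree _ _ _ _ (j ℕ.+ 2 ℕ.+ 1)
          (λ b ne → trans (cong (+ 2 *_) (functional-degree b (λ e → ne (trans e (sym (ℕₚ.+-assoc j 2 1)))))) refl) co-middle co-middle
          (λ b ne → D^-homogeneous 2 φ (j ℕ.+ 1) (λ b ne → functional-degree b (λ e → ne (trans e (sym (ℕₚ.+-assoc j 1 2))))) b
            (λ e → ne (trans (cong (λ t → suc (suc t)) e) (go j))))
      ; functional-killed = D-components _ _ _ _
          (λ b _ → trans (+-right (neg (D φ) b) (+-right (neg (D φ) b) (D-scale (+ 2) φ b))) (cancel-two (D φ b))) co-step co-step functional-killed
      ; functional-at = 0 ∷ 0 ∷ functional-at
      ; functional≢0 = double-≢0 functional≢0
      }
      where
      go : ∀ j → suc (suc (j ℕ.+ 1)) ≡ j ℕ.+ 2 ℕ.+ 1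
      go = ℕSolver.solve-∀
      off : ∀ b → ¬ SocleData.Divides sd b → D φ b ≡ + 0
      off = D-off-support sd φ functional-supp
      middle : ∀ b → suc (deg b) ≢ j ℕ.+ 2 → neg (E f) b ≡ + 0
      middle b ne = neg-zero (E f) b (E^-homogeneous 1 f j kernel-degree b (λ e → ne (trans (cong suc e) (sym (ℕₚ.+-suc j 1)))))
      step : ∀ b → SocleData.Divides sd b → E (E f) b + E (neg (E f)) b ≡ + 0
      step b _ = trans (+-right (E (E f) b) (E-scale (- (+ 1)) (E f) b)) (cancel-neg (E (E f) b))
      co-middle : ∀ b → suc (deg b) ≢ j ℕ.+ 2 ℕ.+ 1 → neg (D φ) b ≡ + 0
      co-middle b ne = neg-zero (D φ) b (D-homogeneous φ b (λ b′ e → functional-degree b′ (λ e′ → ne (trans (sym e) (trans e′ (sym (ℕₚ.+-assoc j 2 1)))))))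
      co-step : ∀ b → SocleData.Divides sd b → D (D φ) b + D (neg (D φ)) b ≡ + 0
      co-step b _ = trans (+-right (D (D φ) b) (D-scale (- (+ 1)) (D φ) b)) (cancel-neg (D (D φ) b))

  -- Multiplying by w − w′, which w + w′ kills, raises the codimension by two.
  module AdjoinPair¹ {r d} (sd : SocleData r d) {j} (ob : Obstruction (SocleData.Divides sd) 1 j) where
    open Obstruction ob
    open PrependPair sd

    f φ none : Fn r
    f = kernel
    φ = functional
    none _ = + 0

    example : Example (suc (suc r)) d 1
    example = sd″ , suc j , record
      { kernel = components none f (neg f) none
      ; kernel-degree = components-degree _ _ _ _ (suc j) (λ _ _ → refl) (λ b ne → kernel-degree b (λ e → ne (cong suc e)))
          (λ b ne → neg-zero f b (kernel-degree b (λ e → ne (cong suc e)))) (λ _ _ → refl)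
      ; kernel-killed = E-components _ _ _ _ (λ b _ → E-zero b) (λ b d → trans (ℤₚ.+-identityˡ _) (kernel-killed b d))
          (λ b d → trans (ℤₚ.+-identityˡ _) (trans (E-scale (- (+ 1)) f b) (trans (cong (- (+ 1) *_) (kernel-killed b d)) refl)))
          (λ b _ → trans (+-right (neg f b) (trans (+-right (f b) (E-zero b)) (ℤₚ.+-identityʳ (f b)))) (trans (ℤₚ.+-comm (neg f b) (f b)) (cancel-neg (f b))))
      ; kernel-at = 1 ∷ 0 ∷ kernel-at
      ; kernel-at-P = pair-divides ℕₚ.≤-refl z≤n kernel-at-P
      ; kernel≢0 = kernel≢0
      ; functional = components none φ (neg φ) none
      ; functional-supp = components-support _ _ _ _ (λ _ _ → refl) functional-supp (λ b ¬d → neg-zero φ b (functional-supp b ¬d)) (λ _ _ → refl)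
      ; functional-degree = components-degree _ _ _ _ (suc j ℕ.+ 1) (λ _ _ → refl) (λ b ne → functional-degree b (λ e → ne (cong suc e)))
          (λ b ne → neg-zero φ b (functional-degree b (λ e → ne (cong suc e)))) (λ _ _ → refl)
      ; functional-killed = D-components _ _ _ _
          (λ b _ → trans (+-right (φ b) (trans (+-right (neg φ b) (D-zero b)) (ℤₚ.+-identityʳ (neg φ b)))) (cancel-neg (φ b)))
          (λ b d → trans (ℤₚ.+-identityˡ _) (functional-killed b d))
          (λ b d → trans (ℤₚ.+-identityˡ _) (trans (D-scale (- (+ 1)) φ b) (trans (cong (- (+ 1) *_) (functional-killed b d)) refl)))
          (λ b _ → D-zero b)
      ; functional-at = 1 ∷ 0 ∷ functional-at
      ; functional≢0 = functional≢0
      }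

  -- Adjoining a pair to a failure of L itself raises the codimension by two, so each parity needs
  -- its own start: one cube-zero variable gives codimension 4, a square-zero pair gives 5.
  example-type-two : ∀ n → Example (4 ℕ.+ n) 2 1
  example-type-two zero          = AdjoinCube.example Base.socleData Base.obstruction
  example-type-two (suc zero)    = AdjoinPair³.example Base.socleData Base.obstruction
  example-type-two (suc (suc n)) = let (sd , j , ob) = example-type-two n in AdjoinPair¹.example sd ob

-- Failing algebras of type at least three.

module PlanarExamples where
  open import Data.Integer using (_+_; _*_; -_; _-_)
  open ℤSolver using (solve-∀)
  open ≡ using (refl; sym; trans; cong; cong₂; subst)
  open Vecₚ using (≡-dec; ∷-injectiveˡ; lookup-replicate)
  open Listₚ using (length-map; length-upTo)
  open IntegerOperators
  open FieldTransfer using (E-homogeneous)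
  open CompleteIntersections using (D-homogeneous; deg-mono)
  open TwoVariables using (sgn; sgn-square)
  open LevelAlgebras using (SocleData; zeros; deg-zeros)
  open Examples using (Example)

  replicate-deg : ∀ r k → deg (Vec.replicate r k) ≡ r ℕ.* k
  replicate-deg zero    k = refl
  replicate-deg (suc r) k = cong (k ℕ.+_) (replicate-deg r k)

  E-δ-low : ∀ {r} (a b : Vec ℕ r) → deg b ≤ deg a → E (δ a) b ≡ + 0
  E-δ-low a b l = E-homogeneous (δ a) b (λ b′ e → δ-≢ a b′ (λ { refl → ℕₚ.<-irrefl refl (ℕₚ.≤-trans (ℕₚ.≤-reflexive e) l) }))

  D-δ-zeros : ∀ {r} (b : Vec ℕ r) → D (δ (zeros r)) b ≡ + 0
  D-δ-zeros {r} b = D-homogeneous (δ (zeros r)) b (λ b′ e → δ-≢ (zeros r) b′ (λ { refl → ℕₚ.0≢1+n (trans (sym (deg-zeros r)) e) }))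

  -- Socle monomials: enough monomials in x and y to have all of k[x,y] in degree N, where it is not in the
  -- image of L, and one monomial x^k y^k w₁⋯w_r, whose submodule generated by w₁⋯w_r contains
  -- the kernel element w₁⋯w_r Σ (−1)^i x^i y^(k−i) in degree N − 1.
  module Planar (r″ extra : ℕ) where

    r′ k′ k N e : ℕ
    r′ = suc r″
    -- `k′` is at least `extra`, which keeps the `planar` monomials distinct from the others, and at
    -- least r′ + 2, so that N ≤ 2k′ and every x^i y^(N-i) divides `first` or `second`. `N` is one
    -- more than the degree r′ + k of the kernel element, and `e` equals the degree 2k + r′ of
    -- `third`.
    k′ = r′ ℕ.+ 2 ℕ.+ extra
    k  = suc k′
    N  = r′ ℕ.+ 2 ℕ.+ k′
    e  = N ℕ.+ k′

    O W : Vec ℕ r′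
    O = zeros r′
    W = Vec.replicate r′ 1

    deg-W : deg W ≡ r′
    deg-W = trans (replicate-deg r′ 1) (ℕₚ.*-identityʳ r′)

    planar : ℕ → Vec ℕ (2 ℕ.+ r′)
    planar i = i ∷ e ∸ i ∷ O

    first second third : Vec ℕ (2 ℕ.+ r′)
    first  = N ∷ k′ ∷ O
    second = k′ ∷ N ∷ O
    third  = k ∷ k ∷ W

    monomials : List (Vec ℕ (2 ℕ.+ r′))
    monomials = first ∷ second ∷ third ∷ List.map planar (upTo extra)

    extra≤k′ : extra ≤ k′
    extra≤k′ = ℕₚ.m≤n+m extra (r′ ℕ.+ 2)

    k<N : k < N
    k<N = ℕₚ.≤-trans (s≤s (ℕₚ.m≤n+m k (suc r″))) (ℕₚ.≤-reflexive (go r″ k′))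
      where
      go : ∀ r k → suc (suc r ℕ.+ suc k) ≡ suc r ℕ.+ 2 ℕ.+ k
      go = ℕSolver.solve-∀

    planar-deg : ∀ {i} → i < extra → deg (planar i) ≡ e
    planar-deg {i} l = trans (cong (λ t → i ℕ.+ (e ∸ i ℕ.+ t)) (deg-zeros r′)) (trans (cong (i ℕ.+_) (ℕₚ.+-identityʳ (e ∸ i)))
      (ℕₚ.m+[n∸m]≡n (ℕₚ.≤-trans (ℕₚ.<⇒≤ l) (ℕₚ.≤-trans extra≤k′ (ℕₚ.m≤n+m k′ N)))))

    socleData : SocleData (2 ℕ.+ r′) (3 ℕ.+ extra)
    socleData = record
      { monomials = monomials
      ; count = cong (3 ℕ.+_) (trans (length-map planar (upTo extra)) (length-upTo extra))
      ; degree = e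
      ; pure = cong (N ℕ.+_) (trans (cong (k′ ℕ.+_) (deg-zeros r′)) (ℕₚ.+-identityʳ k′))
          ∷ trans (cong (λ t → k′ ℕ.+ (N ℕ.+ t)) (deg-zeros r′)) (go₁ k′ N)
          ∷ trans (cong (λ t → k ℕ.+ (k ℕ.+ t)) deg-W) (go₂ r′ k′)
          ∷ Allₚ.map⁺ (All.tabulate (λ i∈ → planar-deg (∈-upTo⁻ i∈)))
      ; distinct = (head≢ (ℕₚ.>⇒≢ (ℕₚ.<-trans (ℕₚ.n<1+n k′) k<N)) ∷ head≢ (ℕₚ.>⇒≢ k<N) ∷ planar≢ (ℕₚ.m≤n+m k′ (r′ ℕ.+ 2)))
          ∷ (head≢ (ℕₚ.<⇒≢ (ℕₚ.n<1+n k′)) ∷ planar≢ ℕₚ.≤-refl)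
          ∷ planar≢ (ℕₚ.n≤1+n k′)
          ∷ Uniqueₚ.map⁺ ∷-injectiveˡ (Uniqueₚ.upTo⁺ extra)
      ; covers = λ { zero → here (s≤s z≤n) ; (suc zero) → here (s≤s z≤n)
          ; (suc (suc i)) → there (there (here (ℕₚ.≤-reflexive (sym (lookup-replicate i 1))))) }
      ; nonempty = first , here refl
      }
      where
      go₁ : ∀ k n → k ℕ.+ (n ℕ.+ 0) ≡ n ℕ.+ k
      go₁ = ℕSolver.solve-∀
      go₂ : ∀ r k → suc k ℕ.+ (suc k ℕ.+ r) ≡ r ℕ.+ 2 ℕ.+ k ℕ.+ k
      go₂ = ℕSolver.solve-∀
      head≢ : ∀ {n x y} {a b : Vec ℕ n} → x ≢ y → x ∷ a ≢ y ∷ b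
      head≢ ne eq = ne (∷-injectiveˡ eq)
      planar≢ : ∀ {x} {a : Vec ℕ (suc r′)} → k′ ≤ x → All (x ∷ a ≢_) (List.map planar (upTo extra))
      planar≢ l = Allₚ.map⁺ (All.tabulate (λ i∈ → head≢ (ℕₚ.>⇒≢ (ℕₚ.≤-trans (∈-upTo⁻ i∈) (ℕₚ.≤-trans extra≤k′ l)))))

    open SocleData socleData using (Divides)

    divides-cases : ∀ {x y w} → Divides (x ∷ y ∷ w) → w ∣ₘ O ⊎ (x ≤ k × y ≤ k × w ∣ₘ W)
    divides-cases (here (_ ∷ _ ∷ l))                   = inj₁ l
    divides-cases (there (here (_ ∷ _ ∷ l)))           = inj₁ l
    divides-cases (there (there (here (lx ∷ ly ∷ l)))) = inj₂ (lx , ly , l)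
    divides-cases (there (there (there d))) with find (Anyₚ.map⁻ d)
    ... | _ , _ , _ ∷ _ ∷ l = inj₁ l

    w≤W : ∀ {x y w} → Divides (x ∷ y ∷ w) → deg w ≤ deg W
    w≤W d with divides-cases d
    ... | inj₁ l           = ℕₚ.≤-trans (deg-mono l) (ℕₚ.≤-trans (ℕₚ.≤-reflexive (deg-zeros r′)) z≤n)
    ... | inj₂ (_ , _ , l) = deg-mono l

    alternating : ℕ → ℕ → ℕ → ℤ
    alternating n x y = δℕ n (x ℕ.+ y) * sgn x

    family : ℕ → Vec ℕ r′ → Fn (2 ℕ.+ r′)
    family n v (x ∷ y ∷ w) = alternating n x y * δ v w

    family-vanishes : ∀ n v x y w → ¬ (x ℕ.+ y ≡ n × w ≡ v) → family n v (x ∷ y ∷ w) ≡ + 0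
    family-vanishes n v x y w no-match with n ℕ.≟ x ℕ.+ y | ≡-dec ℕ._≟_ v w
    ... | no ne | _      = trans (cong (λ t → t * sgn x * δ v w) (δℕ-≢ n (x ℕ.+ y) ne)) refl
    ... | yes _ | no ne  = trans (cong (alternating n x y *_) (δ-≢ v w ne)) (ℤₚ.*-zeroʳ (alternating n x y))
    ... | yes p | yes q  = contradiction (sym p , sym q) no-match

    family≢0 : ∀ n v → family n v (n ∷ 0 ∷ v) ≢ + 0
    family≢0 n v e₀ = contradiction (trans (sym (sgn-square n)) (trans (cong (sgn n *_) sgn≡0) (ℤₚ.*-zeroʳ (sgn n)))) λ ()
      where
      sgn≡0 : sgn n ≡ + 0
      sgn≡0 = trans (sym (trans (cong₂ (λ s t → s * sgn n * t) (trans (cong (δℕ n) (ℕₚ.+-identityʳ n)) (δℕ-refl n)) (δ-refl v)) (go (sgn n)))) e₀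
        where
        go : ∀ s → + 1 * s * + 1 ≡ s
        go = solve-∀

    -- The product has degree k + 1, and within the square [0, k]² a point of that degree has both
    -- lower neighbours, of opposite signs. Its only other coefficients, at the pure powers, lie
    -- outside the square.
    alternating-E : ∀ x y → x ≤ k → y ≤ k → prev (λ t → alternating k t y) x + prev (λ t → alternating k x t) y ≡ + 0
    alternating-E zero    zero    _  _  = refl
    alternating-E zero    (suc y) _  ly = trans (ℤₚ.+-identityˡ _) (cong (_* + 1) (δℕ-≢ k y (ℕₚ.>⇒≢ ly)))
    alternating-E (suc x) zero    lx _  = trans (ℤₚ.+-identityʳ _) (cong (_* sgn x) (δℕ-≢ k (x ℕ.+ 0) (ℕₚ.>⇒≢ (subst (_< k) (sym (ℕₚ.+-identityʳ x)) lx))))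
    alternating-E (suc x) (suc y) _  _  = trans (cong (λ n → δℕ k n * sgn x + δℕ k (suc x ℕ.+ y) * - sgn x) (ℕₚ.+-suc x y)) (go (δℕ k (suc x ℕ.+ y)) (sgn x))
      where
      go : ∀ d s → d * s + d * - s ≡ + 0
      go = solve-∀

    prev-scale : ∀ g a x → prev (λ t → g t * a) x ≡ prev g x * a
    prev-scale g a zero    = sym (ℤₚ.*-zeroˡ a)
    prev-scale g a (suc x) = refl

    kernel-killed : ∀ b → Divides b → E (family k W) b ≡ + 0
    kernel-killed (x ∷ y ∷ w) d = trans (cong₂ _+_ (prev-scale (λ t → alternating k t y) (δ W w) x)
        (cong₂ _+_ (prev-scale (λ t → alternating k x t) (δ W w) y) (trans (E-scale (alternating k x y) (δ W) w)
          (trans (cong (alternating k x y *_) (E-δ-low W w (w≤W d))) (ℤₚ.*-zeroʳ (alternating k x y))))))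
      (trans (arrange (prev (λ t → alternating k t y) x) (prev (λ t → alternating k x t) y) (δ W w)) (interior (divides-cases d)))
      where
      arrange : ∀ a b t → a * t + (b * t + + 0) ≡ (a + b) * t
      arrange = solve-∀
      interior : w ∣ₘ O ⊎ (x ≤ k × y ≤ k × w ∣ₘ W) → (prev (λ t → alternating k t y) x + prev (λ t → alternating k x t) y) * δ W w ≡ + 0
      interior (inj₁ l) = trans (cong ((prev (λ t → alternating k t y) x + prev (λ t → alternating k x t) y) *_) (δ-≢ W w (λ { refl → W∤O l }))) (ℤₚ.*-zeroʳ (prev (λ t → alternating k t y) x + prev (λ t → alternating k x t) y))
        where
        W∤O : ¬ (W ∣ₘ O)
        W∤O (() ∷ _)
      interior (inj₂ (lx , ly , _)) = trans (cong (_* δ W w) (alternating-E x y lx ly)) (ℤₚ.*-zeroˡ (δ W w))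

    functional-killed : ∀ b → Divides b → D (family N O) b ≡ + 0
    functional-killed (x ∷ y ∷ w) _ = trans (cong (λ t → family N O (suc x ∷ y ∷ w) + (family N O (x ∷ suc y ∷ w) + t))
        (trans (D-scale (alternating N x y) (δ O) w) (trans (cong (alternating N x y *_) (D-δ-zeros w)) (ℤₚ.*-zeroʳ (alternating N x y)))))
      (trans (cong (λ n → family N O (suc x ∷ y ∷ w) + (δℕ N n * sgn x * δ O w + + 0)) (ℕₚ.+-suc x y)) (go (δℕ N (suc x ℕ.+ y)) (sgn x) (δ O w)))
      where
      go : ∀ d s t → d * - s * t + (d * s * t + + 0) ≡ + 0
      go = solve-∀

    functional-support : ∀ b → ¬ Divides b → family N O b ≡ + 0
    functional-support (x ∷ y ∷ w) ¬d = family-vanishes N O x y w λ { (eq , refl) → ¬d (divisor eq (ℕₚ.≤-total x k′)) }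
      where
      divisor : x ℕ.+ y ≡ N → x ≤ k′ ⊎ k′ ≤ x → Divides (x ∷ y ∷ O)
      divisor eq (inj₁ l) = there (here (l ∷ ℕₚ.m+n≤o⇒n≤o x (ℕₚ.≤-reflexive eq) ∷ ∣ₘ-refl))
      divisor eq (inj₂ l) = here (ℕₚ.m+n≤o⇒m≤o x (ℕₚ.≤-reflexive eq) ∷ ℕₚ.+-cancelˡ-≤ k′ y k′ bound ∷ ∣ₘ-refl)
        where
        bound : k′ ℕ.+ y ≤ k′ ℕ.+ k′
        bound = ℕₚ.≤-trans (ℕₚ.+-monoˡ-≤ y l) (ℕₚ.≤-trans (ℕₚ.≤-reflexive eq) (ℕₚ.+-monoˡ-≤ k′ (ℕₚ.m≤m+n (r′ ℕ.+ 2) extra)))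

    j : ℕ
    j = r′ ℕ.+ k

    family-degree : ∀ n v b → deg b ≢ n ℕ.+ deg v → family n v b ≡ + 0
    family-degree n v (x ∷ y ∷ w) ne = family-vanishes n v x y w λ { (refl , refl) → ne (sym (ℕₚ.+-assoc x y (deg v))) }

    example : Example (2 ℕ.+ r′) (3 ℕ.+ extra) 1
    example = socleData , j , record
      { kernel = family k W
      ; kernel-degree = λ b ne → family-degree k W b (λ eq → ne (trans eq (trans (cong (k ℕ.+_) deg-W) (ℕₚ.+-comm k r′))))
      ; kernel-killed = kernel-killed
      ; kernel-at = k ∷ 0 ∷ W
      ; kernel-at-P = there (there (here (ℕₚ.≤-refl ∷ z≤n ∷ ∣ₘ-refl)))
      ; kernel≢0 = family≢0 k W
      ; functional = family N O
      ; functional-supp = functional-support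
      ; functional-degree = λ b ne → family-degree N O b (λ eq → ne (trans eq (trans (cong (N ℕ.+_) (deg-zeros r′)) (go r′ k′))))
      ; functional-killed = functional-killed
      ; functional-at = N ∷ 0 ∷ O
      ; functional≢0 = family≢0 N O
      }
      where
      go : ∀ r k → r ℕ.+ 2 ℕ.+ k ℕ.+ 0 ≡ r ℕ.+ suc k ℕ.+ 1
      go = ℕSolver.solve-∀

-- Assembly of the two equivalences.

open ≡ using (refl)
open FieldTransfer using (module OverField)
open TwoVariables using (lefschetz₁; lefschetz₂)
open CompleteIntersections using (lefschetz-box)
open ThreeVariables using (lefschetz₃)
open LevelAlgebras using (module Shape)
open Examples using (Example; example-obstructs; example₃₂; example-type-two)
open PlanarExamples using (module Planar)

module _ {c ℓ} (K : Field c ℓ) (char0 : CharZero K) where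
  open OverField K using (ones; transfer)

  SLP⇒WLP : ∀ {r} (gs : Gens r) → Algebra.SLP K gs → Algebra.WLP K gs
  SLP⇒WLP gs (L , slp) = L , λ j → slp j 1 (s≤s z≤n)

  slp-few-variables : ∀ r → 1 ≤ r → r ≤ 2 → (gs : Gens r) → Algebra.SLP K gs
  slp-few-variables 1 _ _ gs = ones , λ j s _ → transfer char0 gs s j (lefschetz₁ gs s j)
  slp-few-variables 2 _ _ gs = ones , λ j s _ → transfer char0 gs s j (lefschetz₂ gs s j)
  slp-few-variables (suc (suc (suc r))) _ (s≤s (s≤s ())) gs

  slp-type-one : ∀ r (gs : Gens r) → MonomialArtinianLevel K r 1 gs → Algebra.SLP K gs
  slp-type-one r gs lev = ones , λ j s _ → transfer char0 gs s j (lefschetz-box gs (proj₁ shape) (proj₁ (proj₂ shape)) (proj₂ (proj₂ shape)) s j)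
    where shape = Shape.type-one K gs lev

  wlp-three-two : (gs : Gens 3) → MonomialArtinianLevel K 3 2 gs → Algebra.WLP K gs
  wlp-three-two gs lev = build (Shape.type-two K gs lev)
    where
    build : (Σ (Vec ℕ 3) λ m → Σ (Vec ℕ 3) λ m′ → deg m ≡ deg m′ ×
      (∀ b → Standard gs b → (b ∣ₘ m) ⊎ (b ∣ₘ m′)) × (∀ b → (b ∣ₘ m) ⊎ (b ∣ₘ m′) → Standard gs b)) → Algebra.WLP K gs
    build (m , m′ , same , to , from) = ones , λ j → transfer char0 gs 1 j (lefschetz₃ gs m m′ same to from j)

  Fails : ℕ → ℕ → ℕ → Set _
  Fails r d s = Σ (Gens r) λ gs → MonomialArtinianLevel K r d gs × ∃ λ j → ∀ L → ¬ Algebra.MaxRank K gs L s j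

  no-wlp : ∀ {r d} → Example r d 1 → ¬ (∀ (gs : Gens r) → MonomialArtinianLevel K r d gs → Algebra.WLP K gs)
  no-wlp {r} {d} ex all = refute (example-obstructs K char0 ex)
    where
    refute : Fails r d 1 → ⊥
    refute (gs , lev , j , fails) = fails (proj₁ (all gs lev)) (proj₂ (all gs lev) j)

  no-slp : ∀ {r d s} → 1 ≤ s → Example r d s → ¬ (∀ (gs : Gens r) → MonomialArtinianLevel K r d gs → Algebra.SLP K gs)
  no-slp {r} {d} {s} 1≤s ex all = refute (example-obstructs K char0 ex)
    where
    refute : Fails r d s → ⊥
    refute (gs , lev , j , fails) = fails (proj₁ (all gs lev)) (proj₂ (all gs lev) j s 1≤s)

  necessary-wlp : ∀ r d → 1 ≤ d → (∀ (gs : Gens r) → MonomialArtinianLevel K r d gs → Algebra.WLP K gs) → r ≤ 2 ⊎ d ≡ 1 ⊎ (r ≡ 3 × d ≡ 2)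
  necessary-wlp 0 d _ all = inj₁ z≤n
  necessary-wlp 1 d _ all = inj₁ (s≤s z≤n)
  necessary-wlp 2 d _ all = inj₁ ℕₚ.≤-refl
  necessary-wlp (suc (suc (suc r))) 1 _ all = inj₂ (inj₁ refl)
  necessary-wlp 3 2 _ all = inj₂ (inj₂ (refl , refl))
  necessary-wlp (suc (suc (suc (suc r)))) 2 _ all = ⊥-elim (no-wlp (example-type-two r) all)
  necessary-wlp (suc (suc (suc r))) (suc (suc (suc d))) _ all = ⊥-elim (no-wlp (Planar.example r d) all)

  -- SLP contains WLP as the case s = 1, so only r = 3, d = 2 remains, where the failure of L³
  -- decides.
  necessary-slp : ∀ r d → 1 ≤ d → (∀ (gs : Gens r) → MonomialArtinianLevel K r d gs → Algebra.SLP K gs) → r ≤ 2 ⊎ d ≡ 1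
  necessary-slp r d 1≤d all with necessary-wlp r d 1≤d (λ gs lev → SLP⇒WLP gs (all gs lev))
  ... | inj₁ r≤2                  = inj₁ r≤2
  ... | inj₂ (inj₁ d≡1)           = inj₂ d≡1
  ... | inj₂ (inj₂ (refl , refl)) = ⊥-elim (no-slp (s≤s z≤n) example₃₂ all)

  sufficient-slp : ∀ r d → 1 ≤ r → r ≤ 2 ⊎ d ≡ 1 → ∀ (gs : Gens r) → MonomialArtinianLevel K r d gs → Algebra.SLP K gs
  sufficient-slp r d 1≤r (inj₁ r≤2)  gs _   = slp-few-variables r 1≤r r≤2 gs
  sufficient-slp r d 1≤r (inj₂ refl) gs lev = slp-type-one r gs lev

  sufficient-wlp : ∀ r d → 1 ≤ r → r ≤ 2 ⊎ d ≡ 1 ⊎ (r ≡ 3 × d ≡ 2) → ∀ (gs : Gens r) → MonomialArtinianLevel K r d gs → Algebra.WLP K gs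
  sufficient-wlp r d 1≤r (inj₁ r≤2)                  gs lev = SLP⇒WLP gs (sufficient-slp r d 1≤r (inj₁ r≤2) gs lev)
  sufficient-wlp r d 1≤r (inj₂ (inj₁ d≡1))           gs lev = SLP⇒WLP gs (sufficient-slp r d 1≤r (inj₂ d≡1) gs lev)
  sufficient-wlp r d 1≤r (inj₂ (inj₂ (refl , refl))) gs lev = wlp-three-two gs lev

theorem7p17 : ∀ {c ℓ} (K : Field c ℓ) → CharZero K → (r d : ℕ) → 1 ≤ r → 1 ≤ d →
    ((∀ (gs : Gens r) → MonomialArtinianLevel K r d gs → Algebra.WLP K gs)
      ⇔ (r ≤ 2 ⊎ d ≡ 1 ⊎ (r ≡ 3 × d ≡ 2)))
    × ((∀ (gs : Gens r) → MonomialArtinianLevel K r d gs → Algebra.SLP K gs)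
      ⇔ (r ≤ 2 ⊎ d ≡ 1))
theorem7p17 K char0 r d 1≤r 1≤d =
  mk⇔ (necessary-wlp K char0 r d 1≤d) (sufficient-wlp K char0 r d 1≤r) ,
  mk⇔ (necessary-slp K char0 r d 1≤d) (sufficient-slp K char0 r d 1≤r)
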